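{- ($\mathsf{ZF}$) A $\mathrm{CCC}_3$ notion of forcing cannot change cofinalities or collapse any cardinal $\kappa>\omega_1$; and if $\omega_1$ is regular, then a $\mathrm{CCC}_3$ notion of forcing does not change cofinalities or collapse cardinals at all.
   Context: A notion of forcing is a preordered set $\mathbb P$ with a maximum. Conditions are compatible if they have a common extension. $D\subseteq\mathbb P$ is predense if every $p\in\mathbb P$ is compatible with some member of $D$. $\mathbb P$ is $\mathrm{CCC}_3$ if every predense subset of $\mathbb P$ contains a countable predense subset. Here cardinals $\kappa$ are $\aleph$ numbers (well-ordered cardinals). A forcing collapses $\kappa$ if $\kappa$ is a cardinal in the ground model but not in the generic extension, and changes cofinalities if some limit ordinal has a different cofinality in the generic extension than in the ground model. -}

module Defs where

open import Level using (Level; suc)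
open import Data.Nat.Base as ℕ using (ℕ)
open import Data.Fin.Base using (Fin)
open import Data.Vec.Base using (Vec; _∷_; lookup)
open import Data.Product using (Σ; ∃; ∃-syntax; ∃₂; ∃!; _×_)
open import Data.Sum.Base using (_⊎_)
open import Function.Bundles using (_⇔_)
open import Relation.Nullary.Negation.Core using (¬_)
open import Relation.Binary.Structures using (IsEquivalence)

-- Structures for the language {∈, =}.  Equality is an arbitrary congruence,
-- since quotients of carriers are not available.
record Structure (ℓ : Level) : Set (suc ℓ) where
  infix 4 _∈_ _≈_
  field
    Carrier       : Set ℓ
    _≈_           : Carrier → Carrier → Set ℓ
    _∈_           : Carrier → Carrier → Set ℓ
    isEquivalence : IsEquivalence _≈_
    ∈-resp-≈      : ∀ {x x′ y y′} → x ≈ x′ → y ≈ y′ → x ∈ y → x′ ∈ y′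

-- First-order formulas with n free de Bruijn variables.  They are needed as
-- syntax because the two schemas of ZF range over first-order formulas only:
-- ranging over Agda predicates would give second-order ZF.
data Formula (n : ℕ) : Set where
  _∈̇_ _≐_         : Fin n → Fin n → Formula n
  ¬̇_              : Formula n → Formula n
  _∧̇_ _∨̇_ _⇒̇_   : Formula n → Formula n → Formula n
  ∀̇_ ∃̇_          : Formula (ℕ.suc n) → Formula n

module Sets {ℓ : Level} (M : Structure ℓ) where

  open Structure M

  Sat : ∀ {n} → Formula n → Vec Carrier n → Set ℓ
  Sat (i ∈̇ j)  ρ = lookup ρ i ∈ lookup ρ j
  Sat (i ≐ j)  ρ = lookup ρ i ≈ lookup ρ j
  Sat (¬̇ φ)    ρ = ¬ Sat φ ρ
  Sat (φ ∧̇ ψ)  ρ = Sat φ ρ × Sat ψ ρ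
  Sat (φ ∨̇ ψ)  ρ = Sat φ ρ ⊎ Sat ψ ρ
  Sat (φ ⇒̇ ψ)  ρ = Sat φ ρ → Sat ψ ρ
  Sat (∀̇ φ)    ρ = ∀ x → Sat φ (x ∷ ρ)
  Sat (∃̇ φ)    ρ = ∃[ x ] Sat φ (x ∷ ρ)

  infix 4 _⊆_ ⟨_,_⟩∈_

  _⊆_ : Carrier → Carrier → Set ℓ
  x ⊆ y = ∀ z → z ∈ x → z ∈ y

  Nonempty : Carrier → Set ℓ
  Nonempty x = ∃[ y ] y ∈ x

  -- s = y ∪ {y}
  IsSuccessorOf : Carrier → Carrier → Set ℓ
  IsSuccessorOf s y = ∀ z → z ∈ s ⇔ (z ∈ y ⊎ z ≈ y)

  -- z = {x, y}
  IsUnorderedPair : Carrier → Carrier → Carrier → Set ℓ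
  IsUnorderedPair z x y = ∀ w → w ∈ z ⇔ (w ≈ x ⊎ w ≈ y)

  -- z = {{x}, {x, y}}
  IsOrderedPair : Carrier → Carrier → Carrier → Set ℓ
  IsOrderedPair z x y =
    ∃₂ λ a b → IsUnorderedPair a x x × IsUnorderedPair b x y × IsUnorderedPair z a b

  ⟨_,_⟩∈_ : Carrier → Carrier → Carrier → Set ℓ
  ⟨ x , y ⟩∈ r = ∃[ z ] (IsOrderedPair z x y × z ∈ r)

  -- r ⊆ x × y
  IsRelation : Carrier → Carrier → Carrier → Set ℓ
  IsRelation r x y =
    ∀ z → z ∈ r → ∃₂ λ a b → IsOrderedPair z a b × a ∈ x × b ∈ y

  IsFunction : Carrier → Carrier → Carrier → Set ℓ
  IsFunction f x y =
    IsRelation f x y × (∀ a → a ∈ x → ∃! _≈_ λ b → ⟨ a , b ⟩∈ f)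

  IsInjection : Carrier → Carrier → Carrier → Set ℓ
  IsInjection f x y =
    IsFunction f x y × (∀ a a′ b → ⟨ a , b ⟩∈ f → ⟨ a′ , b ⟩∈ f → a ≈ a′)

  IsBijection : Carrier → Carrier → Carrier → Set ℓ
  IsBijection f x y =
    IsInjection f x y × (∀ b → b ∈ y → ∃[ a ] ⟨ a , b ⟩∈ f)

  IsTransitive : Carrier → Set ℓ
  IsTransitive x = ∀ y → y ∈ x → y ⊆ x

  IsWellOrderedBy∈ : Carrier → Set ℓ
  IsWellOrderedBy∈ x =
      (∀ a → a ∈ x → ¬ a ∈ a)
    × (∀ a b c → a ∈ x → b ∈ x → c ∈ x → a ∈ b → b ∈ c → a ∈ c)
    × (∀ a b → a ∈ x → b ∈ x → a ∈ b ⊎ a ≈ b ⊎ b ∈ a)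
    × (∀ s → s ⊆ x → Nonempty s → ∃[ m ] (m ∈ s × (∀ a → a ∈ s → m ∈ a ⊎ m ≈ a)))

  IsOrdinal : Carrier → Set ℓ
  IsOrdinal α = IsTransitive α × IsWellOrderedBy∈ α

  IsLimitOrdinal : Carrier → Set ℓ
  IsLimitOrdinal δ = IsOrdinal δ × Nonempty δ × (∀ β → ¬ IsSuccessorOf δ β)

  -- The least limit ordinal.
  Isω : Carrier → Set ℓ
  Isω w = IsLimitOrdinal w × (∀ n → n ∈ w → ¬ IsLimitOrdinal n)

  Countable : Carrier → Set ℓ
  Countable x = ∃₂ λ w f → Isω w × IsInjection f x w

  -- The least uncountable ordinal.
  Isω₁ : Carrier → Set ℓ
  Isω₁ α = IsOrdinal α × ¬ Countable α × (∀ β → β ∈ α → Countable β)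

  -- An ℵ number: an infinite initial ordinal.
  IsCardinal : Carrier → Set ℓ
  IsCardinal κ =
      IsOrdinal κ
    × (∃[ w ] (Isω w × w ⊆ κ))
    × (∀ α → α ∈ κ → ¬ (∃[ f ] IsBijection f α κ))

  HasCofinalMap : Carrier → Carrier → Set ℓ
  HasCofinalMap λ′ δ =
    ∃[ f ] (IsFunction f λ′ δ ×
      (∀ β → β ∈ δ → ∃₂ λ α γ → ⟨ α , γ ⟩∈ f × (β ∈ γ ⊎ β ≈ γ)))

  -- cf(δ) = λ′
  IsCofinalityOf : Carrier → Carrier → Set ℓ
  IsCofinalityOf λ′ δ =
      IsOrdinal λ′
    × HasCofinalMap λ′ δ
    × (∀ μ → μ ∈ λ′ → ¬ HasCofinalMap μ δ)

  IsRegular : Carrier → Set ℓ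
  IsRegular κ = IsLimitOrdinal κ × IsCofinalityOf κ κ

record IsModelOfZF {ℓ : Level} (M : Structure ℓ) : Set ℓ where
  open Structure M
  open Sets M
  field
    extensionality : ∀ x y → (∀ z → z ∈ x ⇔ z ∈ y) → x ≈ y
    foundation     : ∀ x → Nonempty x → ∃[ y ] (y ∈ x × (∀ z → z ∈ y → ¬ z ∈ x))
    pairing        : ∀ x y → ∃[ z ] IsUnorderedPair z x y
    union          : ∀ x → ∃[ u ] (∀ z → z ∈ u ⇔ (∃[ y ] (y ∈ x × z ∈ y)))
    powerset       : ∀ x → ∃[ p ] (∀ z → z ∈ p ⇔ z ⊆ x)
    infinity       : ∃[ x ] ((∃[ e ] (e ∈ x × ¬ Nonempty e)) ×
                             (∀ y → y ∈ x → ∃[ s ] (s ∈ x × IsSuccessorOf s y)))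
    separation     : ∀ {n} (φ : Formula (ℕ.suc n)) (ρ : Vec Carrier n) x →
                     ∃[ y ] (∀ z → z ∈ y ⇔ (z ∈ x × Sat φ (z ∷ ρ)))
    replacement    : ∀ {n} (φ : Formula (ℕ.suc (ℕ.suc n))) (ρ : Vec Carrier n) x →
                     (∀ a → a ∈ x → ∃! _≈_ λ b → Sat φ (a ∷ b ∷ ρ)) →
                     ∃[ y ] (∀ b → b ∈ y ⇔ (∃[ a ] (a ∈ x × Sat φ (a ∷ b ∷ ρ))))

-- A set P of M, preordered by a set of pairs ≤ of M, with a maximum.
-- Smaller conditions are stronger.
record ForcingNotion {ℓ : Level} (M : Structure ℓ) : Set ℓ where
  open Structure M
  open Sets M
  infix 4 _≼_
  field
    P ≤ : Carrier

  _≼_ : Carrier → Carrier → Set ℓ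
  q ≼ p = ⟨ q , p ⟩∈ ≤

  field
    relation   : IsRelation ≤ P P
    reflexive  : ∀ p → p ∈ P → p ≼ p
    transitive : ∀ p q r → p ≼ q → q ≼ r → p ≼ r
    maximum    : ∃[ 𝟙 ] (𝟙 ∈ P × (∀ p → p ∈ P → p ≼ 𝟙))

  Compatible : Carrier → Carrier → Set ℓ
  Compatible p q = ∃[ r ] (r ∈ P × r ≼ p × r ≼ q)

  IsPredense : Carrier → Set ℓ
  IsPredense D = D ⊆ P × (∀ p → p ∈ P → ∃[ d ] (d ∈ D × Compatible p d))

  IsDense : Carrier → Set ℓ
  IsDense D = D ⊆ P × (∀ p → p ∈ P → ∃[ d ] (d ∈ D × d ≼ p))

  CCC₃ : Set ℓ
  CCC₃ = ∀ D → IsPredense D → ∃[ C ] (C ⊆ D × Countable C × IsPredense C)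

  -- τ is a P-name when every element of τ is a pair (σ, p) with σ a P-name
  -- and p ∈ P.  M may be ill-founded from outside, so the recursion is carried
  -- out inside M: the set T witnesses that τ is hereditarily of this form.
  IsName : Carrier → Set ℓ
  IsName τ =
    ∃[ T ] (τ ∈ T × (∀ t → t ∈ T → IsRelation t T P))

module _ {ℓ : Level} (N : Structure ℓ) where
  open Structure N
  open Sets N

  -- x is the value of the name τ at G, where
  --   val(τ) = { val(σ) | (σ, p) ∈ τ for some p ∈ G }.
  -- Again the recursion is internal to N: f is a set function satisfying the
  -- recursion equation on a domain T that contains τ and is closed under
  -- passing to names occurring in its members.
  IsValueOf : (G τ x : Carrier) → Set ℓ
  IsValueOf G τ x =
    ∃[ T ] ∃[ Y ] ∃[ f ]
      ( IsFunction f T Y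
      × (∀ t σ p → t ∈ T → ⟨ σ , p ⟩∈ t → σ ∈ T)
      × (∀ t y → ⟨ t , y ⟩∈ f →
           ∀ w → w ∈ y ⇔ (∃₂ λ σ p → p ∈ G × ⟨ σ , p ⟩∈ t × ⟨ σ , w ⟩∈ f))
      × ⟨ τ , x ⟩∈ f )

-- A generic extension N = M[G]: a model of ZF of which M is a transitive
-- submodel (along ι), containing an M-generic filter G on ℙ, and all of whose
-- elements are values at G of ℙ-names from M.
record GenericExtension {ℓ : Level} (M : Structure ℓ) (ℙ : ForcingNotion M)
                        : Set (suc ℓ) where
  private module M = Structure M
  open ForcingNotion ℙ
  field
    N   : Structure ℓ
    zf  : IsModelOfZF N
  open Structure N
  field
    ι          : M.Carrier → Carrier
    ι-≈        : ∀ x y → x M.≈ y ⇔ ι x ≈ ι y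
    ι-∈        : ∀ x y → x M.∈ y ⇔ ι x ∈ ι y
    transitive-submodel : ∀ x y → y ∈ ι x → ∃[ z ] ι z ≈ y

    G          : Carrier
    G⊆P        : Sets._⊆_ N G (ι P)
    G-nonempty : Sets.Nonempty N G
    G-upward   : ∀ p q → p ≼ q → ι p ∈ G → ι q ∈ G
    G-directed : ∀ p q → ι p ∈ G → ι q ∈ G → ∃[ r ] (ι r ∈ G × r ≼ p × r ≼ q)
    G-generic  : ∀ D → IsDense D → ∃[ d ] (d M.∈ D × ι d ∈ G)

    generated  : ∀ x → ∃[ τ ] (IsName τ × IsValueOf N G (ι τ) x)

module _ {ℓ : Level} (M : Structure ℓ) (ℙ : ForcingNotion M) where
  open Structure M
  open Sets M
  open GenericExtension using (N; ι)

  Collapses : Carrier → Set (suc ℓ)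
  Collapses κ =
    IsCardinal κ × Σ (GenericExtension M ℙ) λ E → ¬ Sets.IsCardinal (N E) (ι E κ)

  ChangesCofinalities : Set (suc ℓ)
  ChangesCofinalities =
    ∃₂ λ δ λ′ → IsLimitOrdinal δ × IsCofinalityOf λ′ δ ×
      Σ (GenericExtension M ℙ) λ E →
        ∃[ μ ] (Sets.IsCofinalityOf (N E) μ (ι E δ) × ¬ Structure._≈_ (N E) μ (ι E λ′))

{-# OPTIONS --safe #-}

-- Let τ name a function f : α → δ of the extension.  The relation "q forces
-- σ = x̌", for names σ and ground model sets x, is a fixed point of a monotone
-- operator, so it is a set of the ground model, and ∈-induction on x shows that
-- val(σ) = x iff some q ∈ G forces it.  Hence some p₀ ∈ G forces the relevant
-- part of "τ is a function", and for each ξ < α a countable predense set of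
-- conditions deciding τ(ξ) below p₀ bounds the number of possible values: f is
-- covered by a ground model relation B ⊆ α × δ all of whose columns are countable.
--
-- If f is cofinal in δ and α < cf(δ), then either all columns are bounded and
-- their least bounds give a cofinal map from α to δ in the ground model, or some
-- column is unbounded, so that cf(δ) ≤ ω and α is finite.  Both are impossible.
-- If f maps α onto a cardinal κ > α, ω₁, then sending β to the least ξ with
-- β ∈ B_ξ and the order type of B_ξ ∩ β injects κ into α × ω₁ without any choice,
-- and this product embeds into max(α, ω₁) < κ by Gödel's ordering of pairs.
module Submission where

open import Defs
open import Level using (Level)
open import Data.Nat.Base as ℕ using (ℕ)
open import Data.Fin.Base using (Fin; zero; suc)
open import Data.Vec.Base using (Vec; []; _∷_; lookup)
open import Data.Product using (∃-syntax; ∃₂; ∃!; _×_; _,_; proj₁; proj₂)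
open import Data.Sum.Base using (_⊎_; inj₁; inj₂)
open import Data.Empty using (⊥; ⊥-elim)
open import Function.Base using (id)
open import Function.Bundles using (_⇔_; mk⇔; Equivalence)
open import Relation.Nullary using (yes; no)
open import Relation.Nullary.Negation.Core using (¬_)
open import Relation.Binary.Structures using (IsEquivalence)
open import Axiom.ExcludedMiddle using (ExcludedMiddle)
open Equivalence using (to; from)

-- Without choice the countable columns of a covering relation cannot be enumerated simultaneously,
-- so a countable union of them may be uncountable. No step passes through such a union:
-- cofinalities are treated column by column, and for cardinals the canonical order types below `ω₁`
-- replace enumerations. The embedding into `α × ω₁` says nothing when the cardinal is `ω₁` itself;
-- there regularity turns a collapse into a short cofinal map. The general forcing theorem is
-- avoided as well. A function between ground model ordinals is determined by the ground model pairs
-- that belong to it, so the only atomic statement to be forced is the equality of a name with a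
-- ground model set, restricted to a set of names and a transitive set of values. Every other use of
-- forcing is a density argument about this set relation. The models may be ill-founded, and their
-- two schemas cover first-order formulas only. Inductions therefore take place inside a model, and
-- each instance of separation or replacement comes with a formula built along with its predicate.

pattern v0 = zero
pattern v1 = suc v0
pattern v2 = suc v1
pattern v3 = suc v2
pattern v4 = suc v3
pattern v5 = suc v4
pattern v6 = suc v5
pattern v7 = suc v6
pattern v8 = suc v7

-- Renaming of variables in formulas.

lift : ∀ {m n} → (Fin m → Fin n) → Fin (ℕ.suc m) → Fin (ℕ.suc n)
lift f zero    = zero
lift f (suc i) = suc (f i)

rename : ∀ {m n} → (Fin m → Fin n) → Formula m → Formula n
rename f (i ∈̇ j) = f i ∈̇ f j
rename f (i ≐ j) = f i ≐ f j
rename f (¬̇ φ)   = ¬̇ rename f φ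
rename f (φ ∧̇ ψ) = rename f φ ∧̇ rename f ψ
rename f (φ ∨̇ ψ) = rename f φ ∨̇ rename f ψ
rename f (φ ⇒̇ ψ) = rename f φ ⇒̇ rename f ψ
rename f (∀̇ φ)   = ∀̇ rename (lift f) φ
rename f (∃̇ φ)   = ∃̇ rename (lift f) φ

-- Predicates defined by first-order formulas.

module Definability {ℓ : Level} (M : Structure ℓ) where
  open Structure M
  open Sets M
  open IsEquivalence isEquivalence

  lift-≈ : ∀ {m n} {f : Fin m → Fin n} {ρ : Vec Carrier m} {σ : Vec Carrier n} →
           (∀ i → lookup σ (f i) ≈ lookup ρ i) →
           ∀ x i → lookup (x ∷ σ) (lift f i) ≈ lookup (x ∷ ρ) i
  lift-≈ e x zero    = refl
  lift-≈ e x (suc i) = e i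

  -- The environments are compared up to `≈` rather than by identity, so that renaming by `id`
  -- already yields the invariance of definable predicates under `≈`.
  Sat-rename : ∀ {m n} (φ : Formula m) {f : Fin m → Fin n} {ρ : Vec Carrier m}
               {σ : Vec Carrier n} → (∀ i → lookup σ (f i) ≈ lookup ρ i) →
               Sat (rename f φ) σ ⇔ Sat φ ρ
  Sat-rename (i ∈̇ j) e = mk⇔ (∈-resp-≈ (e i) (e j)) (∈-resp-≈ (sym (e i)) (sym (e j)))
  Sat-rename (i ≐ j) e =
    mk⇔ (λ p → trans (sym (e i)) (trans p (e j))) (λ p → trans (e i) (trans p (sym (e j))))
  Sat-rename (¬̇ φ)   e =
    mk⇔ (λ p q → p (from (Sat-rename φ e) q)) (λ p q → p (to (Sat-rename φ e) q))
  Sat-rename (φ ∧̇ ψ) e =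
    mk⇔ (λ (p , q) → to (Sat-rename φ e) p , to (Sat-rename ψ e) q)
        (λ (p , q) → from (Sat-rename φ e) p , from (Sat-rename ψ e) q)
  Sat-rename (φ ∨̇ ψ) e =
    mk⇔ (λ { (inj₁ p) → inj₁ (to (Sat-rename φ e) p) ; (inj₂ q) → inj₂ (to (Sat-rename ψ e) q) })
        (λ { (inj₁ p) → inj₁ (from (Sat-rename φ e) p) ; (inj₂ q) → inj₂ (from (Sat-rename ψ e) q) })
  Sat-rename (φ ⇒̇ ψ) e =
    mk⇔ (λ p q → to (Sat-rename ψ e) (p (from (Sat-rename φ e) q)))
        (λ p q → from (Sat-rename ψ e) (p (to (Sat-rename φ e) q)))
  Sat-rename (∀̇ φ)   e =
    mk⇔ (λ p x → to (Sat-rename φ (lift-≈ e x)) (p x))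
        (λ p x → from (Sat-rename φ (lift-≈ e x)) (p x))
  Sat-rename (∃̇ φ)   e =
    mk⇔ (λ (x , p) → x , to (Sat-rename φ (lift-≈ e x)) p)
        (λ (x , p) → x , from (Sat-rename φ (lift-≈ e x)) p)

  -- A predicate takes the whole environment, so that binding a variable extends the vector exactly
  -- as in `Sat`. The formula is then assembled by the same combinators that spell out the
  -- predicate.
  record Definable {n : ℕ} (P : Vec Carrier n → Set ℓ) : Set ℓ where
    constructor definable
    field
      formula : Formula n
      sat     : ∀ ρ → Sat formula ρ ⇔ P ρ
  open Definable public

  module _ {n : ℕ} {P : Vec Carrier n → Set ℓ} (d : Definable P) where

    abstract
      resp : ∀ {ρ σ} → (∀ i → lookup ρ i ≈ lookup σ i) → P ρ → P σ
      resp {ρ} {σ} e p = to (sat d σ) (to (Sat-rename (formula d) {id} {σ} {σ} (λ _ → refl))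
        (from (Sat-rename (formula d) (λ i → sym (e i))) (from (sat d ρ) p)))

  resp₁ : ∀ {n} {P : Vec Carrier (ℕ.suc n) → Set ℓ} → Definable P →
          ∀ ρ {x y} → x ≈ y → P (x ∷ ρ) → P (y ∷ ρ)
  resp₁ d ρ e = resp d λ { zero → e ; (suc i) → refl }

  resp₂ : ∀ {n} {P : Vec Carrier (ℕ.suc (ℕ.suc n)) → Set ℓ} → Definable P →
          ∀ ρ {x x′ y y′} → x ≈ x′ → y ≈ y′ → P (x ∷ y ∷ ρ) → P (x′ ∷ y′ ∷ ρ)
  resp₂ d ρ e e′ = resp d λ { zero → e ; (suc zero) → e′ ; (suc (suc i)) → refl }

  private variable
    n : ℕ
    P Q : Vec Carrier n → Set ℓ

  infix  8 _∈ᵈ_ _≈ᵈ_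
  infixr 6 _∧ᵈ_
  infixr 5 _∨ᵈ_
  infixr 4 _⇒ᵈ_
  infix  3 _⇔ᵈ_

  abstract
    _∈ᵈ_ : (i j : Fin n) → Definable {n} (λ ρ → lookup ρ i ∈ lookup ρ j)
    i ∈ᵈ j = definable (i ∈̇ j) λ ρ → mk⇔ id id

    _≈ᵈ_ : (i j : Fin n) → Definable {n} (λ ρ → lookup ρ i ≈ lookup ρ j)
    i ≈ᵈ j = definable (i ≐ j) λ ρ → mk⇔ id id

    ¬ᵈ_ : Definable P → Definable (λ ρ → ¬ P ρ)
    ¬ᵈ d = definable (¬̇ formula d) λ ρ → mk⇔ (λ f p → f (from (sat d ρ) p)) (λ f p → f (to (sat d ρ) p))

    _∧ᵈ_ : Definable P → Definable Q → Definable (λ ρ → P ρ × Q ρ)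
    d ∧ᵈ e = definable (formula d ∧̇ formula e) λ ρ →
      mk⇔ (λ (p , q) → to (sat d ρ) p , to (sat e ρ) q) (λ (p , q) → from (sat d ρ) p , from (sat e ρ) q)

    _∨ᵈ_ : Definable P → Definable Q → Definable (λ ρ → P ρ ⊎ Q ρ)
    d ∨ᵈ e = definable (formula d ∨̇ formula e) λ ρ →
      mk⇔ (λ { (inj₁ p) → inj₁ (to (sat d ρ) p) ; (inj₂ q) → inj₂ (to (sat e ρ) q) })
          (λ { (inj₁ p) → inj₁ (from (sat d ρ) p) ; (inj₂ q) → inj₂ (from (sat e ρ) q) })

    _⇒ᵈ_ : Definable P → Definable Q → Definable (λ ρ → P ρ → Q ρ)
    d ⇒ᵈ e = definable (formula d ⇒̇ formula e) λ ρ →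
      mk⇔ (λ f p → to (sat e ρ) (f (from (sat d ρ) p))) (λ f p → from (sat e ρ) (f (to (sat d ρ) p)))

    _⇔ᵈ_ : Definable P → Definable Q → Definable (λ ρ → P ρ ⇔ Q ρ)
    d ⇔ᵈ e = definable (formula ((d ⇒ᵈ e) ∧ᵈ (e ⇒ᵈ d))) λ ρ →
      mk⇔ (λ s → let f , g = to (sat ((d ⇒ᵈ e) ∧ᵈ (e ⇒ᵈ d)) ρ) s in mk⇔ f g)
          (λ s → from (sat ((d ⇒ᵈ e) ∧ᵈ (e ⇒ᵈ d)) ρ) (to s , from s))

    ∀ᵈ_ : {P : Vec Carrier (ℕ.suc n) → Set ℓ} → Definable P → Definable {n} (λ ρ → ∀ x → P (x ∷ ρ))
    ∀ᵈ d = definable (∀̇ formula d) λ ρ →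
      mk⇔ (λ f x → to (sat d (x ∷ ρ)) (f x)) (λ f x → from (sat d (x ∷ ρ)) (f x))

    ∃ᵈ_ : {P : Vec Carrier (ℕ.suc n) → Set ℓ} → Definable P → Definable {n} (λ ρ → ∃[ x ] P (x ∷ ρ))
    ∃ᵈ d = definable (∃̇ formula d) λ ρ →
      mk⇔ (λ (x , p) → x , to (sat d (x ∷ ρ)) p) (λ (x , p) → x , from (sat d (x ∷ ρ)) p)

    ∃!ᵈ_ : {P : Vec Carrier (ℕ.suc n) → Set ℓ} → Definable P →
           Definable {n} (λ ρ → ∃! _≈_ λ x → P (x ∷ ρ))
    ∃!ᵈ d = definable
      -- In the uniqueness clause `v0` is the competitor and `v1` the witness, which `lift suc`
      -- skips in the second copy of the formula.
      (∃̇ (formula d ∧̇ (∀̇ (rename (lift suc) (formula d) ⇒̇ (v1 ≐ v0))))) λ ρ →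
      mk⇔ (λ (x , p , u) → x , to (sat d _) p , λ {y} q →
             u y (from (Sat-rename (formula d) (lift-≈ (λ _ → refl) y)) (from (sat d _) q)))
          (λ (x , p , u) → x , from (sat d _) p , λ y q →
             u (to (sat d _) (to (Sat-rename (formula d) (lift-≈ (λ _ → refl) y)) q)))

    -- The successive quantification ∃ b a over a set of pairs z leaves the
    -- environment b ∷ a ∷ z ∷ ρ.
    swapped : {P : Vec Carrier (ℕ.suc (ℕ.suc n)) → Set ℓ} → Definable P →
              Definable {ℕ.suc (ℕ.suc (ℕ.suc n))} (λ { (b ∷ a ∷ z ∷ ρ) → P (a ∷ b ∷ ρ) })
    swapped d = definable (rename (λ { zero → v1 ; (suc zero) → v0 ; (suc (suc i)) → suc (suc (suc i)) }) (formula d))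
      λ { (b ∷ a ∷ z ∷ ρ) →
        let e = Sat-rename (formula d) {ρ = a ∷ b ∷ ρ} (λ { zero → refl ; (suc zero) → refl ; (suc (suc i)) → refl })
        in mk⇔ (λ s → to (sat d _) (to e s)) (λ p → from e (from (sat d _) p)) }

    swap : ∀ {n} {P : Vec Carrier (ℕ.suc (ℕ.suc n)) → Set ℓ} → Definable P →
           Definable {ℕ.suc (ℕ.suc n)} (λ { (a ∷ b ∷ ρ) → P (b ∷ a ∷ ρ) })
    swap d = definable (rename (λ { zero → v1 ; (suc zero) → v0 ; (suc (suc i)) → suc (suc i) }) (formula d))
      λ { (a ∷ b ∷ ρ) →
        let e = Sat-rename (formula d) {ρ = b ∷ a ∷ ρ} (λ { zero → refl ; (suc zero) → refl ; (suc (suc i)) → refl })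
        in mk⇔ (λ s → to (sat d _) (to e s)) (λ p → from e (from (sat d _) p)) }

    unorderedPairᵈ : (z x y : Fin n) →
      Definable {n} (λ ρ → IsUnorderedPair (lookup ρ z) (lookup ρ x) (lookup ρ y))
    unorderedPairᵈ z x y = ∀ᵈ (v0 ∈ᵈ suc z ⇔ᵈ v0 ≈ᵈ suc x ∨ᵈ v0 ≈ᵈ suc y)

    orderedPairᵈ : (z x y : Fin n) →
      Definable {n} (λ ρ → IsOrderedPair (lookup ρ z) (lookup ρ x) (lookup ρ y))
    orderedPairᵈ z x y = ∃ᵈ (∃ᵈ (unorderedPairᵈ v1 (suc (suc x)) (suc (suc x))
      ∧ᵈ unorderedPairᵈ v0 (suc (suc x)) (suc (suc y)) ∧ᵈ unorderedPairᵈ (suc (suc z)) v1 v0))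

    ⟨_,_⟩∈ᵈ_ : (x y r : Fin n) → Definable {n} (λ ρ → ⟨ lookup ρ x , lookup ρ y ⟩∈ lookup ρ r)
    ⟨ x , y ⟩∈ᵈ r = ∃ᵈ (orderedPairᵈ v0 (suc x) (suc y) ∧ᵈ v0 ∈ᵈ suc r)

    functionᵈ : (f x y : Fin n) →
      Definable {n} (λ ρ → IsFunction (lookup ρ f) (lookup ρ x) (lookup ρ y))
    functionᵈ f x y =
      (∀ᵈ (v0 ∈ᵈ suc f ⇒ᵈ (∃ᵈ (∃ᵈ (orderedPairᵈ v2 v1 v0 ∧ᵈ v1 ∈ᵈ suc (suc (suc x)) ∧ᵈ v0 ∈ᵈ suc (suc (suc y)))))))
      ∧ᵈ (∀ᵈ (v0 ∈ᵈ suc x ⇒ᵈ (∃!ᵈ (⟨ v1 , v0 ⟩∈ᵈ suc (suc f)))))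

    injectionᵈ : (f x y : Fin n) →
      Definable {n} (λ ρ → IsInjection (lookup ρ f) (lookup ρ x) (lookup ρ y))
    injectionᵈ f x y = functionᵈ f x y ∧ᵈ (∀ᵈ (∀ᵈ (∀ᵈ
      (⟨ v2 , v0 ⟩∈ᵈ suc (suc (suc f)) ⇒ᵈ ⟨ v1 , v0 ⟩∈ᵈ suc (suc (suc f)) ⇒ᵈ v2 ≈ᵈ v1))))

-- Basic set theory inside a model of ZF.

module SetTheory {ℓ : Level} (em : ExcludedMiddle ℓ) (M : Structure ℓ) (zf : IsModelOfZF M) where
  open Structure M public
  open Sets M public
  open IsModelOfZF zf public
  open Definability M public
  open IsEquivalence isEquivalence public using (refl; sym; trans)

  abstract
    byContradiction : {A : Set ℓ} → ¬ ¬ A → A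
    byContradiction {A} ¬¬a with em {A}
    ... | yes a = a
    ... | no ¬a = ⊥-elim (¬¬a ¬a)

    ∈-respˡ : ∀ {x x′ y} → x ≈ x′ → x ∈ y → x′ ∈ y
    ∈-respˡ e = ∈-resp-≈ e refl

    ∈-respʳ : ∀ {x y y′} → y ≈ y′ → x ∈ y → x ∈ y′
    ∈-respʳ = ∈-resp-≈ refl

    comprehension : ∀ {n} {P : Vec Carrier (ℕ.suc n) → Set ℓ} → Definable P → ∀ ρ x →
                    ∃[ y ] (∀ z → z ∈ y ⇔ (z ∈ x × P (z ∷ ρ)))
    comprehension d ρ x = let y , y⇔ = separation (formula d) ρ x in y , λ z →
      mk⇔ (λ z∈y → let z∈x , s = to (y⇔ z) z∈y in z∈x , to (sat d _) s)
          (λ (z∈x , p) → from (y⇔ z) (z∈x , from (sat d _) p))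

    replacementᵈ : ∀ {n} {P : Vec Carrier (ℕ.suc (ℕ.suc n)) → Set ℓ} → Definable P → ∀ ρ x →
                 (∀ a → a ∈ x → ∃[ b ] P (a ∷ b ∷ ρ)) →
                 (∀ a b b′ → a ∈ x → P (a ∷ b ∷ ρ) → P (a ∷ b′ ∷ ρ) → b ≈ b′) →
                 ∃[ y ] (∀ b → b ∈ y ⇔ (∃[ a ] (a ∈ x × P (a ∷ b ∷ ρ))))
    replacementᵈ d ρ x total unique =
      let y , y⇔ = replacement (formula d) ρ x λ a a∈x →
            let b , p = total a a∈x in
            b , from (sat d _) p , λ {b′} s → unique a b b′ a∈x p (to (sat d _) s)
      in y , λ b → mk⇔ (λ b∈y → let a , a∈x , s = to (y⇔ b) b∈y in a , a∈x , to (sat d _) s)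
                       (λ (a , a∈x , p) → from (y⇔ b) (a , a∈x , from (sat d _) p))

    -- Relative to a set `X`, so that the counterexamples form a set by separation and foundation
    -- yields a minimal one.
    ∈-induction : ∀ {n} {P : Vec Carrier (ℕ.suc n) → Set ℓ} → Definable P → ∀ ρ X →
                  (∀ x → x ∈ X → (∀ y → y ∈ x → y ∈ X → P (y ∷ ρ)) → P (x ∷ ρ)) →
                  ∀ x → x ∈ X → P (x ∷ ρ)
    ∈-induction {P = P} d ρ X step x x∈X = byContradiction λ ¬p →
      let s , s⇔ = comprehension (¬ᵈ d) ρ X
          m , m∈s , m-min = foundation s (x , from (s⇔ x) (x∈X , ¬p))
          m∈X , ¬pm = to (s⇔ m) m∈s
      in ¬pm (step m m∈X λ y y∈m y∈X → byContradiction λ ¬py → m-min y y∈m (from (s⇔ y) (y∈X , ¬py)))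

    binaryUnion : ∀ x y → ∃[ u ] (∀ z → z ∈ u ⇔ (z ∈ x ⊎ z ∈ y))
    binaryUnion x y =
      let p , p⇔ = pairing x y
          u , u⇔ = union p
      in u , λ z → mk⇔
        (λ z∈u → let a , a∈p , z∈a = to (u⇔ z) z∈u in case-pair (to (p⇔ a) a∈p) z∈a)
        (λ { (inj₁ z∈x) → from (u⇔ z) (x , from (p⇔ x) (inj₁ refl) , z∈x)
           ; (inj₂ z∈y) → from (u⇔ z) (y , from (p⇔ y) (inj₂ refl) , z∈y) })
      where
      case-pair : ∀ {a z} → a ≈ x ⊎ a ≈ y → z ∈ a → z ∈ x ⊎ z ∈ y
      case-pair (inj₁ e) z∈a = inj₁ (∈-respʳ e z∈a)
      case-pair (inj₂ e) z∈a = inj₂ (∈-respʳ e z∈a)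

    successor : ∀ x → ∃[ s ] IsSuccessorOf s x
    successor x =
      let p , p⇔ = pairing x x
          u , u⇔ = binaryUnion x p
      in u , λ z → mk⇔
        (λ z∈u → case-union (to (u⇔ z) z∈u) (to (p⇔ z)))
        (λ { (inj₁ z∈x) → from (u⇔ z) (inj₁ z∈x) ; (inj₂ e) → from (u⇔ z) (inj₂ (from (p⇔ z) (inj₁ e))) })
      where
      case-union : ∀ {z p} → z ∈ x ⊎ z ∈ p → (z ∈ p → z ≈ x ⊎ z ≈ x) → z ∈ x ⊎ z ≈ x
      case-union (inj₁ z∈x) _ = inj₁ z∈x
      case-union (inj₂ z∈p) f with f z∈p
      ... | inj₁ e = inj₂ e
      ... | inj₂ e = inj₂ e

    ∈-acyclic₃ : ∀ {x y z} → x ∈ y → y ∈ z → z ∈ x → ⊥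
    ∈-acyclic₃ {x} {y} {z} x∈y y∈z z∈x =
      let p , p⇔ = pairing x y
          s , s⇔ = pairing z z
          u , u⇔ = binaryUnion p s
          x∈u = from (u⇔ x) (inj₁ (from (p⇔ x) (inj₁ refl)))
          y∈u = from (u⇔ y) (inj₁ (from (p⇔ y) (inj₂ refl)))
          z∈u = from (u⇔ z) (inj₂ (from (s⇔ z) (inj₁ refl)))
          m , m∈u , min = foundation u (x , x∈u)
          isz : m ≈ z → ⊥
          isz e = min y (∈-respʳ (sym e) y∈z) y∈u
          isxy : m ≈ x ⊎ m ≈ y → ⊥
          isxy = λ { (inj₁ e) → min z (∈-respʳ (sym e) z∈x) z∈u
                   ; (inj₂ e) → min x (∈-respʳ (sym e) x∈y) x∈u }
          cases : m ∈ p ⊎ m ∈ s → ⊥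
          cases = λ { (inj₁ m∈p) → isxy (to (p⇔ m) m∈p)
                    ; (inj₂ m∈s) → singleton (to (s⇔ m) m∈s) isz }
      in cases (to (u⇔ m) m∈u)
      where
      singleton : ∀ {m} → m ≈ z ⊎ m ≈ z → (m ≈ z → ⊥) → ⊥
      singleton (inj₁ e) f = f e
      singleton (inj₂ e) f = f e

    ∈-irrefl : ∀ {x} → ¬ x ∈ x
    ∈-irrefl x∈x = ∈-acyclic₃ x∈x x∈x x∈x

    ∈-asym : ∀ {x y} → x ∈ y → ¬ y ∈ x
    ∈-asym {x} {y} x∈y y∈x =
      let p , p⇔ = pairing x y
          x∈p = from (p⇔ x) (inj₁ refl)
          y∈p = from (p⇔ y) (inj₂ refl)
          m , m∈p , min = foundation p (x , x∈p)
          cases : m ≈ x ⊎ m ≈ y → ⊥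
          cases = λ { (inj₁ e) → min y (∈-respʳ (sym e) y∈x) y∈p
                    ; (inj₂ e) → min x (∈-respʳ (sym e) x∈y) x∈p }
      in cases (to (p⇔ m) m∈p)

    -- Ordered pairs and relations

    orderedPair : ∀ x y → ∃[ z ] IsOrderedPair z x y
    orderedPair x y =
      let a , a⇔ = pairing x x
          b , b⇔ = pairing x y
          z , z⇔ = pairing a b
      in z , a , b , a⇔ , b⇔ , z⇔

    unorderedPair-unique : ∀ {z z′ x y} → IsUnorderedPair z x y → IsUnorderedPair z′ x y → z ≈ z′
    unorderedPair-unique h h′ = extensionality _ _ λ w →
      mk⇔ (λ p → from (h′ w) (to (h w) p)) (λ p → from (h w) (to (h′ w) p))

    orderedPair-resp : ∀ {z z′ x x′ y y′} → z ≈ z′ → x ≈ x′ → y ≈ y′ →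
                       IsOrderedPair z x y → IsOrderedPair z′ x′ y′
    orderedPair-resp e₁ e₂ e₃ = resp (orderedPairᵈ v0 v1 v2) {_ ∷ _ ∷ _ ∷ []} {_ ∷ _ ∷ _ ∷ []}
      λ { v0 → e₁ ; v1 → e₂ ; v2 → e₃ }

    orderedPair-unique : ∀ {z z′ x y} → IsOrderedPair z x y → IsOrderedPair z′ x y → z ≈ z′
    orderedPair-unique (a , b , a⇔ , b⇔ , z⇔) (a′ , b′ , a′⇔ , b′⇔ , z′⇔) =
      unorderedPair-unique z⇔ λ w → resp (v0 ∈ᵈ v1 ⇔ᵈ (v0 ≈ᵈ v2 ∨ᵈ v0 ≈ᵈ v3))
        {w ∷ _ ∷ a′ ∷ b′ ∷ []} {w ∷ _ ∷ a ∷ b ∷ []}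
        (λ { v0 → refl ; v1 → refl ; v2 → unorderedPair-unique a′⇔ a⇔ ; v3 → unorderedPair-unique b′⇔ b⇔ })
        (z′⇔ w)

    -- Gives access to the coordinates through the union of the pair, without asking which of its
    -- members is the singleton. It settles the second coordinate in `orderedPair-injective`.
    components : ∀ {z x y} → IsOrderedPair z x y →
                 ∀ u → (∃[ v ] (v ∈ z × u ∈ v)) ⇔ (u ≈ x ⊎ u ≈ y)
    components {z} {x} {y} (a , b , a⇔ , b⇔ , z⇔) u = mk⇔ fwd bwd
      where
      fwd : (∃[ v ] (v ∈ z × u ∈ v)) → u ≈ x ⊎ u ≈ y
      fwd (v , v∈z , u∈v) with to (z⇔ v) v∈z
      ... | inj₂ e = to (b⇔ u) (∈-respʳ e u∈v)
      ... | inj₁ e with to (a⇔ u) (∈-respʳ e u∈v)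
      ... | inj₁ e′ = inj₁ e′
      ... | inj₂ e′ = inj₁ e′
      bwd : u ≈ x ⊎ u ≈ y → ∃[ v ] (v ∈ z × u ∈ v)
      bwd e = b , from (z⇔ b) (inj₂ refl) , from (b⇔ u) e

    orderedPair-injective : ∀ {z x y x′ y′} → IsOrderedPair z x y → IsOrderedPair z x′ y′ →
                            x ≈ x′ × y ≈ y′
    orderedPair-injective {z} {x} {y} {x′} {y′}
      h@(a , b , a⇔ , b⇔ , z⇔) h′@(a′ , b′ , a′⇔ , b′⇔ , z′⇔) = x≈x′ , y≈y′
      where
      x≈x′ : x ≈ x′
      x≈x′ with to (z′⇔ a) (from (z⇔ a) (inj₁ refl))
      ... | inj₁ e with to (a′⇔ x) (∈-respʳ e (from (a⇔ x) (inj₁ refl)))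
      ...   | inj₁ e′ = e′
      ...   | inj₂ e′ = e′
      x≈x′ | inj₂ e with to (a⇔ x′) (∈-respʳ (sym e) (from (b′⇔ x′) (inj₁ refl)))
      ...   | inj₁ e′ = sym e′
      ...   | inj₂ e′ = sym e′
      y≈y′ : y ≈ y′
      y≈y′ with to (components h′ y) (from (components h y) (inj₂ refl))
      ... | inj₂ e = e
      ... | inj₁ e with to (components h y′) (from (components h′ y′) (inj₂ refl))
      ...   | inj₂ e′ = sym e′
      ...   | inj₁ e′ = trans e (trans (sym x≈x′) (sym e′))

    pair∈ : ∀ {x y z r} → ⟨ x , y ⟩∈ r → IsOrderedPair z x y → z ∈ r
    pair∈ (z , h , z∈r) h′ = ∈-respˡ (orderedPair-unique h h′) z∈r

    ⟨,⟩∈-resp : ∀ {x x′ y y′ r} → x ≈ x′ → y ≈ y′ → ⟨ x , y ⟩∈ r → ⟨ x′ , y′ ⟩∈ r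
    ⟨,⟩∈-resp e e′ (z , h , z∈r) = z , orderedPair-resp refl e e′ h , z∈r

  IsProduct : Carrier → Carrier → Carrier → Set ℓ
  IsProduct p x y = ∀ z → z ∈ p ⇔ (∃₂ λ a b → IsOrderedPair z a b × a ∈ x × b ∈ y)

  abstract
    productᵈ : ∀ {n} (p x y : Fin n) → Definable {n} (λ ρ → IsProduct (lookup ρ p) (lookup ρ x) (lookup ρ y))
    productᵈ p x y = ∀ᵈ (v0 ∈ᵈ suc p ⇔ᵈ (∃ᵈ (∃ᵈ (orderedPairᵈ v2 v1 v0 ∧ᵈ v1 ∈ᵈ suc (suc (suc x)) ∧ᵈ v0 ∈ᵈ suc (suc (suc y))))))

    -- Places the pairs over `u` in the double power set of `u`, for products here and for
    -- `pair-universe` later.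
    orderedPair⊆ : ∀ {z a b u} → IsOrderedPair z a b → a ∈ u → b ∈ u → ∀ v → v ∈ z → v ⊆ u
    orderedPair⊆ h a∈u b∈u v v∈z t t∈v with to (components h t) (v , v∈z , t∈v)
    ... | inj₁ e = ∈-respˡ (sym e) a∈u
    ... | inj₂ e = ∈-respˡ (sym e) b∈u

    product : ∀ x y → ∃[ p ] IsProduct p x y
    product x y =
      let u , u⇔ = binaryUnion x y
          pu , pu⇔ = powerset u
          ppu , ppu⇔ = powerset pu
          p , p⇔ = comprehension (∃ᵈ (∃ᵈ (orderedPairᵈ v2 v1 v0 ∧ᵈ v1 ∈ᵈ v3 ∧ᵈ v0 ∈ᵈ v4))) (x ∷ y ∷ []) ppu
      in p , λ z → mk⇔ (λ z∈p → proj₂ (to (p⇔ z) z∈p))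
        (λ { h@(a , b , z≡ab , a∈x , b∈y) → from (p⇔ z) (from (ppu⇔ z) (λ v v∈z →
            from (pu⇔ v) (orderedPair⊆ z≡ab (from (u⇔ a) (inj₁ a∈x)) (from (u⇔ b) (inj₂ b∈y)) v v∈z)) , h) })

    relation-comprehension : ∀ {n} {P : Vec Carrier (ℕ.suc (ℕ.suc n)) → Set ℓ} → Definable P → ∀ ρ x y →
      ∃[ r ] (IsRelation r x y × (∀ a b → ⟨ a , b ⟩∈ r ⇔ (a ∈ x × b ∈ y × P (a ∷ b ∷ ρ))))
    relation-comprehension {P = P} d ρ x y =
      let p , p⇔ = product x y
          r , r⇔ = comprehension (∃ᵈ (∃ᵈ (orderedPairᵈ v2 v1 v0 ∧ᵈ swapped d))) ρ p
      in r , (λ z z∈r → to (p⇔ z) (proj₁ (to (r⇔ z) z∈r))) , λ a b → mk⇔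
        (λ (z , z≡ab , z∈r) →
          let z∈p , a′ , b′ , z≡a′b′ , q = to (r⇔ z) z∈r
              a″ , b″ , z≡a″b″ , a″∈x , b″∈y = to (p⇔ z) z∈p
              a′≈a , b′≈b = orderedPair-injective z≡a′b′ z≡ab
              a″≈a , b″≈b = orderedPair-injective z≡a″b″ z≡ab
          in ∈-respˡ a″≈a a″∈x , ∈-respˡ b″≈b b″∈y , resp₂ d ρ a′≈a b′≈b q)
        (λ (a∈x , b∈y , q) → let z , z≡ab = orderedPair a b in
          z , z≡ab , from (r⇔ z) (from (p⇔ z) (a , b , z≡ab , a∈x , b∈y) , a , b , z≡ab , q))

    relation-sides : ∀ {r x y a b} → IsRelation r x y → ⟨ a , b ⟩∈ r → a ∈ x × b ∈ y
    relation-sides rel (z , z≡ab , z∈r) =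
      let a′ , b′ , z≡a′b′ , a′∈x , b′∈y = rel z z∈r
          a′≈a , b′≈b = orderedPair-injective z≡a′b′ z≡ab
      in ∈-respˡ a′≈a a′∈x , ∈-respˡ b′≈b b′∈y

    -- Functions

    function-sides : ∀ {f x y a b} → IsFunction f x y → ⟨ a , b ⟩∈ f → a ∈ x × b ∈ y
    function-sides (rel , _) = relation-sides rel

    function-total : ∀ {f x y} → IsFunction f x y → ∀ a → a ∈ x → ∃[ b ] (b ∈ y × ⟨ a , b ⟩∈ f)
    function-total F@(_ , total) a a∈x = let b , ab∈f , _ = total a a∈x in b , proj₂ (function-sides F ab∈f) , ab∈f

    function-unique : ∀ {f x y a b b′} → IsFunction f x y → ⟨ a , b ⟩∈ f → ⟨ a , b′ ⟩∈ f → b ≈ b′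
    function-unique F@(_ , total) ab∈f ab′∈f =
      let _ , _ , unique = total _ (proj₁ (function-sides F ab∈f)) in trans (sym (unique ab∈f)) (unique ab′∈f)

    function-comprehension : ∀ {n} {P : Vec Carrier (ℕ.suc (ℕ.suc n)) → Set ℓ} → Definable P → ∀ ρ x y →
      (∀ a → a ∈ x → ∃[ b ] (b ∈ y × P (a ∷ b ∷ ρ))) →
      (∀ a b b′ → a ∈ x → b ∈ y → b′ ∈ y → P (a ∷ b ∷ ρ) → P (a ∷ b′ ∷ ρ) → b ≈ b′) →
      ∃[ f ] (IsFunction f x y × (∀ a b → ⟨ a , b ⟩∈ f ⇔ (a ∈ x × b ∈ y × P (a ∷ b ∷ ρ))))
    function-comprehension d ρ x y total unique =
      let f , rel , f⇔ = relation-comprehension d ρ x y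
      in f , (rel , λ a a∈x → let b , b∈y , p = total a a∈x in
           b , from (f⇔ a b) (a∈x , b∈y , p) , λ {b′} ab′∈f →
             let _ , b′∈y , p′ = to (f⇔ a b′) ab′∈f in unique a b b′ a∈x b∈y b′∈y p p′) , f⇔

  infix 4 _≲_

  _≲_ : Carrier → Carrier → Set ℓ
  x ≲ y = ∃[ f ] IsInjection f x y

  abstract
    ≲ᵈ : ∀ {n} (x y : Fin n) → Definable {n} (λ ρ → lookup ρ x ≲ lookup ρ y)
    ≲ᵈ x y = ∃ᵈ injectionᵈ v0 (suc x) (suc y)

    ≲-comprehension : ∀ {n} {P : Vec Carrier (ℕ.suc (ℕ.suc n)) → Set ℓ} → Definable P → ∀ ρ x y →
      (∀ a → a ∈ x → ∃[ b ] (b ∈ y × P (a ∷ b ∷ ρ))) →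
      (∀ a b b′ → a ∈ x → b ∈ y → b′ ∈ y → P (a ∷ b ∷ ρ) → P (a ∷ b′ ∷ ρ) → b ≈ b′) →
      (∀ a a′ b → a ∈ x → a′ ∈ x → b ∈ y → P (a ∷ b ∷ ρ) → P (a′ ∷ b ∷ ρ) → a ≈ a′) →
      x ≲ y
    ≲-comprehension d ρ x y total unique injective =
      let f , F , f⇔ = function-comprehension d ρ x y total unique
      in f , F , λ a a′ b ab∈f a′b∈f →
        let a∈x , b∈y , p = to (f⇔ a b) ab∈f
            a′∈x , _ , p′ = to (f⇔ a′ b) a′b∈f
        in injective a a′ b a∈x a′∈x b∈y p p′

    ⊆⇒≲ : ∀ {x y} → x ⊆ y → x ≲ y
    ⊆⇒≲ {x} {y} x⊆y = ≲-comprehension (v0 ≈ᵈ v1) [] x y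
      (λ a a∈x → a , x⊆y a a∈x , refl)
      (λ a b b′ _ _ _ p q → trans (sym p) q)
      (λ a a′ b _ _ _ p q → trans p (sym q))

    ≲-trans : ∀ {x y z} → x ≲ y → y ≲ z → x ≲ z
    ≲-trans {x} {y} {z} (f , F , f-inj) (g , G , g-inj) =
      ≲-comprehension (∃ᵈ (⟨ v1 , v0 ⟩∈ᵈ v3 ∧ᵈ ⟨ v0 , v2 ⟩∈ᵈ v4)) (f ∷ g ∷ []) x z
      (λ a a∈x → let b , b∈y , ab∈f = function-total F a a∈x
                     c , c∈z , bc∈g = function-total G b b∈y
                 in c , c∈z , b , ab∈f , bc∈g)
      (λ { a c c′ _ _ _ (b , ab∈f , bc∈g) (b′ , ab′∈f , b′c′∈g) →
        function-unique G bc∈g (⟨,⟩∈-resp (function-unique F ab′∈f ab∈f) refl b′c′∈g) })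
      (λ { a a′ c _ _ _ (b , ab∈f , bc∈g) (b′ , a′b′∈f , b′c∈g) →
        f-inj a a′ b ab∈f (⟨,⟩∈-resp refl (g-inj b′ b c b′c∈g bc∈g) a′b′∈f) })

    ≲-product : ∀ {x x′ y y′ p p′} → x ≲ x′ → y ≲ y′ → IsProduct p x y → IsProduct p′ x′ y′ → p ≲ p′
    ≲-product {x} {x′} {y} {y′} {p} {p′} (f , F , f-inj) (g , G , g-inj) p⇔ p′⇔ =
      ≲-comprehension
        (∃ᵈ (∃ᵈ (∃ᵈ (∃ᵈ (orderedPairᵈ v4 v3 v2 ∧ᵈ orderedPairᵈ v5 v1 v0 ∧ᵈ ⟨ v3 , v1 ⟩∈ᵈ v6 ∧ᵈ ⟨ v2 , v0 ⟩∈ᵈ v7)))))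
        (f ∷ g ∷ []) p p′
        (λ z z∈p → let a , b , z≡ab , a∈x , b∈y = to (p⇔ z) z∈p
                       c , c∈x′ , ac∈f = function-total F a a∈x
                       d , d∈y′ , bd∈g = function-total G b b∈y
                       z′ , z′≡cd = orderedPair c d
                   in z′ , from (p′⇔ z′) (c , d , z′≡cd , c∈x′ , d∈y′) , a , b , c , d , z≡ab , z′≡cd , ac∈f , bd∈g)
        (λ { z z₁ z₂ _ _ _ (a , b , c , d , z≡ab , z₁≡cd , ac∈f , bd∈g) (a′ , b′ , c′ , d′ , z≡a′b′ , z₂≡c′d′ , a′c′∈f , b′d′∈g) →
           let a′≈a , b′≈b = orderedPair-injective z≡a′b′ z≡ab
               c≈c′ = function-unique F ac∈f (⟨,⟩∈-resp a′≈a refl a′c′∈f)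
               d≈d′ = function-unique G bd∈g (⟨,⟩∈-resp b′≈b refl b′d′∈g)
           in orderedPair-unique (orderedPair-resp refl c≈c′ d≈d′ z₁≡cd) z₂≡c′d′ })
        (λ { z₁ z₂ z _ _ _ (a , b , c , d , z₁≡ab , z≡cd , ac∈f , bd∈g) (a′ , b′ , c′ , d′ , z₂≡a′b′ , z≡c′d′ , a′c′∈f , b′d′∈g) →
           let c′≈c , d′≈d = orderedPair-injective z≡c′d′ z≡cd
               a≈a′ = f-inj _ _ _ ac∈f (⟨,⟩∈-resp refl c′≈c a′c′∈f)
               b≈b′ = g-inj _ _ _ bd∈g (⟨,⟩∈-resp refl d′≈d b′d′∈g)
           in orderedPair-unique (orderedPair-resp refl a≈a′ b≈b′ z₁≡ab) z₂≡a′b′ })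

-- Ordinals, finite unions and cardinals.

module Ordinals {ℓ : Level} (em : ExcludedMiddle ℓ) (M : Structure ℓ) (zf : IsModelOfZF M) where
  open SetTheory em M zf

  infix 4 _≤_

  _≤_ : Carrier → Carrier → Set ℓ
  α ≤ β = α ∈ β ⊎ α ≈ β

  abstract
    ≤ᵈ : ∀ {n} (x y : Fin n) → Definable {n} (λ ρ → lookup ρ x ≤ lookup ρ y)
    ≤ᵈ x y = x ∈ᵈ y ∨ᵈ x ≈ᵈ y

  IsTotal : Carrier → Set ℓ
  IsTotal x = ∀ a b → a ∈ x → b ∈ x → a ∈ b ⊎ a ≈ b ⊎ b ∈ a

  -- Foundation supplies the remaining clauses of a well-ordering by ∈.
  abstract
    transitive∧total⇒ordinal : ∀ {x} → IsTransitive x → IsTotal x → IsOrdinal x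
    transitive∧total⇒ordinal {x} tr total = tr , (λ a _ → ∈-irrefl) , ∈-trans , total , least
      where
      ∈-trans : ∀ a b c → a ∈ x → b ∈ x → c ∈ x → a ∈ b → b ∈ c → a ∈ c
      ∈-trans a b c a∈x b∈x c∈x a∈b b∈c with total a c a∈x c∈x
      ... | inj₁ a∈c        = a∈c
      ... | inj₂ (inj₁ a≈c) = ⊥-elim (∈-asym a∈b (∈-respʳ (sym a≈c) b∈c))
      ... | inj₂ (inj₂ c∈a) = ⊥-elim (∈-acyclic₃ a∈b b∈c c∈a)
      least : ∀ s → s ⊆ x → Nonempty s → ∃[ m ] (m ∈ s × (∀ a → a ∈ s → m ∈ a ⊎ m ≈ a))
      least s s⊆x ne = let m , m∈s , min = foundation s ne in m , m∈s , λ a a∈s → cases m a m∈s a∈s (min a)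
        where
        cases : ∀ m a → m ∈ s → a ∈ s → (a ∈ m → ¬ a ∈ s) → m ∈ a ⊎ m ≈ a
        cases m a m∈s a∈s min with total m a (s⊆x m m∈s) (s⊆x a a∈s)
        ... | inj₁ m∈a        = inj₁ m∈a
        ... | inj₂ (inj₁ m≈a) = inj₂ m≈a
        ... | inj₂ (inj₂ a∈m) = ⊥-elim (min a∈m a∈s)

    ordinal-total : ∀ {α} → IsOrdinal α → IsTotal α
    ordinal-total (_ , _ , _ , total , _) = total

    ordinal-transitive : ∀ {α} → IsOrdinal α → ∀ {β γ} → β ∈ γ → γ ∈ α → β ∈ α
    ordinal-transitive (tr , _) β∈γ γ∈α = tr _ γ∈α _ β∈γ

    ∈-ordinal : ∀ {α β} → IsOrdinal α → β ∈ α → IsOrdinal β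
    ∈-ordinal {α} {β} oα@(tr , _ , ∈-trans , total , _) β∈α = transitive∧total⇒ordinal
      (λ b b∈β c c∈b → ∈-trans c b β (tr b (tr β β∈α b b∈β) c c∈b) (tr β β∈α b b∈β) β∈α c∈b b∈β)
      (λ a b a∈β b∈β → total a b (tr β β∈α a a∈β) (tr β β∈α b b∈β))

    ordinal-resp : ∀ {α β} → α ≈ β → IsOrdinal α → IsOrdinal β
    ordinal-resp e (tr , _ , _ , total , _) = transitive∧total⇒ordinal
      (λ y y∈β z z∈y → ∈-respʳ e (tr y (∈-respʳ (sym e) y∈β) z z∈y))
      (λ a b a∈β b∈β → total a b (∈-respʳ (sym e) a∈β) (∈-respʳ (sym e) b∈β))

    ≤-resp : ∀ {α α′ β} → α ≈ α′ → α ≤ β → α′ ≤ β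
    ≤-resp e (inj₁ α∈β) = inj₁ (∈-respˡ e α∈β)
    ≤-resp e (inj₂ α≈β) = inj₂ (trans (sym e) α≈β)

    limit-resp : ∀ {δ δ′} → δ ≈ δ′ → IsLimitOrdinal δ → IsLimitOrdinal δ′
    limit-resp e (oδ , (γ , γ∈δ) , nosucc) = ordinal-resp e oδ , (γ , ∈-respʳ e γ∈δ) , λ β h → nosucc β λ w →
      mk⇔ (λ w∈δ → to (h w) (∈-respʳ e w∈δ)) (λ p → ∈-respʳ (sym e) (from (h w) p))

    ≤⇒⊆ : ∀ {α β} → IsOrdinal β → α ≤ β → α ⊆ β
    ≤⇒⊆ oβ (inj₁ α∈β) z z∈α = ordinal-transitive oβ z∈α α∈β
    ≤⇒⊆ oβ (inj₂ α≈β) z z∈α = ∈-respʳ α≈β z∈α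

    -- A minimal element `m` of `β` outside `α` equals `α`: what lies below `m` is in `α` by
    -- minimality, and an element of `α` not below `m` would force `m` into the transitive set `α`.
    ⊆⇒≤ : ∀ {α β} → IsOrdinal α → IsOrdinal β → α ⊆ β → α ≤ β
    ⊆⇒≤ {α} {β} oα oβ α⊆β with comprehension (¬ᵈ (v0 ∈ᵈ v1)) (α ∷ []) β
    ... | d , d⇔ with em {Nonempty d}
    ... | no empty = inj₂ (extensionality _ _ λ z → mk⇔ (α⊆β z) λ z∈β → byContradiction λ z∉α → empty (z , from (d⇔ z) (z∈β , z∉α)))
    ... | yes ne with foundation d ne
    ... | m , m∈d , min = inj₁ (∈-respˡ m≈α m∈β)
      where
      m∈β : m ∈ β
      m∈β = proj₁ (to (d⇔ m) m∈d)
      m∉α : ¬ m ∈ α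
      m∉α = proj₂ (to (d⇔ m) m∈d)
      in-m : ∀ z → z ∈ α → z ∈ m
      in-m z z∈α with ordinal-total oβ z m (α⊆β z z∈α) m∈β
      ... | inj₁ z∈m        = z∈m
      ... | inj₂ (inj₁ z≈m) = ⊥-elim (m∉α (∈-respˡ z≈m z∈α))
      ... | inj₂ (inj₂ m∈z) = ⊥-elim (m∉α (ordinal-transitive oα m∈z z∈α))
      m≈α : m ≈ α
      m≈α = extensionality _ _ λ z → mk⇔
        (λ z∈m → byContradiction λ z∉α → min z z∈m (from (d⇔ z) (ordinal-transitive oβ z∈m m∈β , z∉α)))
        (in-m z)

    -- The intersection `γ` is an ordinal included in both. It cannot be a member of both, since
    -- then `γ ∈ γ`; hence it equals one of them.
    trichotomy : ∀ {α β} → IsOrdinal α → IsOrdinal β → α ∈ β ⊎ α ≈ β ⊎ β ∈ α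
    trichotomy {α} {β} oα oβ with comprehension (v0 ∈ᵈ v1) (β ∷ []) α
    ... | γ , γ⇔ = cases (⊆⇒≤ oγ oα γ⊆α) (⊆⇒≤ oγ oβ γ⊆β)
      where
      γ⊆α : γ ⊆ α
      γ⊆α z z∈γ = proj₁ (to (γ⇔ z) z∈γ)
      γ⊆β : γ ⊆ β
      γ⊆β z z∈γ = proj₂ (to (γ⇔ z) z∈γ)
      oγ : IsOrdinal γ
      oγ = transitive∧total⇒ordinal
        (λ y y∈γ z z∈y → from (γ⇔ z) (ordinal-transitive oα z∈y (γ⊆α y y∈γ) , ordinal-transitive oβ z∈y (γ⊆β y y∈γ)))
        (λ a b a∈γ b∈γ → ordinal-total oα a b (γ⊆α a a∈γ) (γ⊆α b b∈γ))
      cases : γ ≤ α → γ ≤ β → α ∈ β ⊎ α ≈ β ⊎ β ∈ α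
      cases (inj₁ γ∈α) (inj₁ γ∈β) = ⊥-elim (∈-irrefl (from (γ⇔ γ) (γ∈α , γ∈β)))
      cases (inj₁ γ∈α) (inj₂ γ≈β) = inj₂ (inj₂ (∈-respˡ γ≈β γ∈α))
      cases (inj₂ γ≈α) (inj₁ γ∈β) = inj₁ (∈-respˡ γ≈α γ∈β)
      cases (inj₂ γ≈α) (inj₂ γ≈β) = inj₂ (inj₁ (trans (sym γ≈α) γ≈β))

    ∈-or-≥ : ∀ {α β} → IsOrdinal α → IsOrdinal β → α ∈ β ⊎ β ≤ α
    ∈-or-≥ oα oβ with trichotomy oα oβ
    ... | inj₁ α∈β        = inj₁ α∈β
    ... | inj₂ (inj₁ α≈β) = inj₂ (inj₂ (sym α≈β))
    ... | inj₂ (inj₂ β∈α) = inj₂ (inj₁ β∈α)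

    ≤-trans : ∀ {α β γ} → IsOrdinal γ → α ≤ β → β ≤ γ → α ≤ γ
    ≤-trans oγ α≤β (inj₂ β≈γ) with α≤β
    ... | inj₁ α∈β = inj₁ (∈-respʳ β≈γ α∈β)
    ... | inj₂ α≈β = inj₂ (trans α≈β β≈γ)
    ≤-trans oγ α≤β (inj₁ β∈γ) with α≤β
    ... | inj₁ α∈β = inj₁ (ordinal-transitive oγ α∈β β∈γ)
    ... | inj₂ α≈β = inj₁ (∈-respˡ (sym α≈β) β∈γ)

    maximum : ∀ {α β γ} → IsOrdinal γ → α ∈ γ → β ∈ γ → ∃[ m ] (m ∈ γ × (m ≈ α ⊎ m ≈ β) × α ≤ m × β ≤ m)
    maximum {α} {β} oγ α∈γ β∈γ with ordinal-total oγ α β α∈γ β∈γ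
    ... | inj₁ α∈β        = β , β∈γ , inj₂ refl , inj₁ α∈β , inj₂ refl
    ... | inj₂ (inj₁ α≈β) = β , β∈γ , inj₂ refl , inj₂ α≈β , inj₂ refl
    ... | inj₂ (inj₂ β∈α) = α , α∈γ , inj₁ refl , inj₂ refl , inj₁ β∈α

    successor-ordinal : ∀ {α s} → IsOrdinal α → IsSuccessorOf s α → IsOrdinal s
    successor-ordinal {α} {s} oα s⇔ = transitive∧total⇒ordinal tr total
      where
      tr : IsTransitive s
      tr y y∈s z z∈y with to (s⇔ y) y∈s
      ... | inj₁ y∈α = from (s⇔ z) (inj₁ (ordinal-transitive oα z∈y y∈α))
      ... | inj₂ y≈α = from (s⇔ z) (inj₁ (∈-respʳ y≈α z∈y))
      total : IsTotal s
      total a b a∈s b∈s with to (s⇔ a) a∈s | to (s⇔ b) b∈s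
      ... | inj₁ a∈α | inj₁ b∈α = ordinal-total oα a b a∈α b∈α
      ... | inj₁ a∈α | inj₂ b≈α = inj₁ (∈-respʳ (sym b≈α) a∈α)
      ... | inj₂ a≈α | inj₁ b∈α = inj₂ (inj₂ (∈-respʳ (sym a≈α) b∈α))
      ... | inj₂ a≈α | inj₂ b≈α = inj₂ (inj₁ (trans a≈α (sym b≈α)))

    limit-successor : ∀ {δ γ} → IsLimitOrdinal δ → γ ∈ δ → ∃[ s ] (s ∈ δ × IsSuccessorOf s γ)
    limit-successor {δ} {γ} (oδ , _ , nosucc) γ∈δ with successor γ
    ... | s , s⇔ with trichotomy (successor-ordinal (∈-ordinal oδ γ∈δ) s⇔) oδ
    ... | inj₁ s∈δ        = s , s∈δ , s⇔
    ... | inj₂ (inj₁ s≈δ) = ⊥-elim (nosucc γ λ z → mk⇔ (λ z∈δ → to (s⇔ z) (∈-respʳ (sym s≈δ) z∈δ)) (λ h → ∈-respʳ s≈δ (from (s⇔ z) h)))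
    ... | inj₂ (inj₂ δ∈s) with to (s⇔ δ) δ∈s
    ...   | inj₁ δ∈γ = ⊥-elim (∈-asym δ∈γ γ∈δ)
    ...   | inj₂ δ≈γ = ⊥-elim (∈-irrefl (∈-respʳ δ≈γ γ∈δ))

    least : ∀ {n} {P : Vec Carrier (ℕ.suc n) → Set ℓ} → Definable P → ∀ ρ {α} → IsOrdinal α →
            (∃[ β ] (β ∈ α × P (β ∷ ρ))) →
            ∃[ β ] (β ∈ α × P (β ∷ ρ) × (∀ γ → γ ∈ α → P (γ ∷ ρ) → β ≤ γ))
    least d ρ {α} (_ , _ , _ , _ , min) (β , β∈α , p) =
      let s , s⇔ = comprehension d ρ α
          m , m∈s , m≤ = min s (λ z z∈s → proj₁ (to (s⇔ z) z∈s)) (β , from (s⇔ β) (β∈α , p))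
          m∈α , q = to (s⇔ m) m∈s
      in m , m∈α , q , λ γ γ∈α pγ → m≤ γ (from (s⇔ γ) (γ∈α , pγ))

    ≤-antisym : ∀ {α β} → α ≤ β → β ≤ α → α ≈ β
    ≤-antisym (inj₂ e) _ = e
    ≤-antisym (inj₁ _) (inj₂ e) = sym e
    ≤-antisym (inj₁ α∈β) (inj₁ β∈α) = ⊥-elim (∈-asym α∈β β∈α)

    -- Choosing least values turns a total relation with values in an ordinal
    -- into a function.
    selection : ∀ {n} {P : Vec Carrier (ℕ.suc (ℕ.suc n)) → Set ℓ} → Definable P → ∀ ρ x {α} → IsOrdinal α →
      (∀ a → a ∈ x → ∃[ b ] (b ∈ α × P (b ∷ a ∷ ρ))) →
      ∃[ f ] (IsFunction f x α × (∀ a b → ⟨ a , b ⟩∈ f → P (b ∷ a ∷ ρ)))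
    selection {P = P} d ρ x {α} oα total =
      let r , rel , r⇔ = relation-comprehension (swap d) ρ x α
          f , F , f⇔ = function-comprehension (⟨ v0 , v1 ⟩∈ᵈ v2 ∧ᵈ (∀ᵈ (⟨ v1 , v0 ⟩∈ᵈ v3 ⇒ᵈ ≤ᵈ v2 v0))) (r ∷ []) x α
            (λ a a∈x → let b , b∈α , p , b≤ = least d (a ∷ ρ) oα (total a a∈x) in
              b , b∈α , from (r⇔ a b) (a∈x , b∈α , p) , λ c ac∈r → let _ , c∈α , q = to (r⇔ a c) ac∈r in b≤ c c∈α q)
            (λ { a b b′ _ _ _ (ab∈r , b≤) (ab′∈r , b′≤) → ≤-antisym (b≤ b′ ab′∈r) (b′≤ b ab∈r) })
      in f , F , λ a b ab∈f → let _ , _ , ab∈r , _ = to (f⇔ a b) ab∈f in proj₂ (proj₂ (to (r⇔ a b) ab∈r))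

    least-≲ : ∀ {n} {P : Vec Carrier (ℕ.suc (ℕ.suc n)) → Set ℓ} → Definable P → ∀ ρ x {α} → IsOrdinal α →
      (∀ a → a ∈ x → ∃[ b ] (b ∈ α × P (b ∷ a ∷ ρ))) →
      (∀ a a′ b → P (b ∷ a ∷ ρ) → P (b ∷ a′ ∷ ρ) → a ≈ a′) → x ≲ α
    least-≲ d ρ x oα total injective =
      let f , F , sound = selection d ρ x oα total
      in f , F , λ a a′ b ab∈f a′b∈f → injective a a′ b (sound a b ab∈f) (sound a′ b a′b∈f)

    -- ω and finite unions

    ω-unique : ∀ {w w′} → Isω w → Isω w′ → w ≈ w′
    ω-unique (lim@(o , _) , min) (lim′@(o′ , _) , min′) with trichotomy o o′
    ... | inj₁ w∈w′        = ⊥-elim (min′ _ w∈w′ lim)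
    ... | inj₂ (inj₁ w≈w′) = w≈w′
    ... | inj₂ (inj₂ w′∈w) = ⊥-elim (min _ w′∈w lim′)

    finite-cases : ∀ {w n} → Isω w → n ∈ w → ¬ Nonempty n ⊎ (∃[ m ] (IsSuccessorOf n m))
    finite-cases {n = n} ((o , _) , min) n∈w with em {Nonempty n}
    ... | no empty = inj₁ empty
    ... | yes ne = inj₂ (byContradiction λ nosucc → min n n∈w (∈-ordinal o n∈w , ne , λ β s → nosucc (β , s)))

  BoundedAt : (r δ i γ : Carrier) → Set ℓ
  BoundedAt r δ i γ = γ ∈ δ × (∀ β → ⟨ i , β ⟩∈ r → β ≤ γ)

  abstract
    -- Induction on `n`, keeping the larger of two bounds at each successor. Rows of a relation are
    -- bounded rather than values of a function, so that the lemma can be nested in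
    -- `ω-not-≲-finite-square`.
    finite-union-bounded : ∀ {w δ r} → Isω w → IsOrdinal δ → Nonempty δ → ∀ n → n ∈ w →
      (∀ i → i ∈ n → ∃[ γ ] BoundedAt r δ i γ) →
      ∃[ γ ] (γ ∈ δ × (∀ i β → i ∈ n → ⟨ i , β ⟩∈ r → β ≤ γ))
    finite-union-bounded {w} {δ} {r} ωw@((ow , _) , _) oδ (γ₀ , γ₀∈δ) = ∈-induction
      ((∀ᵈ (v0 ∈ᵈ v1 ⇒ᵈ (∃ᵈ (v0 ∈ᵈ v3 ∧ᵈ (∀ᵈ (⟨ v2 , v0 ⟩∈ᵈ v5 ⇒ᵈ ≤ᵈ v0 v1))))))
        ⇒ᵈ (∃ᵈ (v0 ∈ᵈ v2 ∧ᵈ (∀ᵈ (∀ᵈ (v1 ∈ᵈ v3 ⇒ᵈ ⟨ v1 , v0 ⟩∈ᵈ v5 ⇒ᵈ ≤ᵈ v0 v2))))))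
      (δ ∷ r ∷ []) w step
      where
      step : ∀ n → n ∈ w → (∀ m → m ∈ n → m ∈ w → (∀ i → i ∈ m → ∃[ γ ] BoundedAt r δ i γ) →
               ∃[ γ ] (γ ∈ δ × (∀ i β → i ∈ m → ⟨ i , β ⟩∈ r → β ≤ γ))) →
             (∀ i → i ∈ n → ∃[ γ ] BoundedAt r δ i γ) →
             ∃[ γ ] (γ ∈ δ × (∀ i β → i ∈ n → ⟨ i , β ⟩∈ r → β ≤ γ))
      step n n∈w ih bdd with finite-cases ωw n∈w
      ... | inj₁ empty = γ₀ , γ₀∈δ , λ i β i∈n → ⊥-elim (empty (i , i∈n))
      ... | inj₂ (m , n⇔) =
        let m∈n = from (n⇔ m) (inj₂ refl)
            γ , γ∈δ , β≤γ = ih m m∈n (ordinal-transitive ow m∈n n∈w) (λ i i∈m → bdd i (from (n⇔ i) (inj₁ i∈m)))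
            γ′ , γ′∈δ , β≤γ′ = bdd m m∈n
            μ , μ∈δ , _ , γ≤μ , γ′≤μ = maximum oδ γ∈δ γ′∈δ
            oμ = ∈-ordinal oδ μ∈δ
            bound : ∀ i β → i ∈ m ⊎ i ≈ m → ⟨ i , β ⟩∈ r → β ≤ μ
            bound = λ { i β (inj₁ i∈m) iβ∈r → ≤-trans oμ (β≤γ i β i∈m iβ∈r) γ≤μ
                      ; i β (inj₂ i≈m) iβ∈r → ≤-trans oμ (β≤γ′ β (⟨,⟩∈-resp i≈m refl iβ∈r)) γ′≤μ }
        in μ , μ∈δ , λ i β i∈n → bound i β (to (n⇔ i) i∈n)

    limit-unbounded : ∀ {δ γ} → IsLimitOrdinal δ → γ ∈ δ → ¬ (∀ β → β ∈ δ → β ≤ γ)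
    limit-unbounded lim γ∈δ bdd with limit-successor lim γ∈δ
    ... | s , s∈δ , s⇔ with bdd s s∈δ
    ...   | inj₁ s∈γ = ∈-asym (from (s⇔ _) (inj₂ refl)) s∈γ
    ...   | inj₂ s≈γ = ∈-irrefl (∈-respʳ s≈γ (from (s⇔ _) (inj₂ refl)))

    cofinalMapᵈ : ∀ {n} (μ δ : Fin n) → Definable {n} (λ ρ → HasCofinalMap (lookup ρ μ) (lookup ρ δ))
    cofinalMapᵈ μ δ = ∃ᵈ (functionᵈ v0 (suc μ) (suc δ) ∧ᵈ
      (∀ᵈ (v0 ∈ᵈ suc (suc δ) ⇒ᵈ (∃ᵈ (∃ᵈ (⟨ v1 , v0 ⟩∈ᵈ v3 ∧ᵈ ≤ᵈ v2 v0))))))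

    cofinalMap-resp : ∀ {μ μ′ δ δ′} → μ ≈ μ′ → δ ≈ δ′ → HasCofinalMap μ δ → HasCofinalMap μ′ δ′
    cofinalMap-resp = resp₂ (cofinalMapᵈ v0 v1) []

    bijection⇒cofinalMap : ∀ {f μ δ} → IsBijection f μ δ → HasCofinalMap μ δ
    bijection⇒cofinalMap ((F , _) , surjective) = _ , F , λ β β∈δ → let a , aβ∈f = surjective β β∈δ in a , β , aβ∈f , inj₂ refl

    no-finite-cofinal-map : ∀ {w δ n} → Isω w → IsLimitOrdinal δ → n ∈ w → ¬ HasCofinalMap n δ
    no-finite-cofinal-map {n = n} ωw lim@(oδ , ne , _) n∈w (f , F , cofinal) =
      let γ , γ∈δ , bdd = finite-union-bounded {r = f} ωw oδ ne n n∈w λ i i∈n →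
            let b , b∈δ , ib∈f = function-total F i i∈n in b , b∈δ , λ β iβ∈f → inj₂ (function-unique F iβ∈f ib∈f)
      in limit-unbounded lim γ∈δ λ β β∈δ →
           let i , γ′ , iγ′∈f , β≤γ′ = cofinal β β∈δ
           in ≤-trans (∈-ordinal oδ γ∈δ) β≤γ′ (bdd i γ′ (proj₁ (function-sides F iγ′∈f)) iγ′∈f)

    -- Injectivity leaves at most one natural number in each cell of the square. Bounding finitely
    -- many cells bounds a row, and bounding finitely many rows would bound all of `ω`.
    ω-not-≲-finite-square : ∀ {w n p} → Isω w → n ∈ w → IsProduct p n n → ¬ w ≲ p
    ω-not-≲-finite-square {w} {n} {p} ωw@(lim@(ow , ne , _) , _) n∈w p⇔ (h , H , h-inj) =
      let r , rel , r⇔ = relation-comprehension (∃ᵈ (∃ᵈ (orderedPairᵈ v0 v2 v1 ∧ᵈ ⟨ v3 , v0 ⟩∈ᵈ v4))) (h ∷ []) n w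
          γ , γ∈w , bdd = finite-union-bounded {r = r} ωw ow ne n n∈w λ i i∈n →
            let rᵢ , _ , rᵢ⇔ = relation-comprehension (∃ᵈ (orderedPairᵈ v0 v3 v1 ∧ᵈ ⟨ v2 , v0 ⟩∈ᵈ v4)) (i ∷ h ∷ []) n w
                γ , γ∈w , bdd = finite-union-bounded {r = rᵢ} ωw ow ne n n∈w λ j j∈n → cell rᵢ i j (rᵢ⇔ j)
            in γ , γ∈w , λ β iβ∈r →
              let _ , β∈w , j , z , z≡ij , βz∈h = to (r⇔ i β) iβ∈r
                  a , b , z≡ab , _ , b∈n = to (p⇔ z) (proj₂ (function-sides H βz∈h))
                  j∈n = ∈-respˡ (proj₂ (orderedPair-injective z≡ab z≡ij)) b∈n
              in bdd j β j∈n (from (rᵢ⇔ j β) (j∈n , β∈w , z , z≡ij , βz∈h))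
      in limit-unbounded lim γ∈w λ β β∈w →
           let z , z∈p , βz∈h = function-total H β β∈w
               i , j , z≡ij , i∈n , j∈n = to (p⇔ z) z∈p
           in bdd i β i∈n (from (r⇔ i β) (i∈n , β∈w , j , z , z≡ij , βz∈h))
      where
      cell : ∀ rᵢ i j → (∀ β → ⟨ j , β ⟩∈ rᵢ ⇔ (j ∈ n × β ∈ w × ∃[ z ] (IsOrderedPair z i j × ⟨ β , z ⟩∈ h))) →
             ∃[ γ ] BoundedAt rᵢ w j γ
      cell rᵢ i j rᵢ⇔ with em {∃[ β ] (⟨ j , β ⟩∈ rᵢ)}
      -- A cell outside the range of `h` has no preimage to bound, so any element of `ω` serves.
      ... | no none = proj₁ ne , proj₂ ne , λ β jβ∈r → ⊥-elim (none (β , jβ∈r))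
      ... | yes (β , jβ∈r) = let _ , β∈w , z , z≡ij , βz∈h = to (rᵢ⇔ β) jβ∈r in
        β , β∈w , λ β′ jβ′∈r → let _ , _ , z′ , z′≡ij , β′z′∈h = to (rᵢ⇔ β′) jβ′∈r in
          inj₂ (h-inj β′ β z (⟨,⟩∈-resp refl (orderedPair-unique z′≡ij z≡ij) β′z′∈h) βz∈h)

    -- Cardinals

    -- The points of κ reached from κ ∖ θ by iterating h are moved by h, all
    -- others are fixed.
    ⊆∧≲⇒bijection : ∀ {θ κ} → θ ⊆ κ → κ ≲ θ → ∃[ f ] IsBijection f θ κ
    ⊆∧≲⇒bijection {θ} {κ} θ⊆κ (h , H , h-inj)
      -- `C` is the intersection of all sets `Z` that include `κ` minus `θ` and are closed under
      -- `h`. This impredicative form replaces a recursion along `ω`.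
      with comprehension (∀ᵈ ((∀ᵈ (v0 ∈ᵈ v4 ⇒ᵈ (¬ᵈ (v0 ∈ᵈ v3)) ⇒ᵈ v0 ∈ᵈ v1))
             ⇒ᵈ (∀ᵈ (∀ᵈ (v1 ∈ᵈ v2 ⇒ᵈ ⟨ v1 , v0 ⟩∈ᵈ v6 ⇒ᵈ v0 ∈ᵈ v2))) ⇒ᵈ v1 ∈ᵈ v0)) (θ ∷ κ ∷ h ∷ []) κ
    ... | C , C⇔ =
      let g , G , g⇔ = function-comprehension
            ((v1 ∈ᵈ v2 ∧ᵈ ⟨ v1 , v0 ⟩∈ᵈ v3) ∨ᵈ ((¬ᵈ (v1 ∈ᵈ v2)) ∧ᵈ v1 ≈ᵈ v0)) (C ∷ h ∷ []) θ κ total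
            (λ u x x′ _ _ _ → unique)
      in g , (G , λ u u′ x ux∈g u′x∈g →
           injective (proj₂ (proj₂ (to (g⇔ u x) ux∈g))) (proj₂ (proj₂ (to (g⇔ u′ x) u′x∈g)))) ,
         λ x x∈κ → let u , u∈θ , p = surjective x x∈κ in u , from (g⇔ u x) (u∈θ , x∈κ , p)
      where
      Graph : Carrier → Carrier → Set ℓ
      Graph u x = (x ∈ C × ⟨ x , u ⟩∈ h) ⊎ (¬ x ∈ C × x ≈ u)
      outside : ∀ y → y ∈ κ → ¬ y ∈ θ → y ∈ C
      outside y y∈κ y∉θ = from (C⇔ y) (y∈κ , λ Z out _ → out y y∈κ y∉θ)
      closed : ∀ y u → y ∈ C → ⟨ y , u ⟩∈ h → u ∈ C
      closed y u y∈C yu∈h = from (C⇔ u) (θ⊆κ u (proj₂ (function-sides H yu∈h)) ,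
        λ Z out cl → cl y u (proj₂ (to (C⇔ y) y∈C) Z out cl) yu∈h)
      reached : ∀ u → u ∈ θ → u ∈ C → ∃[ x ] (x ∈ C × ⟨ x , u ⟩∈ h)
      reached u u∈θ u∈C = byContradiction λ none →
        -- If `u` were the image of no point of `C`, removing `u` from `C` would leave a set that
        -- still includes `κ` minus `θ` and is closed under `h`, against the leastness of `C`.
        let Z , Z⇔ = comprehension (¬ᵈ (v0 ≈ᵈ v1)) (u ∷ []) C
        in proj₂ (to (Z⇔ u) (proj₂ (to (C⇔ u) u∈C) Z
             (λ y y∈κ y∉θ → from (Z⇔ y) (outside y y∈κ y∉θ , λ y≈u → y∉θ (∈-respˡ (sym y≈u) u∈θ)))
             (λ y v y∈Z yv∈h → let y∈C = proj₁ (to (Z⇔ y) y∈Z) in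
                from (Z⇔ v) (closed y v y∈C yv∈h , λ v≈u → none (y , y∈C , ⟨,⟩∈-resp refl v≈u yv∈h))))) refl
      total : ∀ u → u ∈ θ → ∃[ x ] (x ∈ κ × Graph u x)
      total u u∈θ with em {u ∈ C}
      ... | yes u∈C = let x , x∈C , xu∈h = reached u u∈θ u∈C in x , proj₁ (to (C⇔ x) x∈C) , inj₁ (x∈C , xu∈h)
      ... | no u∉C  = u , θ⊆κ u u∈θ , inj₂ (u∉C , refl)
      unique : ∀ {u x x′} → Graph u x → Graph u x′ → x ≈ x′
      unique (inj₁ (_ , xu∈h)) (inj₁ (_ , x′u∈h)) = h-inj _ _ _ xu∈h x′u∈h
      unique (inj₁ (x∈C , xu∈h)) (inj₂ (x′∉C , x′≈u)) = ⊥-elim (x′∉C (∈-respˡ (sym x′≈u) (closed _ _ x∈C xu∈h)))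
      unique (inj₂ (x∉C , x≈u)) (inj₁ (x′∈C , x′u∈h)) = ⊥-elim (x∉C (∈-respˡ (sym x≈u) (closed _ _ x′∈C x′u∈h)))
      unique (inj₂ (_ , x≈u)) (inj₂ (_ , x′≈u)) = trans x≈u (sym x′≈u)
      injective : ∀ {u u′ x} → Graph u x → Graph u′ x → u ≈ u′
      injective (inj₁ (_ , xu∈h)) (inj₁ (_ , xu′∈h)) = function-unique H xu∈h xu′∈h
      injective (inj₁ (x∈C , _)) (inj₂ (x∉C , _)) = ⊥-elim (x∉C x∈C)
      injective (inj₂ (x∉C , _)) (inj₁ (x∈C , _)) = ⊥-elim (x∉C x∈C)
      injective (inj₂ (_ , x≈u)) (inj₂ (_ , x≈u′)) = trans (sym x≈u) x≈u′
      surjective : ∀ x → x ∈ κ → ∃[ u ] (u ∈ θ × Graph u x)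
      surjective x x∈κ with em {x ∈ C}
      ... | yes x∈C = let u , u∈θ , xu∈h = function-total H x x∈κ in u , u∈θ , inj₁ (x∈C , xu∈h)
      ... | no x∉C  = x , byContradiction (λ x∉θ → x∉C (outside x x∈κ x∉θ)) , inj₂ (x∉C , refl)

    cardinal-not-≲ : ∀ {κ θ} → IsCardinal κ → θ ∈ κ → ¬ κ ≲ θ
    cardinal-not-≲ (oκ , _ , initial) θ∈κ κ≲θ = initial _ θ∈κ (⊆∧≲⇒bijection (λ z z∈θ → ordinal-transitive oκ z∈θ θ∈κ) κ≲θ)

-- Mostowski collapse of well-founded tree orders.

module Collapse {ℓ : Level} (em : ExcludedMiddle ℓ) (M : Structure ℓ) (zf : IsModelOfZF M) where
  open SetTheory em M zf
  open Ordinals em M zf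

  -- Linearity is asked only below each element. One collapse then covers both Gödel's order, which
  -- is linear, and the column order, which is a disjoint sum of linear orders.
  record IsTreeOrder (A W : Carrier) : Set ℓ where
    field
      relation    : IsRelation W A A
      transitive  : ∀ a b c → ⟨ a , b ⟩∈ W → ⟨ b , c ⟩∈ W → ⟨ a , c ⟩∈ W
      wellFounded : ∀ s → s ⊆ A → Nonempty s → ∃[ m ] (m ∈ s × (∀ a → a ∈ s → ¬ ⟨ a , m ⟩∈ W))
      linearBelow : ∀ a b c → ⟨ b , a ⟩∈ W → ⟨ c , a ⟩∈ W → ⟨ b , c ⟩∈ W ⊎ b ≈ c ⊎ ⟨ c , b ⟩∈ W

  -- The Mostowski collapse. On a tree order its value at `a` is the order type of the predecessors
  -- of `a`.
  IsCollapse : (A W g : Carrier) → Set ℓ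
  IsCollapse A W g =
      (∀ a → a ∈ A → ∃[ v ] (⟨ a , v ⟩∈ g))
    × (∀ a v v′ → ⟨ a , v ⟩∈ g → ⟨ a , v′ ⟩∈ g → v ≈ v′)
    × (∀ a v → ⟨ a , v ⟩∈ g → a ∈ A × (∀ u → u ∈ v ⇔ (∃[ b ] (⟨ b , a ⟩∈ W × ⟨ b , u ⟩∈ g))))

  -- A partial solution of the recursion whose domain is closed under predecessors.
  -- Single-valuedness on `A` is not built in but comes from `attempts-agree`.
  IsAttempt : (W h : Carrier) → Set ℓ
  IsAttempt W h = ∀ b v → ⟨ b , v ⟩∈ h →
      (∀ c → ⟨ c , b ⟩∈ W → ∃[ u ] (⟨ c , u ⟩∈ h))
    × (∀ u → u ∈ v ⇔ (∃[ c ] (⟨ c , b ⟩∈ W × ⟨ c , u ⟩∈ h)))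

  Value : (W a v : Carrier) → Set ℓ
  Value W a v = ∃[ h ] (IsAttempt W h × ⟨ a , v ⟩∈ h)

  abstract
    valueᵈ : ∀ {n} (W a v : Fin n) → Definable {n} (λ ρ → Value (lookup ρ W) (lookup ρ a) (lookup ρ v))
    valueᵈ W a v = ∃ᵈ ((∀ᵈ (∀ᵈ (⟨ v1 , v0 ⟩∈ᵈ v2 ⇒ᵈ
        (∀ᵈ (⟨ v0 , v2 ⟩∈ᵈ suc (suc (suc (suc W))) ⇒ᵈ (∃ᵈ (⟨ v1 , v0 ⟩∈ᵈ v4))))
        ∧ᵈ (∀ᵈ (v0 ∈ᵈ v1 ⇔ᵈ (∃ᵈ (⟨ v0 , v3 ⟩∈ᵈ suc (suc (suc (suc (suc W)))) ∧ᵈ ⟨ v0 , v1 ⟩∈ᵈ v4)))))))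
      ∧ᵈ ⟨ suc a , suc v ⟩∈ᵈ v0)

  module _ {A W : Carrier} (T : IsTreeOrder A W) where
    open IsTreeOrder T

    abstract
      W-induction : ∀ {n} {P : Vec Carrier (ℕ.suc n) → Set ℓ} → Definable P → ∀ ρ →
                    (∀ a → a ∈ A → (∀ b → ⟨ b , a ⟩∈ W → P (b ∷ ρ)) → P (a ∷ ρ)) →
                    ∀ a → a ∈ A → P (a ∷ ρ)
      W-induction d ρ step a a∈A = byContradiction λ ¬p →
        let s , s⇔ = comprehension (¬ᵈ d) ρ A
            m , m∈s , m-min = wellFounded s (λ z z∈s → proj₁ (to (s⇔ z) z∈s)) (a , from (s⇔ a) (a∈A , ¬p))
            m∈A , ¬pm = to (s⇔ m) m∈s
        in ¬pm (step m m∈A λ b bWm → byContradiction λ ¬pb →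
             m-min b (from (s⇔ b) (proj₁ (relation-sides relation bWm) , ¬pb)) bWm)

      W-irrefl : ∀ {a} → ¬ ⟨ a , a ⟩∈ W
      W-irrefl {a} aWa =
        let s , s⇔ = comprehension (v0 ≈ᵈ v1) (a ∷ []) A
            a∈A = proj₁ (relation-sides relation aWa)
            m , m∈s , m-min = wellFounded s (λ z z∈s → proj₁ (to (s⇔ z) z∈s)) (a , from (s⇔ a) (a∈A , refl))
        in m-min a (from (s⇔ a) (a∈A , refl)) (⟨,⟩∈-resp refl (sym (proj₂ (to (s⇔ m) m∈s))) aWa)

      attempts-agree : ∀ h h′ → IsAttempt W h → IsAttempt W h′ → ∀ a → a ∈ A →
                       ∀ v v′ → ⟨ a , v ⟩∈ h → ⟨ a , v′ ⟩∈ h′ → v ≈ v′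
      attempts-agree h h′ H H′ = W-induction
        (∀ᵈ (∀ᵈ (⟨ v2 , v1 ⟩∈ᵈ v3 ⇒ᵈ ⟨ v2 , v0 ⟩∈ᵈ v4 ⇒ᵈ v1 ≈ᵈ v0))) (h ∷ h′ ∷ [])
        λ a a∈A ih v v′ av∈h av′∈h′ →
          let closed , v⇔ = H a v av∈h
              closed′ , v′⇔ = H′ a v′ av′∈h′
          in extensionality _ _ λ u → mk⇔
            (λ u∈v → let c , cWa , cu∈h = to (v⇔ u) u∈v
                         u′ , cu′∈h′ = closed′ c cWa
                     in from (v′⇔ u) (c , cWa , ⟨,⟩∈-resp refl (sym (ih c cWa u u′ cu∈h cu′∈h′)) cu′∈h′))
            (λ u∈v′ → let c , cWa , cu∈h′ = to (v′⇔ u) u∈v′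
                          u′ , cu′∈h = closed c cWa
                      in from (v⇔ u) (c , cWa , ⟨,⟩∈-resp refl (ih c cWa u′ u cu′∈h cu∈h′) cu′∈h))

      value-unique : ∀ {a v v′} → a ∈ A → Value W a v → Value W a v′ → v ≈ v′
      value-unique a∈A (h , H , av∈h) (h′ , H′ , av′∈h′) = attempts-agree h h′ H H′ _ a∈A _ _ av∈h av′∈h′

    module _ {a V h : Carrier}
      (ih : ∀ b → ⟨ b , a ⟩∈ W → ∃[ v ] Value W b v)
      (V⇔ : ∀ u → u ∈ V ⇔ (∃[ c ] (⟨ c , a ⟩∈ W × Value W c u)))
      (h⇔ : ∀ c u → ⟨ c , u ⟩∈ h ⇔ ((⟨ c , a ⟩∈ W × Value W c u) ⊎ (c ≈ a × u ≈ V))) where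

      extension⁻¹ : ∀ {c u} → ⟨ c , a ⟩∈ W → ⟨ c , u ⟩∈ h → Value W c u
      extension⁻¹ {c} {u} cWa cu∈h with to (h⇔ c u) cu∈h
      ... | inj₁ (_ , val) = val
      ... | inj₂ (c≈a , _) = ⊥-elim (W-irrefl (⟨,⟩∈-resp c≈a refl cWa))

      extension : ∀ {c u} → ⟨ c , a ⟩∈ W → Value W c u → ⟨ c , u ⟩∈ h
      extension {c} {u} cWa val = from (h⇔ c u) (inj₁ (cWa , val))

      -- This is the recursion step: `h` glues the values below `a` and adds the pair of `a` and
      -- `V`. Transitivity of `W` keeps the domain closed under predecessors, and irreflexivity
      -- keeps the new pair from disturbing the values below `a`.
      extension-attempt : IsAttempt W h
      extension-attempt b v bv∈h = cases (to (h⇔ b v) bv∈h)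
        where
        cases : (⟨ b , a ⟩∈ W × Value W b v) ⊎ (b ≈ a × v ≈ V) →
                (∀ c → ⟨ c , b ⟩∈ W → ∃[ u ] (⟨ c , u ⟩∈ h))
              × (∀ u → u ∈ v ⇔ (∃[ c ] (⟨ c , b ⟩∈ W × ⟨ c , u ⟩∈ h)))
        cases (inj₁ (bWa , h′ , H′ , bv∈h′)) =
          (λ c cWb → let u , val = ih c (transitive c b a cWb bWa) in u , extension (transitive c b a cWb bWa) val) ,
          λ u → mk⇔
            (λ u∈v → let c , cWb , cu∈h′ = to (proj₂ (H′ b v bv∈h′) u) u∈v
                     in c , cWb , extension (transitive c b a cWb bWa) (h′ , H′ , cu∈h′))
            (λ (c , cWb , cu∈h) →
              let u′ , cu′∈h′ = proj₁ (H′ b v bv∈h′) c cWb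
                  u≈u′ = value-unique (proj₁ (relation-sides relation cWb))
                           (extension⁻¹ (transitive c b a cWb bWa) cu∈h) (h′ , H′ , cu′∈h′)
              in from (proj₂ (H′ b v bv∈h′) u) (c , cWb , ⟨,⟩∈-resp refl (sym u≈u′) cu′∈h′))
        cases (inj₂ (b≈a , v≈V)) =
          (λ c cWb → let cWa = ⟨,⟩∈-resp refl b≈a cWb
                         u , val = ih c cWa in u , extension cWa val) ,
          λ u → mk⇔
            (λ u∈v → let c , cWa , val = to (V⇔ u) (∈-respʳ v≈V u∈v)
                     in c , ⟨,⟩∈-resp refl (sym b≈a) cWa , extension cWa val)
            (λ (c , cWb , cu∈h) →
              let cWa = ⟨,⟩∈-resp refl b≈a cWb
              in ∈-respʳ (sym v≈V) (from (V⇔ u) (c , cWa , extension⁻¹ cWa cu∈h)))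

    abstract
      value-exists : ∀ a → a ∈ A → ∃[ v ] Value W a v
      value-exists = W-induction (∃ᵈ valueᵈ v2 v1 v0) (W ∷ []) λ a a∈A ih →
        let p , p⇔ = comprehension (⟨ v0 , v1 ⟩∈ᵈ v2) (a ∷ W ∷ []) A
            V , V⇔ = replacementᵈ (valueᵈ v2 v0 v1) (W ∷ []) p
                 (λ b b∈p → ih b (proj₂ (to (p⇔ b) b∈p)))
                 (λ b v v′ b∈p → value-unique (proj₁ (to (p⇔ b) b∈p)))
            -- The values of `h` are the elements of `V` together with `V` itself, so the successor
            -- of `V` serves as codomain.
            V⁺ , V⁺⇔ = successor V
            h , _ , h⇔ = relation-comprehension
              ((⟨ v0 , v2 ⟩∈ᵈ v3 ∧ᵈ valueᵈ v3 v0 v1) ∨ᵈ (v0 ≈ᵈ v2 ∧ᵈ v1 ≈ᵈ v4)) (a ∷ W ∷ V ∷ []) A V⁺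
            V⇔′ : ∀ u → u ∈ V ⇔ (∃[ c ] (⟨ c , a ⟩∈ W × Value W c u))
            V⇔′ = λ u → mk⇔
              (λ u∈V → let c , c∈p , val = to (V⇔ u) u∈V in c , proj₂ (to (p⇔ c) c∈p) , val)
              (λ (c , cWa , val) → from (V⇔ u) (c , from (p⇔ c) (proj₁ (relation-sides relation cWa) , cWa) , val))
            h⇔′ : ∀ c u → ⟨ c , u ⟩∈ h ⇔ ((⟨ c , a ⟩∈ W × Value W c u) ⊎ (c ≈ a × u ≈ V))
            h⇔′ = λ c u → mk⇔ (λ cu∈h → proj₂ (proj₂ (to (h⇔ c u) cu∈h)))
              λ { q@(inj₁ (cWa , val)) → from (h⇔ c u) (proj₁ (relation-sides relation cWa) ,
                                            from (V⁺⇔ u) (inj₁ (from (V⇔′ u) (c , cWa , val))) , q)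
                ; q@(inj₂ (c≈a , u≈V)) → from (h⇔ c u) (∈-respˡ (sym c≈a) a∈A , from (V⁺⇔ u) (inj₂ u≈V) , q) }
        in V , h , extension-attempt ih V⇔′ h⇔′ , from (h⇔′ a V) (inj₂ (refl , refl))

      graph-collapse : ∀ {g} → (∀ a v → ⟨ a , v ⟩∈ g ⇔ (a ∈ A × Value W a v)) → IsCollapse A W g
      graph-collapse {g} g⇔ =
          (λ a a∈A → let v , val = value-exists a a∈A in v , from (g⇔ a v) (a∈A , val))
        , (λ a v v′ av∈g av′∈g → value-unique (proj₁ (to (g⇔ a v) av∈g)) (proj₂ (to (g⇔ a v) av∈g)) (proj₂ (to (g⇔ a v′) av′∈g)))
        , λ a v av∈g → proj₁ (to (g⇔ a v) av∈g) , equation a v (proj₂ (to (g⇔ a v) av∈g))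
        where
        equation : ∀ a v → Value W a v → ∀ u → u ∈ v ⇔ (∃[ b ] (⟨ b , a ⟩∈ W × ⟨ b , u ⟩∈ g))
        equation a v (h , H , av∈h) u = mk⇔
          (λ u∈v → let b , bWa , bu∈h = to (proj₂ (H a v av∈h) u) u∈v
                   in b , bWa , from (g⇔ b u) (proj₁ (relation-sides relation bWa) , h , H , bu∈h))
          (λ (b , bWa , bu∈g) → let u′ , bu′∈h = proj₁ (H a v av∈h) b bWa in
            from (proj₂ (H a v av∈h) u) (b , bWa , ⟨,⟩∈-resp refl
              (value-unique (proj₁ (to (g⇔ b u) bu∈g)) (h , H , bu′∈h) (proj₂ (to (g⇔ b u) bu∈g))) bu′∈h))

      collapse : ∃[ g ] IsCollapse A W g
      collapse =
        let V , V⇔ = replacementᵈ (valueᵈ v2 v0 v1) (W ∷ []) A value-exists (λ a v v′ → value-unique)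
            g , _ , g⇔ = relation-comprehension (valueᵈ v2 v0 v1) (W ∷ []) A V
        in g , graph-collapse λ a v → mk⇔
             (λ av∈g → let a∈A , _ , val = to (g⇔ a v) av∈g in a∈A , val)
             (λ (a∈A , val) → from (g⇔ a v) (a∈A , from (V⇔ v) (a , a∈A , val) , val))

    module _ {g : Carrier} (C : IsCollapse A W g) where
      private
        unique = proj₁ (proj₂ C)
        rec    = proj₂ (proj₂ C)

      collapse-mono : ∀ {a b u v} → ⟨ a , b ⟩∈ W → ⟨ a , u ⟩∈ g → ⟨ b , v ⟩∈ g → u ∈ v
      collapse-mono aWb au∈g bv∈g = from (proj₂ (rec _ _ bv∈g) _) (_ , aWb , au∈g)

      -- Comparability is essential: in a tree order, elements of different branches may have the
      -- same value.
      collapse-injective : ∀ {a b v} → ⟨ a , b ⟩∈ W ⊎ a ≈ b ⊎ ⟨ b , a ⟩∈ W → ⟨ a , v ⟩∈ g → ⟨ b , v ⟩∈ g → a ≈ b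
      collapse-injective (inj₁ aWb)        av∈g bv∈g = ⊥-elim (∈-irrefl (collapse-mono aWb av∈g bv∈g))
      collapse-injective (inj₂ (inj₁ a≈b)) av∈g bv∈g = a≈b
      collapse-injective (inj₂ (inj₂ bWa)) av∈g bv∈g = ⊥-elim (∈-irrefl (collapse-mono bWa bv∈g av∈g))

      collapse-ordinal : ∀ {a v} → ⟨ a , v ⟩∈ g → IsOrdinal v
      collapse-ordinal {a} {v} av∈g = transitive∧total⇒ordinal
        (λ u u∈v t t∈u → let b , bWa , bu∈g = to (proj₂ (rec a v av∈g) u) u∈v
                             c , cWb , ct∈g = to (proj₂ (rec b u bu∈g) t) t∈u
                         in from (proj₂ (rec a v av∈g) t) (c , transitive c b a cWb bWa , ct∈g))
        (λ u u′ u∈v u′∈v → let b , bWa , bu∈g = to (proj₂ (rec a v av∈g) u) u∈v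
                               c , cWa , cu′∈g = to (proj₂ (rec a v av∈g) u′) u′∈v
                           in cases bu∈g cu′∈g (linearBelow a b c bWa cWa))
        where
        cases : ∀ {b c u u′} → ⟨ b , u ⟩∈ g → ⟨ c , u′ ⟩∈ g →
                ⟨ b , c ⟩∈ W ⊎ b ≈ c ⊎ ⟨ c , b ⟩∈ W → u ∈ u′ ⊎ u ≈ u′ ⊎ u′ ∈ u
        cases bu∈g cu′∈g (inj₁ bWc)        = inj₁ (collapse-mono bWc bu∈g cu′∈g)
        cases bu∈g cu′∈g (inj₂ (inj₁ b≈c)) = inj₂ (inj₁ (unique _ _ _ bu∈g (⟨,⟩∈-resp (sym b≈c) refl cu′∈g)))
        cases bu∈g cu′∈g (inj₂ (inj₂ cWb)) = inj₂ (inj₂ (collapse-mono cWb cu′∈g bu∈g))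

      -- The map is the inverse of the collapse below `a`. It is well defined because `linearBelow`
      -- makes any two predecessors of `a` comparable.
      collapse-≲ : ∀ {a v Y} → ⟨ a , v ⟩∈ g → (∀ b → ⟨ b , a ⟩∈ W → b ∈ Y) → v ≲ Y
      collapse-≲ {a} {v} {Y} av∈g below = ≲-comprehension (⟨ v1 , v2 ⟩∈ᵈ v3 ∧ᵈ ⟨ v1 , v0 ⟩∈ᵈ v4) (a ∷ W ∷ g ∷ []) v Y
        (λ u u∈v → let b , bWa , bu∈g = to (proj₂ (rec a v av∈g) u) u∈v in b , below b bWa , bWa , bu∈g)
        (λ { u b b′ _ _ _ (bWa , bu∈g) (b′Wa , b′u∈g) → collapse-injective (linearBelow a b b′ bWa b′Wa) bu∈g b′u∈g })
        (λ { u u′ b _ _ _ (_ , bu∈g) (_ , bu′∈g) → unique b u u′ bu∈g bu′∈g })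

-- Gödel's ordering of pairs and squares of infinite ordinals.

module GödelOrder {ℓ : Level} (em : ExcludedMiddle ℓ) (M : Structure ℓ) (zf : IsModelOfZF M) where
  open SetTheory em M zf
  open Ordinals em M zf
  open Collapse em M zf

  -- `m` is the maximum of the coordinates. Comparing it before the coordinates confines the
  -- predecessors of a pair to the square of `m + 1`, which the plain lexicographic order would not
  -- do.
  Key : (z m a b : Carrier) → Set ℓ
  Key z m a b = IsOrderedPair z a b × (m ≈ a ⊎ m ≈ b) × a ≤ m × b ≤ m

  Lex : (m a b m′ a′ b′ : Carrier) → Set ℓ
  Lex m a b m′ a′ b′ = m ∈ m′ ⊎ (m ≈ m′ × (a ∈ a′ ⊎ (a ≈ a′ × b ∈ b′)))

  Below : Carrier → Carrier → Set ℓ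
  Below z z′ = ∃[ m ] ∃[ a ] ∃[ b ] ∃[ m′ ] ∃[ a′ ] ∃[ b′ ] (Key z m a b × Key z′ m′ a′ b′ × Lex m a b m′ a′ b′)

  abstract
    keyᵈ : ∀ {n} (z m a b : Fin n) → Definable {n} (λ ρ → Key (lookup ρ z) (lookup ρ m) (lookup ρ a) (lookup ρ b))
    keyᵈ z m a b = orderedPairᵈ z a b ∧ᵈ (m ≈ᵈ a ∨ᵈ m ≈ᵈ b) ∧ᵈ ≤ᵈ a m ∧ᵈ ≤ᵈ b m

    lexᵈ : ∀ {n} (m a b m′ a′ b′ : Fin n) → Definable {n} (λ ρ →
      Lex (lookup ρ m) (lookup ρ a) (lookup ρ b) (lookup ρ m′) (lookup ρ a′) (lookup ρ b′))
    lexᵈ m a b m′ a′ b′ = m ∈ᵈ m′ ∨ᵈ (m ≈ᵈ m′ ∧ᵈ (a ∈ᵈ a′ ∨ᵈ (a ≈ᵈ a′ ∧ᵈ b ∈ᵈ b′)))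

    belowᵈ : ∀ {n} (z z′ : Fin n) → Definable {n} (λ ρ → Below (lookup ρ z) (lookup ρ z′))
    belowᵈ z z′ = ∃ᵈ (∃ᵈ (∃ᵈ (∃ᵈ (∃ᵈ (∃ᵈ (keyᵈ (suc (suc (suc (suc (suc (suc z)))))) v5 v4 v3
      ∧ᵈ keyᵈ (suc (suc (suc (suc (suc (suc z′)))))) v2 v1 v0 ∧ᵈ lexᵈ v5 v4 v3 v2 v1 v0))))))

    ∈⇒≱ : ∀ {α β} → α ∈ β → ¬ β ≤ α
    ∈⇒≱ α∈β (inj₁ β∈α) = ∈-asym α∈β β∈α
    ∈⇒≱ α∈β (inj₂ β≈α) = ∈-irrefl (∈-respʳ β≈α α∈β)

    key-unique : ∀ {z m a b m′ a′ b′} → Key z m a b → Key z m′ a′ b′ → m ≈ m′ × a ≈ a′ × b ≈ b′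
    key-unique {m = m} {a} {b} {m′} {a′} {b′} (z≡ab , m∈ab , a≤m , b≤m) (z≡a′b′ , m′∈ab , a′≤m′ , b′≤m′) =
      ≤-antisym (bound m∈ab (≤-resp (sym a≈a′) a′≤m′) (≤-resp (sym b≈b′) b′≤m′))
                (bound m′∈ab (≤-resp a≈a′ a≤m) (≤-resp b≈b′ b≤m)) , a≈a′ , b≈b′
      where
      a≈a′ : a ≈ a′
      a≈a′ = proj₁ (orderedPair-injective z≡ab z≡a′b′)
      b≈b′ : b ≈ b′
      b≈b′ = proj₂ (orderedPair-injective z≡ab z≡a′b′)
      bound : ∀ {m a b n} → m ≈ a ⊎ m ≈ b → a ≤ n → b ≤ n → m ≤ n
      bound (inj₁ m≈a) a≤n b≤n = ≤-resp (sym m≈a) a≤n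
      bound (inj₂ m≈b) a≤n b≤n = ≤-resp (sym m≈b) b≤n

    below⇒lex : ∀ {z z′ m a b m′ a′ b′} → Key z m a b → Key z′ m′ a′ b′ → Below z z′ → Lex m a b m′ a′ b′
    below⇒lex K K′ (m₁ , a₁ , b₁ , m₂ , a₂ , b₂ , K₁ , K₂ , l) =
      move (key-unique K₁ K) (key-unique K₂ K′)
      where
      move : ∀ {m a b m′ a′ b′} → m₁ ≈ m × a₁ ≈ a × b₁ ≈ b → m₂ ≈ m′ × a₂ ≈ a′ × b₂ ≈ b′ → Lex m a b m′ a′ b′
      move (e₁ , e₂ , e₃) (e₄ , e₅ , e₆) = resp (lexᵈ v0 v1 v2 v3 v4 v5)
        {_ ∷ _ ∷ _ ∷ _ ∷ _ ∷ _ ∷ []} {_ ∷ _ ∷ _ ∷ _ ∷ _ ∷ _ ∷ []}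
        (λ { v0 → e₁ ; v1 → e₂ ; v2 → e₃ ; v3 → e₄ ; v4 → e₅ ; v5 → e₆ }) l

    lex-trans : ∀ {m a b m′ a′ b′ m″ a″ b″} → IsOrdinal m″ → IsOrdinal a″ → IsOrdinal b″ →
                Lex m a b m′ a′ b′ → Lex m′ a′ b′ m″ a″ b″ → Lex m a b m″ a″ b″
    lex-trans om oa ob (inj₁ p) (inj₁ q) = inj₁ (ordinal-transitive om p q)
    lex-trans om oa ob (inj₁ p) (inj₂ (q , _)) = inj₁ (∈-respʳ q p)
    lex-trans om oa ob (inj₂ (p , _)) (inj₁ q) = inj₁ (∈-respˡ (sym p) q)
    lex-trans {a″ = a″} {b″ = b″} om oa ob (inj₂ (p , r)) (inj₂ (q , s)) = inj₂ (trans p q , rest r s)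
      where
      rest : ∀ {a b a′ b′} → a ∈ a′ ⊎ (a ≈ a′ × b ∈ b′) → a′ ∈ a″ ⊎ (a′ ≈ a″ × b′ ∈ b″) → a ∈ a″ ⊎ (a ≈ a″ × b ∈ b″)
      rest (inj₁ p) (inj₁ q) = inj₁ (ordinal-transitive oa p q)
      rest (inj₁ p) (inj₂ (q , _)) = inj₁ (∈-respʳ q p)
      rest (inj₂ (p , _)) (inj₁ q) = inj₁ (∈-respˡ (sym p) q)
      rest (inj₂ (p , r)) (inj₂ (q , s)) = inj₂ (trans p q , ordinal-transitive ob r s)

    lex-total : ∀ {θ m a b m′ a′ b′} → IsOrdinal θ → m ∈ θ → a ∈ θ → b ∈ θ → m′ ∈ θ → a′ ∈ θ → b′ ∈ θ →
                Lex m a b m′ a′ b′ ⊎ (a ≈ a′ × b ≈ b′) ⊎ Lex m′ a′ b′ m a b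
    lex-total oθ m∈ a∈ b∈ m′∈ a′∈ b′∈ with ordinal-total oθ _ _ m∈ m′∈
    ... | inj₁ p        = inj₁ (inj₁ p)
    ... | inj₂ (inj₂ p) = inj₂ (inj₂ (inj₁ p))
    ... | inj₂ (inj₁ p) with ordinal-total oθ _ _ a∈ a′∈
    ...   | inj₁ q        = inj₁ (inj₂ (p , inj₁ q))
    ...   | inj₂ (inj₂ q) = inj₂ (inj₂ (inj₂ (sym p , inj₁ q)))
    ...   | inj₂ (inj₁ q) with ordinal-total oθ _ _ b∈ b′∈
    ...     | inj₁ r        = inj₁ (inj₂ (p , inj₂ (q , r)))
    ...     | inj₂ (inj₂ r) = inj₂ (inj₂ (inj₂ (sym p , inj₂ (sym q , r))))
    ...     | inj₂ (inj₁ r) = inj₂ (inj₁ (q , r))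

  module _ {θ p W : Carrier} (oθ : IsOrdinal θ) (p⇔ : IsProduct p θ θ) (relation : IsRelation W p p)
    (W⇔ : ∀ z z′ → ⟨ z , z′ ⟩∈ W ⇔ (z ∈ p × z′ ∈ p × Below z z′)) where

    HasKey : Carrier → Set ℓ
    HasKey z = ∃[ m ] ∃[ a ] ∃[ b ] (Key z m a b × m ∈ θ × a ∈ θ × b ∈ θ)

    abstract
      hasKey : ∀ z → z ∈ p → HasKey z
      hasKey z z∈p = keyOf (to (p⇔ z) z∈p)
        where
        keyOf : (∃₂ λ a b → IsOrderedPair z a b × a ∈ θ × b ∈ θ) → HasKey z
        keyOf (a , b , z≡ab , a∈θ , b∈θ) = let m , m∈θ , m∈ab , a≤m , b≤m = maximum oθ a∈θ b∈θ in
          m , a , b , (z≡ab , m∈ab , a≤m , b≤m) , m∈θ , a∈θ , b∈θ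

      W⇒lex : ∀ {z z′ m a b m′ a′ b′} → Key z m a b → Key z′ m′ a′ b′ → ⟨ z , z′ ⟩∈ W → Lex m a b m′ a′ b′
      W⇒lex {z} {z′} K K′ zWz′ = below⇒lex K K′ (proj₂ (proj₂ (to (W⇔ z z′) zWz′)))

      lex⇒W : ∀ {z z′ m a b m′ a′ b′} → z ∈ p → z′ ∈ p → Key z m a b → Key z′ m′ a′ b′ →
              Lex m a b m′ a′ b′ → ⟨ z , z′ ⟩∈ W
      lex⇒W {z} {z′} z∈p z′∈p K K′ l = from (W⇔ z z′) (z∈p , z′∈p , _ , _ , _ , _ , _ , _ , K , K′ , l)

      W-trans : ∀ x y z → ⟨ x , y ⟩∈ W → ⟨ y , z ⟩∈ W → ⟨ x , z ⟩∈ W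
      W-trans x y z xWy yWz = go (hasKey x x∈p) (hasKey y (proj₁ (relation-sides relation yWz))) (hasKey z z∈p)
        where
        x∈p : x ∈ p
        x∈p = proj₁ (relation-sides relation xWy)
        z∈p : z ∈ p
        z∈p = proj₂ (relation-sides relation yWz)
        go : HasKey x → HasKey y → HasKey z → ⟨ x , z ⟩∈ W
        go (_ , _ , _ , K , _) (_ , _ , _ , K′ , _) (_ , _ , _ , K″ , m∈ , a∈ , b∈) = lex⇒W x∈p z∈p K K″
          (lex-trans (∈-ordinal oθ m∈) (∈-ordinal oθ a∈) (∈-ordinal oθ b∈) (W⇒lex K K′ xWy) (W⇒lex K′ K″ yWz))

      W-total : ∀ x y → x ∈ p → y ∈ p → ⟨ x , y ⟩∈ W ⊎ x ≈ y ⊎ ⟨ y , x ⟩∈ W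
      W-total x y x∈p y∈p = go (hasKey x x∈p) (hasKey y y∈p)
        where
        go : HasKey x → HasKey y → ⟨ x , y ⟩∈ W ⊎ x ≈ y ⊎ ⟨ y , x ⟩∈ W
        go (_ , _ , _ , K , m∈ , a∈ , b∈) (_ , _ , _ , K′ , m′∈ , a′∈ , b′∈)
          with lex-total oθ m∈ a∈ b∈ m′∈ a′∈ b′∈
        ... | inj₁ l = inj₁ (lex⇒W x∈p y∈p K K′ l)
        ... | inj₂ (inj₂ l) = inj₂ (inj₂ (lex⇒W y∈p x∈p K′ K l))
        ... | inj₂ (inj₁ (a≈a′ , b≈b′)) =
          inj₂ (inj₁ (orderedPair-unique (orderedPair-resp refl a≈a′ b≈b′ (proj₁ K)) (proj₁ K′)))

      -- Three successive minimisations: of the maximum over `s`, of the first coordinate among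
      -- pairs with that maximum, and of the second among those that remain. The local lemmas run
      -- backwards, from the last minimisation to the first.
      W-wellFounded : ∀ s → s ⊆ p → Nonempty s → ∃[ m ] (m ∈ s × (∀ z → z ∈ s → ¬ ⟨ z , m ⟩∈ W))
      W-wellFounded s s⊆p (z₀ , z₀∈s) = first (hasKey z₀ (s⊆p z₀ z₀∈s))
        where
        Goal : Set ℓ
        Goal = ∃[ m ] (m ∈ s × (∀ z → z ∈ s → ¬ ⟨ z , m ⟩∈ W))
        third : ∀ m a → m ∈ θ → a ∈ θ →
                (∀ m′ → m′ ∈ θ → (∃[ z ] ∃[ a′ ] ∃[ b′ ] (z ∈ s × Key z m′ a′ b′)) → m ≤ m′) →
                (∀ a′ → a′ ∈ θ → (∃[ z ] ∃[ b′ ] (z ∈ s × Key z m a′ b′)) → a ≤ a′) →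
                (∃[ b ] (b ∈ θ × (∃[ z ] (z ∈ s × Key z m a b)) ×
                  (∀ b′ → b′ ∈ θ → (∃[ z ] (z ∈ s × Key z m a b′)) → b ≤ b′))) → Goal
        third m a m∈θ a∈θ m-min a-min (b , b∈θ , (z , z∈s , K) , b-min) = z , z∈s , λ z′ z′∈s z′Wz →
          absurd (hasKey z′ (s⊆p z′ z′∈s)) z′∈s z′Wz
          where
          absurd : ∀ {z′} → HasKey z′ → z′ ∈ s → ⟨ z′ , z ⟩∈ W → ⊥
          absurd {z′} (m′ , a′ , b′ , K′ , m′∈θ , a′∈θ , b′∈θ) z′∈s z′Wz with W⇒lex K′ K z′Wz
          ... | inj₁ m′∈m = ∈⇒≱ m′∈m (m-min m′ m′∈θ (z′ , a′ , b′ , z′∈s , K′))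
          ... | inj₂ (m′≈m , inj₁ a′∈a) = ∈⇒≱ a′∈a (a-min a′ a′∈θ (z′ , b′ , z′∈s ,
            resp (keyᵈ v0 v1 v2 v3) {_ ∷ _ ∷ _ ∷ _ ∷ []} {_ ∷ _ ∷ _ ∷ _ ∷ []} (λ { v0 → refl ; v1 → m′≈m ; v2 → refl ; v3 → refl }) K′))
          ... | inj₂ (m′≈m , inj₂ (a′≈a , b′∈b)) = ∈⇒≱ b′∈b (b-min b′ b′∈θ (z′ , z′∈s ,
            resp (keyᵈ v0 v1 v2 v3) {_ ∷ _ ∷ _ ∷ _ ∷ []} {_ ∷ _ ∷ _ ∷ _ ∷ []} (λ { v0 → refl ; v1 → m′≈m ; v2 → a′≈a ; v3 → refl }) K′))
        second : ∀ m → m ∈ θ → (∀ m′ → m′ ∈ θ → (∃[ z ] ∃[ a′ ] ∃[ b′ ] (z ∈ s × Key z m′ a′ b′)) → m ≤ m′) →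
                 (∃[ a ] (a ∈ θ × (∃[ z ] ∃[ b ] (z ∈ s × Key z m a b)) ×
                   (∀ a′ → a′ ∈ θ → (∃[ z ] ∃[ b′ ] (z ∈ s × Key z m a′ b′)) → a ≤ a′))) → Goal
        second m m∈θ m-min (a , a∈θ , (z , b , z∈s , K) , a-min) = third m a m∈θ a∈θ m-min a-min
          (least (∃ᵈ (v0 ∈ᵈ v4 ∧ᵈ keyᵈ v0 v2 v3 v1)) (m ∷ a ∷ s ∷ []) oθ (b , b∈θ (hasKey z (s⊆p z z∈s)) , z , z∈s , K))
          where
          b∈θ : HasKey z → b ∈ θ
          b∈θ (_ , _ , _ , K′ , _ , _ , b′∈θ) = ∈-respˡ (proj₂ (proj₂ (key-unique K′ K))) b′∈θ
        first′ : (∃[ m ] (m ∈ θ × (∃[ z ] ∃[ a ] ∃[ b ] (z ∈ s × Key z m a b)) ×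
                   (∀ m′ → m′ ∈ θ → (∃[ z ] ∃[ a′ ] ∃[ b′ ] (z ∈ s × Key z m′ a′ b′)) → m ≤ m′))) → Goal
        first′ (m , m∈θ , (z , a , b , z∈s , K) , m-min) = second m m∈θ m-min
          (least (∃ᵈ (∃ᵈ (v1 ∈ᵈ v4 ∧ᵈ keyᵈ v1 v3 v2 v0))) (m ∷ s ∷ []) oθ (a , a∈θ (hasKey z (s⊆p z z∈s)) , z , b , z∈s , K))
          where
          a∈θ : HasKey z → a ∈ θ
          a∈θ (_ , _ , _ , K′ , _ , a′∈θ , _) = ∈-respˡ (proj₁ (proj₂ (key-unique K′ K))) a′∈θ
        first : HasKey z₀ → Goal
        first (m , a , b , K , m∈θ , _) = first′
          (least (∃ᵈ (∃ᵈ (∃ᵈ (v2 ∈ᵈ v4 ∧ᵈ keyᵈ v2 v3 v1 v0)))) (s ∷ []) oθ (m , m∈θ , z₀ , a , b , z₀∈s , K))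

    gödelOrder : IsTreeOrder p W
    gödelOrder = record
      { relation    = relation
      ; transitive  = W-trans
      ; wellFounded = W-wellFounded
      ; linearBelow = λ a b c bWa cWa → W-total b c (proj₁ (relation-sides relation bWa)) (proj₁ (relation-sides relation cWa))
      }

  module _ {w : Carrier} (ωw : Isω w) where
    private
      limω : IsLimitOrdinal w
      limω = proj₁ ωw

    abstract
      -- Hilbert's hotel: m goes to 0 and every natural number to its successor.
      successor-≲ : ∀ {m s} → IsOrdinal m → w ⊆ m → IsSuccessorOf s m → s ≲ m
      successor-≲ {m} {s} om w⊆m s⇔ = ≲-comprehension
        ((v0 ≈ᵈ v2 ∧ᵈ v1 ∈ᵈ v3 ∧ᵈ (¬ᵈ (∃ᵈ (v0 ∈ᵈ v2))))
          ∨ᵈ (v0 ∈ᵈ v3 ∧ᵈ (∀ᵈ (v0 ∈ᵈ v2 ⇔ᵈ v0 ∈ᵈ v1 ∨ᵈ v0 ≈ᵈ v1)))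
          ∨ᵈ ((¬ᵈ (v0 ≈ᵈ v2)) ∧ᵈ (¬ᵈ (v0 ∈ᵈ v3)) ∧ᵈ v0 ≈ᵈ v1)) (m ∷ w ∷ []) s m
        total (λ a b b′ _ _ _ → unique) (λ a a′ b _ _ _ → injective)
        where
        Shift : Carrier → Carrier → Set ℓ
        Shift x y = (x ≈ m × y ∈ w × ¬ Nonempty y) ⊎ (x ∈ w × IsSuccessorOf y x) ⊎ (¬ x ≈ m × ¬ x ∈ w × x ≈ y)
        m∉w : ∀ {x} → x ≈ m → ¬ x ∈ w
        m∉w x≈m x∈w = ∈-irrefl (w⊆m m (∈-respˡ x≈m x∈w))
        total : ∀ x → x ∈ s → ∃[ y ] (y ∈ m × Shift x y)
        total x x∈s with em {x ≈ m}
        ... | yes x≈m with foundation w (proj₁ (proj₂ limω))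
        ...   | e , e∈w , min = e , w⊆m e e∈w , inj₁ (x≈m , e∈w , λ (z , z∈e) → min z z∈e (ordinal-transitive (proj₁ limω) z∈e e∈w))
        total x x∈s | no x≉m with em {x ∈ w}
        ...   | yes x∈w = let y , y∈w , y⇔ = limit-successor limω x∈w in y , w⊆m y y∈w , inj₂ (inj₁ (x∈w , y⇔))
        ...   | no x∉w with to (s⇔ x) x∈s
        ...     | inj₁ x∈m = x , x∈m , inj₂ (inj₂ (x≉m , x∉w , refl))
        ...     | inj₂ x≈m = ⊥-elim (x≉m x≈m)
        same : ∀ {y y′ x} → IsSuccessorOf y x → IsSuccessorOf y′ x → y ≈ y′
        same h h′ = extensionality _ _ λ z → mk⇔ (λ p → from (h′ z) (to (h z) p)) (λ p → from (h z) (to (h′ z) p))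
        unique : ∀ {x y y′} → Shift x y → Shift x y′ → y ≈ y′
        unique (inj₁ (_ , _ , e)) (inj₁ (_ , _ , e′)) =
          extensionality _ _ λ z → mk⇔ (λ z∈ → ⊥-elim (e (z , z∈))) (λ z∈ → ⊥-elim (e′ (z , z∈)))
        unique (inj₁ (x≈m , _)) (inj₂ (inj₁ (x∈w , _))) = ⊥-elim (m∉w x≈m x∈w)
        unique (inj₁ (x≈m , _)) (inj₂ (inj₂ (x≉m , _))) = ⊥-elim (x≉m x≈m)
        unique (inj₂ (inj₁ (x∈w , _))) (inj₁ (x≈m , _)) = ⊥-elim (m∉w x≈m x∈w)
        unique (inj₂ (inj₁ (_ , h))) (inj₂ (inj₁ (_ , h′))) = same h h′
        unique (inj₂ (inj₁ (x∈w , _))) (inj₂ (inj₂ (_ , x∉w , _))) = ⊥-elim (x∉w x∈w)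
        unique (inj₂ (inj₂ (x≉m , _))) (inj₁ (x≈m , _)) = ⊥-elim (x≉m x≈m)
        unique (inj₂ (inj₂ (_ , x∉w , _))) (inj₂ (inj₁ (x∈w , _))) = ⊥-elim (x∉w x∈w)
        unique (inj₂ (inj₂ (_ , _ , e))) (inj₂ (inj₂ (_ , _ , e′))) = trans (sym e) e′
        successor-injective : ∀ {x x′ y} → IsSuccessorOf y x → IsSuccessorOf y x′ → x ≈ x′
        successor-injective {x} {x′} h h′ with to (h′ x) (from (h x) (inj₂ refl)) | to (h x′) (from (h′ x′) (inj₂ refl))
        ... | inj₂ e | _ = e
        ... | inj₁ _ | inj₂ e = sym e
        ... | inj₁ x∈x′ | inj₁ x′∈x = ⊥-elim (∈-asym x∈x′ x′∈x)
        successor∈w : ∀ {x y} → x ∈ w → IsSuccessorOf y x → y ∈ w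
        successor∈w x∈w h = let y , y∈w , y⇔ = limit-successor limω x∈w in ∈-respˡ (same y⇔ h) y∈w
        injective : ∀ {x x′ y} → Shift x y → Shift x′ y → x ≈ x′
        injective (inj₁ (x≈m , _)) (inj₁ (x′≈m , _)) = trans x≈m (sym x′≈m)
        injective (inj₁ (_ , _ , e)) (inj₂ (inj₁ (_ , h))) = ⊥-elim (e (_ , from (h _) (inj₂ refl)))
        injective (inj₁ (_ , y∈w , _)) (inj₂ (inj₂ (_ , x′∉w , x′≈y))) = ⊥-elim (x′∉w (∈-respˡ (sym x′≈y) y∈w))
        injective (inj₂ (inj₁ (_ , h))) (inj₁ (_ , _ , e)) = ⊥-elim (e (_ , from (h _) (inj₂ refl)))
        injective (inj₂ (inj₁ (_ , h))) (inj₂ (inj₁ (_ , h′))) = successor-injective h h′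
        injective (inj₂ (inj₁ (x∈w , h))) (inj₂ (inj₂ (_ , x′∉w , x′≈y))) = ⊥-elim (x′∉w (∈-respˡ (sym x′≈y) (successor∈w x∈w h)))
        injective (inj₂ (inj₂ (_ , x∉w , x≈y))) (inj₁ (_ , y∈w , _)) = ⊥-elim (x∉w (∈-respˡ (sym x≈y) y∈w))
        injective (inj₂ (inj₂ (_ , x∉w , x≈y))) (inj₂ (inj₁ (x′∈w , h))) = ⊥-elim (x∉w (∈-respˡ (sym x≈y) (successor∈w x′∈w h)))
        injective (inj₂ (inj₂ (_ , _ , e))) (inj₂ (inj₂ (_ , _ , e′))) = trans e (sym e′)

    SquareEmbeds : Carrier → Set ℓ
    SquareEmbeds θ = ∃[ p ] (IsProduct p θ θ × p ≲ θ)

    abstract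
      square-≲′ : ∀ {x y p} → IsProduct p x x → x ≲ y → SquareEmbeds y → p ≲ y
      square-≲′ p⇔ x≲y (q , q⇔ , q≲y) = ≲-trans (≲-product x≲y x≲y p⇔ q⇔) q≲y

      module _ {θ p W g : Carrier} (oθ : IsOrdinal θ) (w⊆θ : w ⊆ θ)
        (ih : ∀ ν → ν ∈ θ → w ⊆ ν → SquareEmbeds ν)
        (small : ∀ ν → ν ∈ θ → w ⊆ ν → ¬ θ ≲ ν)
        (p⇔ : IsProduct p θ θ) (relation : IsRelation W p p)
        (W⇔ : ∀ z z′ → ⟨ z , z′ ⟩∈ W ⇔ (z ∈ p × z′ ∈ p × Below z z′))
        (C : IsCollapse p W g) where
        private
          T : IsTreeOrder p W
          T = gödelOrder oθ p⇔ relation W⇔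

        -- The predecessors of a pair with maximum m lie in (m + 1) × (m + 1).
        predecessors : ∀ {z v m a b s q} → ⟨ z , v ⟩∈ g → z ∈ p → Key z m a b → m ∈ θ → IsSuccessorOf s m → IsProduct q s s → v ≲ q
        predecessors {z} {v} {m} {a} {b} {s} {q} zv∈g z∈p K m∈θ s⇔ q⇔ = collapse-≲ T C zv∈g λ y yWz →
          bound y yWz (hasKey oθ p⇔ relation W⇔ y (proj₁ (relation-sides relation yWz)))
          where
          ≤m : ∀ {x m′} → x ≤ m′ → m′ ≤ m → x ∈ s
          ≤m x≤m′ m′≤m = from (s⇔ _) (≤-trans (∈-ordinal oθ m∈θ) x≤m′ m′≤m)
          lex-≤ : ∀ {m′ a′ b′} → Lex m′ a′ b′ m a b → m′ ≤ m
          lex-≤ (inj₁ m′∈m) = inj₁ m′∈m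
          lex-≤ (inj₂ (m′≈m , _)) = inj₂ m′≈m
          bound : ∀ y → ⟨ y , z ⟩∈ W → HasKey oθ p⇔ relation W⇔ y → y ∈ q
          bound y yWz (m′ , a′ , b′ , K′@(y≡a′b′ , _ , a′≤m′ , b′≤m′) , _) =
            let m′≤m = lex-≤ (W⇒lex oθ p⇔ relation W⇔ K′ K yWz)
            in from (q⇔ y) (a′ , b′ , y≡a′b′ , ≤m a′≤m′ m′≤m , ≤m b′≤m′ m′≤m)

        -- Otherwise `θ` would inject into the square of `m + 1`. For infinite `m` that square
        -- injects into `m` by `successor-≲` and `ih`, against `small`; for finite `m` a finite
        -- square would contain a copy of `ω`.
        too-small : ∀ {z v m a b s q} → ⟨ z , v ⟩∈ g → z ∈ p → Key z m a b → m ∈ θ →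
                    IsSuccessorOf s m → IsProduct q s s → ¬ θ ⊆ v
        too-small {z} {v} {m} {a} {b} {s} {q} zv∈g z∈p K m∈θ s⇔ q⇔ θ⊆v with ∈-or-≥ (∈-ordinal oθ m∈θ) (proj₁ limω)
        ... | inj₂ w≤m = let om = ∈-ordinal oθ m∈θ
                             w⊆m = ≤⇒⊆ om w≤m
                         in small m m∈θ w⊆m (≲-trans θ≲q (square-≲′ q⇔ (successor-≲ om w⊆m s⇔) (ih m m∈θ w⊆m)))
          where
          θ≲q : θ ≲ q
          θ≲q = ≲-trans (⊆⇒≲ θ⊆v) (predecessors zv∈g z∈p K m∈θ s⇔ q⇔)
        ... | inj₁ m∈w = finite (limit-successor limω m∈w)
          where
          finite : ∃[ s′ ] (s′ ∈ w × IsSuccessorOf s′ m) → ⊥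
          finite (s′ , s′∈w , s′⇔) =
            let q′ , q′⇔ = product s′ s′
            in ω-not-≲-finite-square ωw s′∈w q′⇔ (≲-trans (⊆⇒≲ w⊆θ) (≲-trans (⊆⇒≲ θ⊆v) (predecessors zv∈g z∈p K m∈θ s′⇔ q′⇔)))

        value∈ : ∀ {z v} → ⟨ z , v ⟩∈ g → z ∈ p → HasKey oθ p⇔ relation W⇔ z → v ∈ θ
        value∈ {z} {v} zv∈g z∈p (m , a , b , K , m∈θ , _) with ∈-or-≥ (collapse-ordinal T C zv∈g) oθ
        ... | inj₁ v∈θ = v∈θ
        ... | inj₂ θ≤v = let s , s⇔ = successor m
                             q , q⇔ = product s s
                         in ⊥-elim (too-small zv∈g z∈p K m∈θ s⇔ q⇔ (≤⇒⊆ (collapse-ordinal T C zv∈g) θ≤v))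

        initial-square-≲ : p ≲ θ
        initial-square-≲ = ≲-comprehension (⟨ v0 , v1 ⟩∈ᵈ v2) (g ∷ []) p θ
          (λ z z∈p → let v , zv∈g = proj₁ C z z∈p in v , value∈ zv∈g z∈p (hasKey oθ p⇔ relation W⇔ z z∈p) , zv∈g)
          (λ z v v′ _ _ _ → proj₁ (proj₂ C) z v v′)
          (λ z z′ v z∈p z′∈p _ → collapse-injective T C (W-total oθ p⇔ relation W⇔ z z′ z∈p z′∈p))

      -- If `θ` injects into a smaller infinite `ν`, the embedding for `ν` is transported. Otherwise
      -- every proper initial segment of the Gödel order has order type below `θ`, and the collapse
      -- itself is the embedding.
      square-step : ∀ θ → IsOrdinal θ → (∀ ν → ν ∈ θ → w ⊆ ν → SquareEmbeds ν) → w ⊆ θ → SquareEmbeds θ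
      square-step θ oθ ih w⊆θ with em {∃[ ν ] (ν ∈ θ × w ⊆ ν × θ ≲ ν)}
      ... | yes (ν , ν∈θ , w⊆ν , θ≲ν) = let p , p⇔ = product θ θ in
        p , p⇔ , ≲-trans (square-≲′ p⇔ θ≲ν (ih ν ν∈θ w⊆ν)) (⊆⇒≲ (≤⇒⊆ oθ (inj₁ ν∈θ)))
      ... | no none = embed (product θ θ)
        where
        embed : ∃[ p ] IsProduct p θ θ → SquareEmbeds θ
        embed (p , p⇔) =
          let W , relation , W⇔ = relation-comprehension (belowᵈ v0 v1) [] p p
              g , C = collapse (gödelOrder oθ p⇔ relation W⇔)
          in p , p⇔ , initial-square-≲ oθ w⊆θ ih (λ ν ν∈θ w⊆ν θ≲ν → none (ν , ν∈θ , w⊆ν , θ≲ν)) p⇔ relation W⇔ C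

      square-≲ : ∀ {θ} → IsOrdinal θ → w ⊆ θ → SquareEmbeds θ
      square-≲ {θ} oθ w⊆θ =
        -- The induction needs a transitive set that has `θ` as an element.
        let S , S⇔ = successor θ
            oS = successor-ordinal oθ S⇔
        in ∈-induction ((∀ᵈ (v0 ∈ᵈ v2 ⇒ᵈ v0 ∈ᵈ v1)) ⇒ᵈ (∃ᵈ (productᵈ v0 v1 v1 ∧ᵈ ≲ᵈ v0 v1))) (w ∷ []) S
             (λ x x∈S ih → square-step x (∈-ordinal oS x∈S) (λ ν ν∈x → ih ν ν∈x (ordinal-transitive oS ν∈x x∈S)))
             θ (from (S⇔ θ) (inj₂ refl)) w⊆θ

-- Relations with countable columns.

module CountableCovers {ℓ : Level} (em : ExcludedMiddle ℓ) (M : Structure ℓ) (zf : IsModelOfZF M) where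
  open SetTheory em M zf
  open Ordinals em M zf
  open Collapse em M zf
  open GödelOrder em M zf

  -- Each column is countable on its own. Fixing an enumeration for every `ξ` at once would take
  -- choice.
  CountableColumns : (B x : Carrier) → Set ℓ
  CountableColumns B x = ∀ ξ → ξ ∈ x → ∃[ c ] (Countable c × (∀ β → ⟨ ξ , β ⟩∈ B → β ∈ c))

  abstract
    countable-≲ : ∀ {x y} → x ≲ y → Countable y → Countable x
    countable-≲ x≲y (w , f , ωw , inj) = let g , inj′ = ≲-trans x≲y (f , inj) in w , g , ωw , inj′

    countable⇒∈ω₁ : ∀ {ω₁ v} → Isω₁ ω₁ → IsOrdinal v → Countable v → v ∈ ω₁
    countable⇒∈ω₁ (o₁ , uncountable , _) ov countable with ∈-or-≥ ov o₁
    ... | inj₁ v∈ω₁ = v∈ω₁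
    ... | inj₂ ω₁≤v = ⊥-elim (uncountable (countable-≲ (⊆⇒≲ (≤⇒⊆ ov ω₁≤v)) countable))

    ω⊆ω₁ : ∀ {w ω₁} → Isω w → Isω₁ ω₁ → w ⊆ ω₁
    ω⊆ω₁ ωw@((ow , _) , _) (o₁ , uncountable , _) with ∈-or-≥ o₁ ow
    ... | inj₂ w≤ω₁ = ≤⇒⊆ o₁ w≤ω₁
    ... | inj₁ ω₁∈w = let f , inj = ⊆⇒≲ (≤⇒⊆ ow (inj₁ ω₁∈w)) in ⊥-elim (uncountable (_ , f , ωw , inj))

  -- Orders each column by its second coordinates and leaves different columns incomparable. The
  -- collapse of a pair `(ξ, β)` is thus the order type of the part of column `ξ` below `β`.
  SameColumn : Carrier → Carrier → Set ℓ
  SameColumn z z′ = ∃[ ξ ] ∃[ β ] ∃[ β′ ] (IsOrderedPair z ξ β × IsOrderedPair z′ ξ β′ × β ∈ β′)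

  module _ {α κ B W : Carrier} (oκ : IsOrdinal κ) (B-rel : IsRelation B α κ) (relation : IsRelation W B B)
    (W⇔ : ∀ z z′ → ⟨ z , z′ ⟩∈ W ⇔ (z ∈ B × z′ ∈ B × SameColumn z z′)) where

    abstract
      W-elim : ∀ {z z′ ξ β} → ⟨ z , z′ ⟩∈ W → IsOrderedPair z′ ξ β → ∃[ β₁ ] (IsOrderedPair z ξ β₁ × β₁ ∈ β)
      W-elim {z} {z′} {ξ} {β} zWz′ z′≡ξβ = go (proj₂ (proj₂ (to (W⇔ z z′) zWz′)))
        where
        go : SameColumn z z′ → ∃[ β₁ ] (IsOrderedPair z ξ β₁ × β₁ ∈ β)
        go (ξ₁ , β₁ , β′ , z≡ , z′≡ , β₁∈β′) =
          β₁ , orderedPair-resp refl (proj₁ (orderedPair-injective z′≡ z′≡ξβ)) refl z≡ ,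
          ∈-respʳ (proj₂ (orderedPair-injective z′≡ z′≡ξβ)) β₁∈β′

      W-intro : ∀ {z z′ ξ β β′} → z ∈ B → z′ ∈ B → IsOrderedPair z ξ β → IsOrderedPair z′ ξ β′ → β ∈ β′ → ⟨ z , z′ ⟩∈ W
      W-intro {z} {z′} z∈B z′∈B z≡ z′≡ β∈β′ = from (W⇔ z z′) (z∈B , z′∈B , _ , _ , _ , z≡ , z′≡ , β∈β′)

      second∈ : ∀ {z ξ β} → z ∈ B → IsOrderedPair z ξ β → β ∈ κ
      second∈ z∈B z≡ = proj₂ (relation-sides B-rel (_ , z≡ , z∈B))

      columnOrder-total : ∀ {z z′ ξ β β′} → z ∈ B → z′ ∈ B → IsOrderedPair z ξ β → IsOrderedPair z′ ξ β′ →
        ⟨ z , z′ ⟩∈ W ⊎ z ≈ z′ ⊎ ⟨ z′ , z ⟩∈ W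
      columnOrder-total z∈B z′∈B z≡ z′≡ with ordinal-total oκ _ _ (second∈ z∈B z≡) (second∈ z′∈B z′≡)
      ... | inj₁ β∈β′        = inj₁ (W-intro z∈B z′∈B z≡ z′≡ β∈β′)
      ... | inj₂ (inj₁ β≈β′) = inj₂ (inj₁ (orderedPair-unique (orderedPair-resp refl refl β≈β′ z≡) z′≡))
      ... | inj₂ (inj₂ β′∈β) = inj₂ (inj₂ (W-intro z′∈B z∈B z′≡ z≡ β′∈β))

      columnOrder : IsTreeOrder B W
      columnOrder = record
        { relation    = relation
        ; transitive  = λ a b c aWb bWc → tr a b c aWb bWc (B-rel c (proj₂ (relation-sides relation bWc)))
        ; wellFounded = λ { s s⊆B (z , z∈s) → wf s s⊆B z z∈s (B-rel z (s⊆B z z∈s)) }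
        ; linearBelow = λ a b c bWa cWa → linear a b c bWa cWa (B-rel a (proj₂ (relation-sides relation bWa)))
        }
        where
        Pair : Carrier → Set ℓ
        Pair z = ∃₂ λ ξ β → IsOrderedPair z ξ β × ξ ∈ α × β ∈ κ
        tr : ∀ a b c → ⟨ a , b ⟩∈ W → ⟨ b , c ⟩∈ W → Pair c → ⟨ a , c ⟩∈ W
        tr a b c aWb bWc (ξ , β , c≡ , _ , β∈κ) =
          let β₁ , b≡ , β₁∈β = W-elim bWc c≡
              β₂ , a≡ , β₂∈β₁ = W-elim aWb b≡
          in W-intro (proj₁ (relation-sides relation aWb)) (proj₂ (relation-sides relation bWc)) a≡ c≡
               (ordinal-transitive (∈-ordinal oκ β∈κ) β₂∈β₁ β₁∈β)
        wf : ∀ s → s ⊆ B → ∀ z → z ∈ s → Pair z → ∃[ m ] (m ∈ s × (∀ a → a ∈ s → ¬ ⟨ a , m ⟩∈ W))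
        wf s s⊆B z z∈s (ξ , β , z≡ , _ , β∈κ) =
          -- Only the column of the given `z` is searched: elements of other columns are never below
          -- one of this column, so its least point in `s` is minimal in all of `s`.
          finish (least (∃ᵈ (orderedPairᵈ v0 v2 v1 ∧ᵈ v0 ∈ᵈ v3)) (ξ ∷ s ∷ []) oκ (β , β∈κ , z , z≡ , z∈s))
          where
          finish : (∃[ β ] (β ∈ κ × (∃[ y ] (IsOrderedPair y ξ β × y ∈ s)) ×
                     (∀ γ → γ ∈ κ → (∃[ y ] (IsOrderedPair y ξ γ × y ∈ s)) → β ≤ γ))) →
                   ∃[ m ] (m ∈ s × (∀ a → a ∈ s → ¬ ⟨ a , m ⟩∈ W))
          finish (β , β∈κ , (y , y≡ , y∈s) , min) = y , y∈s , λ a a∈s aWy →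
            let β₁ , a≡ , β₁∈β = W-elim aWy y≡
            in ∈⇒≱ β₁∈β (min β₁ (second∈ (s⊆B a a∈s) a≡) (a , a≡ , a∈s))
        linear : ∀ a b c → ⟨ b , a ⟩∈ W → ⟨ c , a ⟩∈ W → Pair a → ⟨ b , c ⟩∈ W ⊎ b ≈ c ⊎ ⟨ c , b ⟩∈ W
        linear a b c bWa cWa (ξ , β , a≡ , _) =
          columnOrder-total (proj₁ (relation-sides relation bWa)) (proj₁ (relation-sides relation cWa))
            (proj₁ (proj₂ (W-elim bWa a≡))) (proj₁ (proj₂ (W-elim cWa a≡)))

      -- The predecessors of the pair share its first coordinate, so their second coordinates inject
      -- them into the countable set `c`.
      column-value-countable : ∀ {g z v ξ β} → IsCollapse B W g → CountableColumns B α → ⟨ z , v ⟩∈ g →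
                               IsOrderedPair z ξ β → Countable v
      column-value-countable {g} {z} {v} {ξ} {β} C countable zv∈g z≡ =
        let z∈B = proj₁ (proj₂ (proj₂ C) z v zv∈g)
            c , c-countable , col⊆c = countable ξ (proj₁ (relation-sides B-rel (z , z≡ , z∈B)))
            Y , Y⇔ = comprehension (⟨ v0 , v1 ⟩∈ᵈ v2) (z ∷ W ∷ []) B
        in countable-≲ (≲-trans
             (collapse-≲ columnOrder C zv∈g λ b bWz → from (Y⇔ b) (proj₁ (relation-sides relation bWz) , bWz))
             (project c Y col⊆c λ y y∈Y → to (Y⇔ y) y∈Y)) c-countable
        where
        project : ∀ c Y → (∀ β → ⟨ ξ , β ⟩∈ B → β ∈ c) → (∀ y → y ∈ Y → y ∈ B × ⟨ y , z ⟩∈ W) → Y ≲ c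
        project c Y col⊆c below = ≲-comprehension (orderedPairᵈ v0 v2 v1) (ξ ∷ []) Y c
          (λ y y∈Y → let β₁ , y≡ , _ = W-elim (proj₂ (below y y∈Y)) z≡
                     in β₁ , col⊆c β₁ (y , y≡ , proj₁ (below y y∈Y)) , y≡)
          (λ y β β′ _ _ _ y≡ y≡′ → proj₂ (orderedPair-injective y≡ y≡′))
          (λ y y′ β _ _ _ y≡ y′≡ → orderedPair-unique y≡ y′≡)

      -- Equal first coordinates of two codes put both points in one column, where the order is
      -- total and the collapse injective. Countability of the column places the second coordinate
      -- in `ω₁`.
      cover-≲ : ∀ {g f ω₁ p} → Isω₁ ω₁ → IsCollapse B W g → CountableColumns B α →
                IsFunction f κ α → (∀ β ξ → ⟨ β , ξ ⟩∈ f → ⟨ ξ , β ⟩∈ B) → IsProduct p α ω₁ → κ ≲ p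
      cover-≲ {g} {f} {ω₁} {p} isω₁ C countable F choice p⇔ = ≲-comprehension
        (∃ᵈ (∃ᵈ (∃ᵈ (⟨ v3 , v2 ⟩∈ᵈ v5 ∧ᵈ orderedPairᵈ v1 v2 v3 ∧ᵈ ⟨ v1 , v0 ⟩∈ᵈ v6 ∧ᵈ orderedPairᵈ v4 v2 v0))))
        (f ∷ g ∷ []) κ p (λ β β∈κ → total β (function-total F β β∈κ)) (λ β t t′ _ _ _ → unique) (λ β β′ t _ _ _ → injective)
        where
        Code : Carrier → Carrier → Set ℓ
        Code β t = ∃[ ξ ] ∃[ z ] ∃[ v ] (⟨ β , ξ ⟩∈ f × IsOrderedPair z ξ β × ⟨ z , v ⟩∈ g × IsOrderedPair t ξ v)
        total : ∀ β → (∃[ ξ ] (ξ ∈ α × ⟨ β , ξ ⟩∈ f)) → ∃[ t ] (t ∈ p × Code β t)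
        total β (ξ , ξ∈α , βξ∈f) = go (choice β ξ βξ∈f)
          where
          go : ⟨ ξ , β ⟩∈ B → ∃[ t ] (t ∈ p × Code β t)
          go (z , z≡ , z∈B) =
            let v , zv∈g = proj₁ C z z∈B
                t , t≡ = orderedPair ξ v
            in t , from (p⇔ t) (ξ , v , t≡ , ξ∈α ,
                     countable⇒∈ω₁ isω₁ (collapse-ordinal columnOrder C zv∈g) (column-value-countable C countable zv∈g z≡)) ,
               ξ , z , v , βξ∈f , z≡ , zv∈g , t≡
        unique : ∀ {β t t′} → Code β t → Code β t′ → t ≈ t′
        unique (ξ , z , v , βξ∈f , z≡ , zv∈g , t≡) (ξ′ , z′ , v′ , βξ′∈f , z′≡ , z′v′∈g , t′≡) =
          let ξ≈ξ′ = function-unique F βξ∈f βξ′∈f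
              z≈z′ = orderedPair-unique (orderedPair-resp refl ξ≈ξ′ refl z≡) z′≡
              v≈v′ = proj₁ (proj₂ C) z′ v v′ (⟨,⟩∈-resp z≈z′ refl zv∈g) z′v′∈g
          in orderedPair-unique (orderedPair-resp refl ξ≈ξ′ v≈v′ t≡) t′≡
        injective : ∀ {β β′ t} → Code β t → Code β′ t → β ≈ β′
        injective (ξ , z , v , βξ∈f , z≡ , zv∈g , t≡) (ξ′ , z′ , v′ , β′ξ′∈f , z′≡ , z′v′∈g , t′≡) =
          let ξ′≈ξ = proj₁ (orderedPair-injective t′≡ t≡)
              v′≈v = proj₂ (orderedPair-injective t′≡ t≡)
              z′≡ξ = orderedPair-resp refl ξ′≈ξ refl z′≡
              z≈z′ = collapse-injective columnOrder C
                (columnOrder-total (proj₁ (proj₂ (proj₂ C) z v zv∈g)) (proj₁ (proj₂ (proj₂ C) z′ v′ z′v′∈g)) z≡ z′≡ξ)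
                zv∈g (⟨,⟩∈-resp refl v′≈v z′v′∈g)
          in proj₂ (orderedPair-injective z≡ (orderedPair-resp (sym z≈z′) refl refl z′≡ξ))

  abstract
    no-countable-cover : ∀ {κ ω₁ α B} → IsCardinal κ → Isω₁ ω₁ → ω₁ ∈ κ → α ∈ κ → IsRelation B α κ →
      CountableColumns B α → ¬ (∀ β → β ∈ κ → ∃[ ξ ] (⟨ ξ , β ⟩∈ B))
    no-countable-cover {κ} {ω₁} {α} {B} card@(oκ , (w , ωw , w⊆κ) , _) isω₁ ω₁∈κ α∈κ B-rel countable cover =
      contradict (maximum oκ α∈κ ω₁∈κ) (product α ω₁)
      where
      κ≲ : ∀ {p} → IsProduct p α ω₁ → κ ≲ p
      κ≲ p⇔ =
        let W , relation , W⇔ = relation-comprehension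
              (∃ᵈ (∃ᵈ (∃ᵈ (orderedPairᵈ v3 v2 v1 ∧ᵈ orderedPairᵈ v4 v2 v0 ∧ᵈ v1 ∈ᵈ v0)))) [] B B
            g , C = collapse (columnOrder oκ B-rel relation W⇔)
            f , F , choice = selection (⟨ v0 , v1 ⟩∈ᵈ v2) (B ∷ []) κ (∈-ordinal oκ α∈κ)
              (λ β β∈κ → let ξ , ξβ∈B = cover β β∈κ in ξ , proj₁ (relation-sides B-rel ξβ∈B) , ξβ∈B)
        in cover-≲ oκ B-rel relation W⇔ isω₁ C countable F choice p⇔
      contradict : (∃[ θ ] (θ ∈ κ × (θ ≈ α ⊎ θ ≈ ω₁) × α ≤ θ × ω₁ ≤ θ)) → ∃[ p ] IsProduct p α ω₁ → ⊥
      contradict (θ , θ∈κ , _ , α≤θ , ω₁≤θ) (p , p⇔) =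
        let oθ = ∈-ordinal oκ θ∈κ
            w⊆θ : w ⊆ θ
            w⊆θ = λ n n∈w → ≤⇒⊆ oθ ω₁≤θ n (ω⊆ω₁ ωw isω₁ n n∈w)
            q , q⇔ , q≲θ = square-≲ ωw oθ w⊆θ
        in cardinal-not-≲ card θ∈κ (≲-trans (κ≲ p⇔)
             (≲-trans (≲-product (⊆⇒≲ (≤⇒⊆ oθ α≤θ)) (⊆⇒≲ (≤⇒⊆ oθ ω₁≤θ)) p⇔ q⇔) q≲θ))

    -- An enumeration of an unbounded countable column is a cofinal map from ω.
    unbounded-column : ∀ {δ ξ B c w e} → IsLimitOrdinal δ → (∀ β → ⟨ ξ , β ⟩∈ B → β ∈ δ) →
      (∀ β → ⟨ ξ , β ⟩∈ B → β ∈ c) → IsInjection e c w → ¬ (∃[ γ ] BoundedAt B δ ξ γ) → HasCofinalMap w δ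
    unbounded-column {δ} {ξ} {B} {c} {w} {e} (oδ , (γ₀ , γ₀∈δ) , _) col⊆δ col⊆c (E , e-inj) unbounded =
      let f , F , sound = selection
            ((⟨ v0 , v1 ⟩∈ᵈ v3 ∧ᵈ ⟨ v2 , v0 ⟩∈ᵈ v4) ∨ᵈ (¬ᵈ (∃ᵈ (⟨ v0 , v2 ⟩∈ᵈ v4 ∧ᵈ ⟨ v3 , v0 ⟩∈ᵈ v5)))) (ξ ∷ e ∷ B ∷ []) w oδ total
      in f , F , λ β β∈δ → cofinal F sound (above β β∈δ)
      where
      Hit : Carrier → Carrier → Set ℓ
      Hit γ n = ⟨ γ , n ⟩∈ e × ⟨ ξ , γ ⟩∈ B
      total : ∀ n → n ∈ w → ∃[ γ ] (γ ∈ δ × (Hit γ n ⊎ ¬ (∃[ γ′ ] Hit γ′ n)))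
      total n n∈w with em {∃[ γ ] Hit γ n}
      ... | yes (γ , hit) = γ , col⊆δ γ (proj₂ hit) , inj₁ hit
      -- Default value at the numbers that enumerate no element of the column.
      ... | no none = γ₀ , γ₀∈δ , inj₂ none
      above : ∀ β → β ∈ δ → ∃[ γ ] (⟨ ξ , γ ⟩∈ B × β ∈ γ)
      above β β∈δ = byContradiction λ none → unbounded (β , β∈δ , λ γ ξγ∈B → le none γ ξγ∈B)
        where
        le : ¬ (∃[ γ ] (⟨ ξ , γ ⟩∈ B × β ∈ γ)) → ∀ γ → ⟨ ξ , γ ⟩∈ B → γ ≤ β
        le none γ ξγ∈B with ∈-or-≥ (∈-ordinal oδ β∈δ) (∈-ordinal oδ (col⊆δ γ ξγ∈B))
        ... | inj₁ β∈γ = ⊥-elim (none (γ , ξγ∈B , β∈γ))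
        ... | inj₂ γ≤β = γ≤β
      cofinal : ∀ {f β} → IsFunction f w δ → (∀ n γ → ⟨ n , γ ⟩∈ f → Hit γ n ⊎ ¬ (∃[ γ′ ] Hit γ′ n)) →
                (∃[ γ ] (⟨ ξ , γ ⟩∈ B × β ∈ γ)) → ∃₂ λ n γ → ⟨ n , γ ⟩∈ f × (β ∈ γ ⊎ β ≈ γ)
      cofinal {f} {β} F sound (γ , ξγ∈B , β∈γ) = at (function-total E γ (col⊆c γ ξγ∈B))
        where
        at : (∃[ n ] (n ∈ w × ⟨ γ , n ⟩∈ e)) → ∃₂ λ n γ → ⟨ n , γ ⟩∈ f × (β ∈ γ ⊎ β ≈ γ)
        at (n , n∈w , γn∈e) with function-total F n n∈w
        ... | γ′ , _ , nγ′∈f with sound n γ′ nγ′∈f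
        ...   | inj₁ (γ′n∈e , _) = n , γ′ , nγ′∈f , inj₁ (∈-respʳ (e-inj γ γ′ n γn∈e γ′n∈e) β∈γ)
        ...   | inj₂ none = ⊥-elim (none (γ , γn∈e , ξγ∈B))

    -- A contradiction cannot be expected here: for `δ = ω` a single column may be all of `ω`. The
    -- cover has forgotten that it came from a function, so finite `μ` is refuted later, by the
    -- cofinal map in the extension.
    short-cofinal-cover⇒finite : ∀ {δ λ′ μ B} → IsLimitOrdinal δ → IsCofinalityOf λ′ δ → μ ∈ λ′ →
      IsRelation B μ δ → CountableColumns B μ →
      (∀ β → β ∈ δ → ∃₂ λ ξ γ → ⟨ ξ , γ ⟩∈ B × β ≤ γ) →
      ∃[ w ] (Isω w × μ ∈ w)
    short-cofinal-cover⇒finite {δ} {λ′} {μ} {B} lim@(oδ , _) (oλ , _ , minimal) μ∈λ B-rel countable cofinal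
      with em {∃[ ξ ] (ξ ∈ μ × ¬ (∃[ γ ] BoundedAt B δ ξ γ))}
    ... | yes (ξ , ξ∈μ , unbounded) = go (countable ξ ξ∈μ)
      where
      go : (∃[ c ] (Countable c × (∀ β → ⟨ ξ , β ⟩∈ B → β ∈ c))) → ∃[ w ] (Isω w × μ ∈ w)
      go (c , (w , e , ωw , inj) , col⊆c) with ∈-or-≥ (proj₁ (proj₁ ωw)) oλ
      ... | inj₁ w∈λ = ⊥-elim (minimal w w∈λ (unbounded-column lim (λ β h → proj₂ (relation-sides B-rel h)) col⊆c inj unbounded))
      ... | inj₂ λ≤w = w , ωw , ≤⇒⊆ (proj₁ (proj₁ ωw)) λ≤w μ μ∈λ
    ... | no none = ⊥-elim (minimal μ μ∈λ bounded-map)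
      where
      bounded-map : HasCofinalMap μ δ
      bounded-map =
        let f , F , sound = selection (v0 ∈ᵈ v2 ∧ᵈ (∀ᵈ (⟨ v2 , v0 ⟩∈ᵈ v4 ⇒ᵈ ≤ᵈ v0 v1))) (δ ∷ B ∷ []) μ oδ
              (λ ξ ξ∈μ → let γ , bdd = byContradiction (λ h → none (ξ , ξ∈μ , h)) in γ , proj₁ bdd , bdd)
        in f , F , λ β β∈δ → reach F sound (cofinal β β∈δ)
        where
        reach : ∀ {f β} → IsFunction f μ δ → (∀ ξ γ → ⟨ ξ , γ ⟩∈ f → BoundedAt B δ ξ γ) →
                (∃₂ λ ξ γ → ⟨ ξ , γ ⟩∈ B × β ≤ γ) → ∃₂ λ ξ γ → ⟨ ξ , γ ⟩∈ f × (β ∈ γ ⊎ β ≈ γ)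
        reach F sound (ξ , γ , ξγ∈B , β≤γ) =
          let γ′ , γ′∈δ , ξγ′∈f = function-total F ξ (proj₁ (relation-sides B-rel ξγ∈B))
          in ξ , γ′ , ξγ′∈f , ≤-trans (∈-ordinal oδ γ′∈δ) β≤γ (proj₂ (sound ξ γ′ ξγ′∈f) γ ξγ∈B)

-- Forcing the equality of a name with a ground model set.

module ForcingRelation {ℓ : Level} (em : ExcludedMiddle ℓ) (M : Structure ℓ) (zf : IsModelOfZF M) where
  open SetTheory em M zf

  Triple : (S q σ x : Carrier) → Set ℓ
  Triple S q σ x = ∃[ t ] (IsOrderedPair t σ x × ⟨ q , t ⟩∈ S)

  -- If S is read as "q ⊩ σ = x̌", with ⊑ the order of the conditions, this is
  -- the forcing recursion for the equality of a name with a ground model set.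
  Step : (⊑ S q σ x : Carrier) → Set ℓ
  Step ⊑ S q σ x =
      (∀ τ p → ⟨ τ , p ⟩∈ σ → ∀ r → ⟨ r , q ⟩∈ ⊑ → ⟨ r , p ⟩∈ ⊑ →
         ∃[ s ] (⟨ s , r ⟩∈ ⊑ × ∃[ y ] (y ∈ x × Triple S s τ y)))
    × (∀ y → y ∈ x → ∀ r → ⟨ r , q ⟩∈ ⊑ →
         ∃[ s ] (⟨ s , r ⟩∈ ⊑ × ∃[ τ ] ∃[ p ] (⟨ τ , p ⟩∈ σ × ⟨ s , p ⟩∈ ⊑ × Triple S s τ y)))

  -- A strong form of "q forces the pair of a and b into τ": `q` itself lies below a condition
  -- attached to a suitable name, instead of being so only densely below. Every pair of the function
  -- in the extension is still forced by some condition in `G`.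
  ForcesPair : (⊑ S τ q a b : Carrier) → Set ℓ
  ForcesPair ⊑ S τ q a b = ∃[ x ] (IsOrderedPair x a b × ∃[ σ ] ∃[ p ] (⟨ σ , p ⟩∈ τ × ⟨ q , p ⟩∈ ⊑ × Triple S q σ x))

  abstract
    tripleᵈ : ∀ {n} (S q σ x : Fin n) →
      Definable {n} (λ ρ → Triple (lookup ρ S) (lookup ρ q) (lookup ρ σ) (lookup ρ x))
    tripleᵈ S q σ x = ∃ᵈ (orderedPairᵈ v0 (suc σ) (suc x) ∧ᵈ ⟨ suc q , v0 ⟩∈ᵈ suc S)

    stepᵈ : ∀ {n} (⊑ S q σ x : Fin n) →
      Definable {n} (λ ρ → Step (lookup ρ ⊑) (lookup ρ S) (lookup ρ q) (lookup ρ σ) (lookup ρ x))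
    stepᵈ ⊑ S q σ x =
      (∀ᵈ (∀ᵈ (⟨ v1 , v0 ⟩∈ᵈ suc (suc σ) ⇒ᵈ (∀ᵈ (⟨ v0 , suc (suc (suc q)) ⟩∈ᵈ suc (suc (suc ⊑)) ⇒ᵈ ⟨ v0 , v1 ⟩∈ᵈ suc (suc (suc ⊑)) ⇒ᵈ
        (∃ᵈ (⟨ v0 , v1 ⟩∈ᵈ suc (suc (suc (suc ⊑))) ∧ᵈ (∃ᵈ (v0 ∈ᵈ suc (suc (suc (suc (suc x)))) ∧ᵈ tripleᵈ (suc (suc (suc (suc (suc S))))) v1 v4 v0)))))))))
      ∧ᵈ (∀ᵈ (v0 ∈ᵈ suc x ⇒ᵈ (∀ᵈ (⟨ v0 , suc (suc q) ⟩∈ᵈ suc (suc ⊑) ⇒ᵈ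
        (∃ᵈ (⟨ v0 , v1 ⟩∈ᵈ suc (suc (suc ⊑)) ∧ᵈ (∃ᵈ (∃ᵈ (⟨ v1 , v0 ⟩∈ᵈ suc (suc (suc (suc (suc σ)))) ∧ᵈ
          ⟨ v2 , v0 ⟩∈ᵈ suc (suc (suc (suc (suc ⊑)))) ∧ᵈ tripleᵈ (suc (suc (suc (suc (suc S))))) v2 v1 v4)))))))))

    forcesPairᵈ : ∀ {n} (⊑ S τ q a b : Fin n) → Definable {n} (λ ρ →
      ForcesPair (lookup ρ ⊑) (lookup ρ S) (lookup ρ τ) (lookup ρ q) (lookup ρ a) (lookup ρ b))
    forcesPairᵈ ⊑ S τ q a b = ∃ᵈ (orderedPairᵈ v0 (suc a) (suc b) ∧ᵈ (∃ᵈ (∃ᵈ (⟨ v1 , v0 ⟩∈ᵈ suc (suc (suc τ)) ∧ᵈ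
      ⟨ suc (suc (suc q)) , v0 ⟩∈ᵈ suc (suc (suc ⊑)) ∧ᵈ tripleᵈ (suc (suc (suc S))) (suc (suc (suc q))) v1 v2))))

  module _ (ℙ : ForcingNotion M) where
    open ForcingNotion ℙ renaming (≤ to ⊑)

    -- Confining names to `T` and values to `X` makes the forcing relation a set. The truth lemma
    -- rests on this fixed point equation, whichever solution `R` is.
    IsForcing : (T X R : Carrier) → Set ℓ
    IsForcing T X R = ∀ q σ x → Triple R q σ x ⇔ (q ∈ P × σ ∈ T × x ∈ X × Step ⊑ R q σ x)

    AreNames : Carrier → Set ℓ
    AreNames T = ∀ t → t ∈ T → IsRelation t T P

    abstract
      step-mono : ∀ {T X S S′ q σ x} → AreNames T → IsTransitive X → σ ∈ T → x ∈ X →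
        (∀ s τ y → s ∈ P → τ ∈ T → y ∈ X → Triple S s τ y → Triple S′ s τ y) →
        Step ⊑ S q σ x → Step ⊑ S′ q σ x
      step-mono names tr σ∈T x∈X S⊆S′ (forth , back) =
        (λ τ p τp∈σ r r≼q r≼p →
          let s , s≼r , y , y∈x , h = forth τ p τp∈σ r r≼q r≼p
          in s , s≼r , y , y∈x ,
             S⊆S′ s τ y (proj₁ (relation-sides relation s≼r)) (proj₁ (relation-sides (names _ σ∈T) τp∈σ)) (tr _ x∈X y y∈x) h) ,
        (λ y y∈x r r≼q →
          let s , s≼r , τ , p , τp∈σ , s≼p , h = back y y∈x r r≼q
          in s , s≼r , τ , p , τp∈σ , s≼p ,
             S⊆S′ s τ y (proj₁ (relation-sides relation s≼r)) (proj₁ (relation-sides (names _ σ∈T) τp∈σ)) (tr _ x∈X y y∈x) h)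

      triple-comprehension : ∀ {n} {Q : Vec Carrier (ℕ.suc (ℕ.suc (ℕ.suc n))) → Set ℓ} → Definable Q → ∀ ρ T X →
        ∃[ S ] (∀ q σ x → Triple S q σ x ⇔ (q ∈ P × σ ∈ T × x ∈ X × Q (x ∷ σ ∷ q ∷ ρ)))
      triple-comprehension {Q = Q} d ρ T X =
        let TX , TX⇔ = product T X
            S , _ , S⇔ = relation-comprehension (∃ᵈ (∃ᵈ (orderedPairᵈ v3 v1 v0 ∧ᵈ dropped d))) ρ P TX
        in S , λ q σ x → mk⇔ (λ (t , t≡ , qt∈S) → elim TX⇔ t≡ (to (S⇔ q t) qt∈S))
                 (λ (q∈P , σ∈T , x∈X , h) → let t , t≡ = orderedPair σ x in
                   t , t≡ , from (S⇔ q t) (q∈P , from (TX⇔ t) (σ , x , t≡ , σ∈T , x∈X) , σ , x , t≡ , h))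
        where
        dropped : ∀ {n} {Q : Vec Carrier (ℕ.suc (ℕ.suc (ℕ.suc n))) → Set ℓ} → Definable Q →
                  Definable {ℕ.suc (ℕ.suc (ℕ.suc (ℕ.suc n)))} (λ { (x ∷ σ ∷ q ∷ t ∷ ρ) → Q (x ∷ σ ∷ q ∷ ρ) })
        dropped d = definable (rename (λ { v0 → v0 ; v1 → v1 ; v2 → v2 ; (suc (suc (suc i))) → suc (suc (suc (suc i))) }) (formula d))
          λ { (x ∷ σ ∷ q ∷ t ∷ ρ) →
            let e = Sat-rename (formula d) {ρ = x ∷ σ ∷ q ∷ ρ} (λ { v0 → refl ; v1 → refl ; v2 → refl ; (suc (suc (suc i))) → refl })
            in mk⇔ (λ s → to (sat d _) (to e s)) (λ p → from e (from (sat d _) p)) }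
        elim : ∀ {TX t q σ x} → IsProduct TX T X → IsOrderedPair t σ x →
               q ∈ P × t ∈ TX × (∃[ σ′ ] ∃[ x′ ] (IsOrderedPair t σ′ x′ × Q (x′ ∷ σ′ ∷ q ∷ ρ))) →
               q ∈ P × σ ∈ T × x ∈ X × Q (x ∷ σ ∷ q ∷ ρ)
        elim {TX} {t} {q} {σ} {x} TX⇔ t≡ (q∈P , t∈TX , σ′ , x′ , t≡′ , h) = q∈P , proj₁ (sides (to (TX⇔ t) t∈TX)) , proj₂ (sides (to (TX⇔ t) t∈TX)) ,
          resp₂ d _ (proj₂ (orderedPair-injective t≡′ t≡)) (proj₁ (orderedPair-injective t≡′ t≡)) h
          where
          sides : (∃₂ λ a b → IsOrderedPair t a b × a ∈ T × b ∈ X) → σ ∈ T × x ∈ X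
          sides (a , b , t≡″ , a∈T , b∈X) =
            ∈-respˡ (proj₁ (orderedPair-injective t≡″ t≡)) a∈T , ∈-respˡ (proj₂ (orderedPair-injective t≡″ t≡)) b∈X

      -- Step is monotone in S, and R is its greatest fixed point.
      forcing-exists : ∀ T X → AreNames T → IsTransitive X → ∃[ R ] IsForcing T X R
      forcing-exists T X names tr = fixed (triple-comprehension
          (∃ᵈ ((∀ᵈ (∀ᵈ (∀ᵈ (tripleᵈ v3 v2 v1 v0 ⇒ᵈ stepᵈ v7 v3 v2 v1 v0)))) ∧ᵈ tripleᵈ v0 v3 v2 v1)) (⊑ ∷ []) T X)
        where
        Postfixed : Carrier → Set ℓ
        Postfixed S = ∀ q σ x → Triple S q σ x → Step ⊑ S q σ x
        fixed : (∃[ R ] (∀ q σ x → Triple R q σ x ⇔ (q ∈ P × σ ∈ T × x ∈ X × ∃[ S ] (Postfixed S × Triple S q σ x)))) →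
                ∃[ R ] IsForcing T X R
        fixed (R , R⇔) = R , λ q σ x → mk⇔ (post q σ x) (pre q σ x)
          where
          post : ∀ q σ x → Triple R q σ x → q ∈ P × σ ∈ T × x ∈ X × Step ⊑ R q σ x
          post q σ x h = go (to (R⇔ q σ x) h)
            where
            go : q ∈ P × σ ∈ T × x ∈ X × (∃[ S ] (Postfixed S × Triple S q σ x)) → q ∈ P × σ ∈ T × x ∈ X × Step ⊑ R q σ x
            go (q∈P , σ∈T , x∈X , S , S-post , h) = q∈P , σ∈T , x∈X ,
              step-mono names tr σ∈T x∈X (λ s τ y s∈P τ∈T y∈X k → from (R⇔ s τ y) (s∈P , τ∈T , y∈X , S , S-post , k)) (S-post q σ x h)
          -- As in the Knaster-Tarski theorem: the triples satisfying `Step ⊑ R` form a set `S` that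
          -- includes `R` by `post`. By monotonicity `S` is postfixed, hence included in `R`.
          pre : ∀ q σ x → q ∈ P × σ ∈ T × x ∈ X × Step ⊑ R q σ x → Triple R q σ x
          pre q σ x (q∈P , σ∈T , x∈X , h) = go (triple-comprehension (stepᵈ v3 v4 v2 v1 v0) (⊑ ∷ R ∷ []) T X)
            where
            go : (∃[ S ] (∀ q σ x → Triple S q σ x ⇔ (q ∈ P × σ ∈ T × x ∈ X × Step ⊑ R q σ x))) → Triple R q σ x
            go (S , S⇔) = from (R⇔ q σ x) (q∈P , σ∈T , x∈X , S , S-post , from (S⇔ q σ x) (q∈P , σ∈T , x∈X , h))
              where
              S-post : Postfixed S
              S-post q σ x k = let _ , σ∈T , x∈X , st = to (S⇔ q σ x) k in
                step-mono names tr σ∈T x∈X (λ s τ y _ _ _ j → from (S⇔ s τ y) (post s τ y j)) st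

      forcing-mono : ∀ {T X R q r σ x} → IsForcing T X R → r ≼ q → Triple R q σ x → Triple R r σ x
      forcing-mono {q = q} {r} {σ} {x} R⇔ r≼q h =
        let _ , σ∈T , x∈X , forth , back = to (R⇔ q σ x) h
        in from (R⇔ r σ x) (proj₁ (relation-sides relation r≼q) , σ∈T , x∈X ,
             (λ τ p τp∈σ s s≼r → forth τ p τp∈σ s (transitive s r q s≼r r≼q)) ,
             (λ y y∈x s s≼r → back y y∈x s (transitive s r q s≼r r≼q)))

      forcesPair-mono : ∀ {T X R τ q r a b} → IsForcing T X R → r ≼ q → ForcesPair ⊑ R τ q a b → ForcesPair ⊑ R τ r a b
      forcesPair-mono R⇔ r≼q (x , x≡ , σ , p , σp∈τ , q≼p , h) =
        x , x≡ , σ , p , σp∈τ , transitive _ _ _ r≼q q≼p , forcing-mono R⇔ r≼q h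

    -- The part of "τ is a function" that the covering argument uses. It is phrased by quantifying
    -- over conditions below `p`, so that no forcing relation for compound formulas has to be
    -- defined; its failure at `p` gives a `Multivalued` condition below `p`.
    Functional : (R τ p : Carrier) → Set ℓ
    Functional R τ p = ∀ r → r ≼ p → ∀ a b b′ → ForcesPair ⊑ R τ r a b → ForcesPair ⊑ R τ r a b′ → b ≈ b′

    Multivalued : (R τ p : Carrier) → Set ℓ
    Multivalued R τ p = ∃[ a ] ∃[ b ] ∃[ b′ ] (ForcesPair ⊑ R τ p a b × ForcesPair ⊑ R τ p a b′ × ¬ b ≈ b′)

    abstract
      functionality-dense : ∀ R τ → ∃[ D ] (IsDense D × (∀ p → p ∈ D → Multivalued R τ p ⊎ Functional R τ p))
      functionality-dense R τ = go (comprehension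
          ((∃ᵈ (∃ᵈ (∃ᵈ (forcesPairᵈ v4 v5 v6 v3 v2 v1 ∧ᵈ forcesPairᵈ v4 v5 v6 v3 v2 v0 ∧ᵈ (¬ᵈ (v1 ≈ᵈ v0))))))
          ∨ᵈ (∀ᵈ (⟨ v0 , v1 ⟩∈ᵈ v2 ⇒ᵈ (∀ᵈ (∀ᵈ (∀ᵈ (forcesPairᵈ v5 v6 v7 v3 v2 v1 ⇒ᵈ forcesPairᵈ v5 v6 v7 v3 v2 v0 ⇒ᵈ v1 ≈ᵈ v0)))))))
          (⊑ ∷ R ∷ τ ∷ []) P)
        where
        go : (∃[ D ] (∀ p → p ∈ D ⇔ (p ∈ P × (Multivalued R τ p ⊎ Functional R τ p)))) →
             ∃[ D ] (IsDense D × (∀ p → p ∈ D → Multivalued R τ p ⊎ Functional R τ p))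
        go (D , D⇔) = D , ((λ p p∈D → proj₁ (to (D⇔ p) p∈D)) , dense) , λ p p∈D → proj₂ (to (D⇔ p) p∈D)
          where
          dense : ∀ p → p ∈ P → ∃[ d ] (d ∈ D × d ≼ p)
          dense p p∈P with em {∃[ r ] (r ≼ p × Multivalued R τ r)}
          ... | yes (r , r≼p , bad) = r , from (D⇔ r) (proj₁ (relation-sides relation r≼p) , inj₁ bad) , r≼p
          ... | no none = p , from (D⇔ p) (p∈P , inj₂ λ r r≼p a b b′ h h′ →
                byContradiction λ b≉b′ → none (r , r≼p , a , b , b′ , h , h′ , b≉b′)) , reflexive p p∈P

      dense⇒predense : ∀ {D} → IsDense D → IsPredense D
      dense⇒predense (D⊆P , dense) = D⊆P , λ p p∈P →
        let d , d∈D , d≼p = dense p p∈P in d , d∈D , d , D⊆P d d∈D , d≼p , reflexive d (D⊆P d d∈D)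

    -- `CCC₃` concerns sets predense in all of `P`, not just below `p₀`. The second alternative
    -- takes in the conditions incompatible with `p₀`, for which it holds vacuously.
    Decides : (R τ p₀ a q : Carrier) → Set ℓ
    Decides R τ p₀ a q = (q ≼ p₀ × ∃[ b ] ForcesPair ⊑ R τ q a b)
                       ⊎ (∀ r → r ≼ q → r ≼ p₀ → ∀ b → ¬ ForcesPair ⊑ R τ r a b)

    abstract
      deciding-dense : ∀ R τ p₀ a → ∃[ D ] (IsDense D × (∀ q → q ∈ D → Decides R τ p₀ a q))
      deciding-dense R τ p₀ a = go (comprehension
          ((⟨ v0 , v1 ⟩∈ᵈ v2 ∧ᵈ (∃ᵈ (forcesPairᵈ v3 v4 v5 v1 v6 v0)))
          ∨ᵈ (∀ᵈ (⟨ v0 , v1 ⟩∈ᵈ v3 ⇒ᵈ ⟨ v0 , v2 ⟩∈ᵈ v3 ⇒ᵈ (∀ᵈ (¬ᵈ (forcesPairᵈ v4 v5 v6 v1 v7 v0))))))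
          (p₀ ∷ ⊑ ∷ R ∷ τ ∷ a ∷ []) P)
        where
        go : (∃[ D ] (∀ q → q ∈ D ⇔ (q ∈ P × Decides R τ p₀ a q))) → ∃[ D ] (IsDense D × (∀ q → q ∈ D → Decides R τ p₀ a q))
        go (D , D⇔) = D , ((λ q q∈D → proj₁ (to (D⇔ q) q∈D)) , dense) , λ q q∈D → proj₂ (to (D⇔ q) q∈D)
          where
          dense : ∀ q → q ∈ P → ∃[ d ] (d ∈ D × d ≼ q)
          dense q q∈P with em {∃[ r ] (r ≼ q × r ≼ p₀ × ∃[ b ] ForcesPair ⊑ R τ r a b)}
          ... | yes (r , r≼q , r≼p₀ , h) = r , from (D⇔ r) (proj₁ (relation-sides relation r≼q) , inj₁ (r≼p₀ , h)) , r≼q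
          ... | no none = q , from (D⇔ q) (q∈P , inj₂ λ r r≼q r≼p₀ b h → none (r , r≼q , r≼p₀ , b , h)) , reflexive q q∈P

      -- A condition forcing the value `b` is compatible with some `d` in the countable predense
      -- set. Then `d` forces a value too, and a common extension shows that it is `b`. So `b` is
      -- coded by the least index of such a `d`, and two values with the same `d` agree since `p₀`
      -- is `Functional`.
      possible-values-countable : ∀ {T X R τ p₀ a c} → CCC₃ → IsForcing T X R → Functional R τ p₀ →
        (∀ b → b ∈ c → ∃[ q ] (q ≼ p₀ × ForcesPair ⊑ R τ q a b)) → Countable c
      possible-values-countable {T} {X} {R} {τ} {p₀} {a} {c} ccc R⇔ functional possible = go (deciding-dense R τ p₀ a)
        where
        go : ∃[ D ] (IsDense D × (∀ q → q ∈ D → Decides R τ p₀ a q)) → Countable c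
        go (D , D-dense , decides) = count (ccc D (dense⇒predense D-dense))
          where
          count : ∃[ C ] (C ⊆ D × Countable C × IsPredense C) → Countable c
          count (C , C⊆D , (w , e , ωw@((ow , _) , _) , E , e-inj) , _ , predense) =
            let f , inj = Ordinals.least-≲ em M zf
                  (∃ᵈ (⟨ v0 , v1 ⟩∈ᵈ v3 ∧ᵈ ⟨ v0 , v4 ⟩∈ᵈ v5 ∧ᵈ forcesPairᵈ v5 v6 v7 v0 v8 v2))
                  (e ∷ p₀ ∷ ⊑ ∷ R ∷ τ ∷ a ∷ []) c ow total
                  (λ { b b′ n (d , dn∈e , d≼p₀ , h) (d′ , d′n∈e , d′≼p₀ , h′) →
                    functional d d≼p₀ a b b′ h (forces-resp (e-inj d′ d n d′n∈e dn∈e) h′) })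
            in w , f , ωw , inj
            where
            forces-resp : ∀ {d d′ b} → d ≈ d′ → ForcesPair ⊑ R τ d a b → ForcesPair ⊑ R τ d′ a b
            forces-resp {b = b} d≈d′ = resp₁ (forcesPairᵈ v1 v2 v3 v0 v4 v5) (⊑ ∷ R ∷ τ ∷ a ∷ b ∷ []) d≈d′
            Coded : Carrier → Set ℓ
            Coded b = ∃[ n ] (n ∈ w × ∃[ d ] (⟨ d , n ⟩∈ e × d ≼ p₀ × ForcesPair ⊑ R τ d a b))
            total : ∀ b → b ∈ c → Coded b
            total b b∈c = at (possible b b∈c)
              where
              at : (∃[ q ] (q ≼ p₀ × ForcesPair ⊑ R τ q a b)) → Coded b
              at (q , q≼p₀ , h) = meet (predense q (proj₁ (relation-sides relation q≼p₀)))
                where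
                meet : (∃[ d ] (d ∈ C × Compatible q d)) → Coded b
                meet (d , d∈C , r , r∈P , r≼q , r≼d) with decides d (C⊆D d d∈C) | function-total E d d∈C
                ... | inj₂ none | _ = ⊥-elim (none r r≼d (transitive r q p₀ r≼q q≼p₀) b (forcesPair-mono R⇔ r≼q h))
                ... | inj₁ (d≼p₀ , b′ , h′) | n , n∈w , dn∈e = n , n∈w , d , dn∈e , d≼p₀ ,
                  resp₁ (forcesPairᵈ v1 v2 v3 v5 v4 v0) (⊑ ∷ R ∷ τ ∷ a ∷ d ∷ [])
                    (functional r (transitive r q p₀ r≼q q≼p₀) a b′ b (forcesPair-mono R⇔ r≼d h′) (forcesPair-mono R⇔ r≼q h)) h′

-- Absoluteness between the ground model and the extension.

module Absoluteness {ℓ : Level} (em : ExcludedMiddle ℓ) (M : Structure ℓ) (zfᴹ : IsModelOfZF M)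
  (ℙ : ForcingNotion M) (E : GenericExtension M ℙ) where
  open GenericExtension E
  open SetTheory em M zfᴹ
  open Ordinals em M zfᴹ
  module 𝐍 where
    open SetTheory em N zf public
    open Ordinals em N zf public

  abstract
    -- The source of all absoluteness below: a quantifier bounded by `ι x` in the extension ranges
    -- over the images of the elements of `x`.
    ground : ∀ {x y} → y 𝐍.∈ ι x → ∃[ z ] (ι z 𝐍.≈ y × z ∈ x)
    ground {x} {y} y∈ιx = let z , ιz≈y = transitive-submodel x y y∈ιx in
      z , ιz≈y , from (ι-∈ z x) (𝐍.∈-respˡ (𝐍.sym ιz≈y) y∈ιx)

    ι-unorderedPair : ∀ {z x y} → IsUnorderedPair z x y → 𝐍.IsUnorderedPair (ι z) (ι x) (ι y)
    ι-unorderedPair {z} {x} {y} h w = mk⇔ (λ w∈ιz → fwd (ground w∈ιz)) bwd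
      where
      fwd : ∃[ v ] (ι v 𝐍.≈ w × v ∈ z) → w 𝐍.≈ ι x ⊎ w 𝐍.≈ ι y
      fwd (v , e , v∈z) with to (h v) v∈z
      ... | inj₁ v≈x = inj₁ (𝐍.trans (𝐍.sym e) (to (ι-≈ v x) v≈x))
      ... | inj₂ v≈y = inj₂ (𝐍.trans (𝐍.sym e) (to (ι-≈ v y) v≈y))
      bwd : w 𝐍.≈ ι x ⊎ w 𝐍.≈ ι y → w 𝐍.∈ ι z
      bwd (inj₁ e) = 𝐍.∈-respˡ (𝐍.sym e) (to (ι-∈ x z) (from (h x) (inj₁ refl)))
      bwd (inj₂ e) = 𝐍.∈-respˡ (𝐍.sym e) (to (ι-∈ y z) (from (h y) (inj₂ refl)))

    ι-orderedPair : ∀ {z x y} → IsOrderedPair z x y → 𝐍.IsOrderedPair (ι z) (ι x) (ι y)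
    ι-orderedPair (a , b , ha , hb , hz) = ι a , ι b , ι-unorderedPair ha , ι-unorderedPair hb , ι-unorderedPair hz

    ι-⟨,⟩∈ : ∀ {x y r} → ⟨ x , y ⟩∈ r ⇔ 𝐍.⟨ ι x , ι y ⟩∈ ι r
    ι-⟨,⟩∈ {x} {y} {r} = mk⇔ (λ (z , h , z∈r) → ι z , ι-orderedPair h , to (ι-∈ z r) z∈r)
      (λ xy∈r → let z , h = orderedPair x y in z , h , from (ι-∈ z r) (𝐍.pair∈ xy∈r (ι-orderedPair h)))

    ground-pair : ∀ {a b r x y} → IsRelation r x y → 𝐍.⟨ a , b ⟩∈ ι r →
                  ∃[ a′ ] ∃[ b′ ] (ι a′ 𝐍.≈ a × ι b′ 𝐍.≈ b × ⟨ a′ , b′ ⟩∈ r)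
    ground-pair {a} {b} {r} {x} {y} rel (z , z≡ab , z∈ιr) = go (ground z∈ιr)
      where
      go : ∃[ z′ ] (ι z′ 𝐍.≈ z × z′ ∈ r) → ∃[ a′ ] ∃[ b′ ] (ι a′ 𝐍.≈ a × ι b′ 𝐍.≈ b × ⟨ a′ , b′ ⟩∈ r)
      go (z′ , e , z′∈r) = let a′ , b′ , z′≡ , _ = rel z′ z′∈r
                               e₁ , e₂ = 𝐍.orderedPair-injective (𝐍.orderedPair-resp e 𝐍.refl 𝐍.refl (ι-orderedPair z′≡)) z≡ab
                           in a′ , b′ , e₁ , e₂ , z′ , z′≡ , z′∈r

    ι-function : ∀ {f x y} → IsFunction f x y → 𝐍.IsFunction (ι f) (ι x) (ι y)
    ι-function {f} {x} {y} F@(rel , _) = (λ z z∈ιf → related (ground z∈ιf)) , λ a a∈ιx → defined (ground a∈ιx)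
      where
      related : ∀ {z} → ∃[ z′ ] (ι z′ 𝐍.≈ z × z′ ∈ f) → ∃₂ λ a b → 𝐍.IsOrderedPair z a b × a 𝐍.∈ ι x × b 𝐍.∈ ι y
      related (z′ , e , z′∈f) = let a , b , z′≡ , a∈x , b∈y = rel z′ z′∈f in
        ι a , ι b , 𝐍.orderedPair-resp e 𝐍.refl 𝐍.refl (ι-orderedPair z′≡) , to (ι-∈ a x) a∈x , to (ι-∈ b y) b∈y
      defined : ∀ {a} → ∃[ a′ ] (ι a′ 𝐍.≈ a × a′ ∈ x) → ∃! 𝐍._≈_ λ b → 𝐍.⟨ a , b ⟩∈ ι f
      defined {a} (a′ , e , a′∈x) = at (function-total F a′ a′∈x)
        where
        at : ∃[ b ] (b ∈ y × ⟨ a′ , b ⟩∈ f) → ∃! 𝐍._≈_ λ b → 𝐍.⟨ a , b ⟩∈ ι f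
        at (b , b∈y , ab∈f) = ι b , 𝐍.⟨,⟩∈-resp e 𝐍.refl (to ι-⟨,⟩∈ ab∈f) , λ {c} ac∈ιf → same (ground-pair rel ac∈ιf)
          where
          same : ∀ {c} → ∃[ a″ ] ∃[ c′ ] (ι a″ 𝐍.≈ a × ι c′ 𝐍.≈ c × ⟨ a″ , c′ ⟩∈ f) → ι b 𝐍.≈ c
          same (a″ , c′ , e₁ , e₂ , a″c′∈f) = 𝐍.trans (to (ι-≈ b c′) (function-unique F ab∈f
            (⟨,⟩∈-resp (from (ι-≈ a″ a′) (𝐍.trans e₁ (𝐍.sym e))) refl a″c′∈f))) e₂

    ι-≤ : ∀ {x y} → x ≤ y → ι x 𝐍.≤ ι y
    ι-≤ (inj₁ x∈y) = inj₁ (to (ι-∈ _ _) x∈y)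
    ι-≤ (inj₂ x≈y) = inj₂ (to (ι-≈ _ _) x≈y)

    ι-cofinalMap : ∀ {μ δ} → HasCofinalMap μ δ → 𝐍.HasCofinalMap (ι μ) (ι δ)
    ι-cofinalMap {μ} {δ} (f , F , cofinal) = ι f , ι-function F , λ β β∈ιδ → go (ground β∈ιδ)
      where
      go : ∀ {β} → ∃[ β′ ] (ι β′ 𝐍.≈ β × β′ ∈ δ) → ∃₂ λ α γ → 𝐍.⟨ α , γ ⟩∈ ι f × (β 𝐍.∈ γ ⊎ β 𝐍.≈ γ)
      go (β′ , e , β′∈δ) = let α , γ , αγ∈f , β′≤γ = cofinal β′ β′∈δ in
        ι α , ι γ , to ι-⟨,⟩∈ αγ∈f , 𝐍.≤-resp e (ι-≤ β′≤γ)

    ι-ordinal : ∀ {α} → IsOrdinal α → 𝐍.IsOrdinal (ι α)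
    ι-ordinal {α} oα@(tr , _) = 𝐍.transitive∧total⇒ordinal
      (λ y y∈ z z∈y → sub (ground y∈) z∈y)
      (λ a b a∈ b∈ → compare (ground a∈) (ground b∈))
      where
      sub : ∀ {y z} → ∃[ y′ ] (ι y′ 𝐍.≈ y × y′ ∈ α) → z 𝐍.∈ y → z 𝐍.∈ ι α
      sub (y′ , e , y′∈α) z∈y = let z′ , e′ , z′∈y′ = ground (𝐍.∈-respʳ (𝐍.sym e) z∈y) in
        𝐍.∈-respˡ e′ (to (ι-∈ z′ α) (tr y′ y′∈α z′ z′∈y′))
      compare : ∀ {a b} → ∃[ a′ ] (ι a′ 𝐍.≈ a × a′ ∈ α) → ∃[ b′ ] (ι b′ 𝐍.≈ b × b′ ∈ α) → a 𝐍.∈ b ⊎ a 𝐍.≈ b ⊎ b 𝐍.∈ a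
      compare (a′ , e , a′∈α) (b′ , e′ , b′∈α) with ordinal-total oα a′ b′ a′∈α b′∈α
      ... | inj₁ p        = inj₁ (𝐍.∈-resp-≈ e e′ (to (ι-∈ a′ b′) p))
      ... | inj₂ (inj₁ p) = inj₂ (inj₁ (𝐍.trans (𝐍.sym e) (𝐍.trans (to (ι-≈ a′ b′) p) e′)))
      ... | inj₂ (inj₂ p) = inj₂ (inj₂ (𝐍.∈-resp-≈ e′ e (to (ι-∈ b′ a′) p)))

    ι-ordinal⁻¹ : ∀ {α} → 𝐍.IsOrdinal (ι α) → IsOrdinal α
    ι-ordinal⁻¹ {α} oα = transitive∧total⇒ordinal
      (λ y y∈α z z∈y → from (ι-∈ z α) (𝐍.ordinal-transitive oα (to (ι-∈ z y) z∈y) (to (ι-∈ y α) y∈α)))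
      (λ a b a∈α b∈α → compare a b (𝐍.ordinal-total oα (ι a) (ι b) (to (ι-∈ a α) a∈α) (to (ι-∈ b α) b∈α)))
      where
      compare : ∀ a b → ι a 𝐍.∈ ι b ⊎ ι a 𝐍.≈ ι b ⊎ ι b 𝐍.∈ ι a → a ∈ b ⊎ a ≈ b ⊎ b ∈ a
      compare a b (inj₁ p)        = inj₁ (from (ι-∈ a b) p)
      compare a b (inj₂ (inj₁ p)) = inj₂ (inj₁ (from (ι-≈ a b) p))
      compare a b (inj₂ (inj₂ p)) = inj₂ (inj₂ (from (ι-∈ b a) p))

    ι-successor : ∀ {s x} → IsSuccessorOf s x → 𝐍.IsSuccessorOf (ι s) (ι x)
    ι-successor {s} {x} h w = mk⇔ (λ w∈ιs → fwd (ground w∈ιs)) bwd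
      where
      fwd : ∃[ v ] (ι v 𝐍.≈ w × v ∈ s) → w 𝐍.∈ ι x ⊎ w 𝐍.≈ ι x
      fwd (v , e , v∈s) with to (h v) v∈s
      ... | inj₁ v∈x = inj₁ (𝐍.∈-respˡ e (to (ι-∈ v x) v∈x))
      ... | inj₂ v≈x = inj₂ (𝐍.trans (𝐍.sym e) (to (ι-≈ v x) v≈x))
      bwd : w 𝐍.∈ ι x ⊎ w 𝐍.≈ ι x → w 𝐍.∈ ι s
      bwd (inj₁ w∈ιx) = let v , e , v∈x = ground w∈ιx in 𝐍.∈-respˡ e (to (ι-∈ v s) (from (h v) (inj₁ v∈x)))
      bwd (inj₂ e) = 𝐍.∈-respˡ (𝐍.sym e) (to (ι-∈ x s) (from (h x) (inj₂ refl)))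

    ι-successor⁻¹ : ∀ {s x} → 𝐍.IsSuccessorOf (ι s) (ι x) → IsSuccessorOf s x
    ι-successor⁻¹ {s} {x} h w = mk⇔ (λ w∈s → fwd (to (h (ι w)) (to (ι-∈ w s) w∈s))) bwd
      where
      fwd : ι w 𝐍.∈ ι x ⊎ ι w 𝐍.≈ ι x → w ∈ x ⊎ w ≈ x
      fwd (inj₁ p) = inj₁ (from (ι-∈ w x) p)
      fwd (inj₂ p) = inj₂ (from (ι-≈ w x) p)
      bwd : w ∈ x ⊎ w ≈ x → w ∈ s
      bwd (inj₁ p) = from (ι-∈ w s) (from (h (ι w)) (inj₁ (to (ι-∈ w x) p)))
      bwd (inj₂ p) = from (ι-∈ w s) (from (h (ι w)) (inj₂ (to (ι-≈ w x) p)))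

    ι-limit : ∀ {δ} → IsLimitOrdinal δ → 𝐍.IsLimitOrdinal (ι δ)
    ι-limit {δ} (oδ , (γ , γ∈δ) , nosucc) = ι-ordinal oδ , (ι γ , to (ι-∈ γ δ) γ∈δ) , λ β h → absurd β h (ground (from (h β) (inj₂ 𝐍.refl)))
      where
      absurd : ∀ β → 𝐍.IsSuccessorOf (ι δ) β → ∃[ β′ ] (ι β′ 𝐍.≈ β × β′ ∈ δ) → ⊥
      absurd β h (β′ , e , _) = nosucc β′ (ι-successor⁻¹ λ w → 𝐍.resp (v0 𝐍.∈ᵈ v1 𝐍.⇔ᵈ (v0 𝐍.∈ᵈ v2 𝐍.∨ᵈ v0 𝐍.≈ᵈ v2))
        {w ∷ ι δ ∷ β ∷ []} {w ∷ ι δ ∷ ι β′ ∷ []} (λ { v0 → 𝐍.refl ; v1 → 𝐍.refl ; v2 → 𝐍.sym e }) (h w))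

    ι-limit⁻¹ : ∀ {δ} → 𝐍.IsLimitOrdinal (ι δ) → IsLimitOrdinal δ
    ι-limit⁻¹ {δ} (oδ , (γ , γ∈δ) , nosucc) = ι-ordinal⁻¹ oδ , (let γ′ , _ , γ′∈δ = ground γ∈δ in γ′ , γ′∈δ) ,
      λ β h → nosucc (ι β) (ι-successor h)

    ι-ω : ∀ {w} → Isω w → 𝐍.Isω (ι w)
    ι-ω {w} (lim , min) = ι-limit lim , λ n n∈ιw limn → let n′ , e , n′∈w = ground n∈ιw in
      min n′ n′∈w (ι-limit⁻¹ (𝐍.limit-resp (𝐍.sym e) limn))

-- Genericity and the values of names.

module GenericValues {ℓ : Level} (em : ExcludedMiddle ℓ) (M : Structure ℓ) (zfᴹ : IsModelOfZF M)
  (ℙ : ForcingNotion M) (E : GenericExtension M ℙ) where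
  open GenericExtension E
  open ForcingNotion ℙ renaming (≤ to ⊑)
  open SetTheory em M zfᴹ
  open ForcingRelation em M zfᴹ
  open CountableCovers em M zfᴹ using (CountableColumns)
  open Absoluteness em M zfᴹ ℙ E
  private module 𝐍F = ForcingRelation em N zf

  abstract
    ι-triple : ∀ {R q σ x} → Triple R q σ x ⇔ 𝐍F.Triple (ι R) (ι q) (ι σ) (ι x)
    ι-triple {R} {q} {σ} {x} = mk⇔ (λ (t , t≡ , qt∈R) → ι t , ι-orderedPair t≡ , to ι-⟨,⟩∈ qt∈R)
      (λ (t , t≡ , qt∈R) → let t′ , t′≡ = orderedPair σ x in
        t′ , t′≡ , from ι-⟨,⟩∈ (𝐍.⟨,⟩∈-resp 𝐍.refl (𝐍.orderedPair-unique t≡ (ι-orderedPair t′≡)) qt∈R))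

    below∈P : ∀ {q p} → q ≼ p → q ∈ P
    below∈P q≼p = proj₁ (relation-sides relation q≼p)

    -- Adding to `D` the conditions incompatible with `r` makes it dense. The filter cannot meet the
    -- added part, as it contains `r` and is directed.
    generic-below : ∀ {D r} → D ⊆ P → ι r 𝐍.∈ G → (∀ q → q ≼ r → ∃[ d ] (d ∈ D × d ≼ q)) → ∃[ d ] (d ∈ D × ι d 𝐍.∈ G)
    generic-below {D} {r} D⊆P r∈G dense = go (comprehension (v0 ∈ᵈ v1 ∨ᵈ (¬ᵈ (∃ᵈ (⟨ v0 , v1 ⟩∈ᵈ v3 ∧ᵈ ⟨ v0 , v4 ⟩∈ᵈ v3)))) (D ∷ ⊑ ∷ r ∷ []) P)
      where
      go : ∃[ D′ ] (∀ q → q ∈ D′ ⇔ (q ∈ P × (q ∈ D ⊎ ¬ (∃[ u ] (u ≼ q × u ≼ r))))) → ∃[ d ] (d ∈ D × ι d 𝐍.∈ G)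
      go (D′ , D′⇔) = met (G-generic D′ ((λ q q∈D′ → proj₁ (to (D′⇔ q) q∈D′)) , D′-dense))
        where
        D′-dense : ∀ p → p ∈ P → ∃[ d ] (d ∈ D′ × d ≼ p)
        D′-dense p p∈P with em {∃[ u ] (u ≼ p × u ≼ r)}
        ... | no none = p , from (D′⇔ p) (p∈P , inj₂ none) , reflexive p p∈P
        ... | yes (u , u≼p , u≼r) = let d , d∈D , d≼u = dense u u≼r in
          d , from (D′⇔ d) (below∈P d≼u , inj₁ d∈D) , transitive d u p d≼u u≼p
        met : ∃[ d ] (d ∈ D′ × ι d 𝐍.∈ G) → ∃[ d ] (d ∈ D × ι d 𝐍.∈ G)
        met (d , d∈D′ , d∈G) with proj₂ (to (D′⇔ d) d∈D′)
        ... | inj₁ d∈D  = d , d∈D , d∈G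
        ... | inj₂ none = let u , _ , u≼d , u≼r = G-directed d r d∈G r∈G in ⊥-elim (none (u , u≼d , u≼r))

    meets-below : ∀ {n} {Q : Vec Carrier (ℕ.suc n) → Set ℓ} → Definable Q → ∀ ρ {r} → ι r 𝐍.∈ G →
                  (∀ q → q ≼ r → ∃[ s ] (s ≼ q × Q (s ∷ ρ))) → ∃[ s ] (ι s 𝐍.∈ G × Q (s ∷ ρ))
    meets-below d ρ r∈G dense =
      let D , D⇔ = comprehension d ρ P
          s , s∈D , s∈G = generic-below (λ q q∈D → proj₁ (to (D⇔ q) q∈D)) r∈G λ q q≼r →
            let s , s≼q , h = dense q q≼r in s , from (D⇔ s) (below∈P s≼q , h) , s≼q
      in s , s∈G , proj₂ (to (D⇔ s) s∈D)

  -- The truth lemma for equality with ground model sets.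

  module Truth {T X R : Carrier} {T′ Y g : 𝐍.Carrier}
    (names : AreNames ℙ T) (X-transitive : IsTransitive X) (R⇔ : IsForcing ℙ T X R)
    (g-function : 𝐍.IsFunction g T′ Y)
    (T′-closed : ∀ t σ p → t 𝐍.∈ T′ → 𝐍.⟨ σ , p ⟩∈ t → σ 𝐍.∈ T′)
    (g-value : ∀ t y → 𝐍.⟨ t , y ⟩∈ g → ∀ w → w 𝐍.∈ y ⇔ (∃₂ λ σ p → p 𝐍.∈ G × 𝐍.⟨ σ , p ⟩∈ t × 𝐍.⟨ σ , w ⟩∈ g)) where

    -- All names are treated at once, because the induction on `x` passes from `σ` to the names
    -- occurring in it.
    TruthAt : Carrier → Set ℓ
    TruthAt x = ∀ σ → σ ∈ T → ι σ 𝐍.∈ T′ → (∃[ q ] (ι q 𝐍.∈ G × Triple R q σ x)) ⇔ 𝐍.⟨ ι σ , ι x ⟩∈ g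

    Member : Carrier → 𝐍.Carrier → Set ℓ
    Member σ w = ∃[ τ ] ∃[ p ] (⟨ τ , p ⟩∈ σ × ι p 𝐍.∈ G × τ ∈ T × ι τ 𝐍.∈ T′ × 𝐍.⟨ ι τ , w ⟩∈ g)

    abstract
      members : ∀ {σ y} → σ ∈ T → ι σ 𝐍.∈ T′ → 𝐍.⟨ ι σ , y ⟩∈ g → ∀ w → w 𝐍.∈ y ⇔ Member σ w
      members {σ} {y} σ∈T σ∈T′ σy∈g w = mk⇔ (λ w∈y → fwd (to (g-value (ι σ) y σy∈g w) w∈y))
        (λ (τ , p , τp∈σ , p∈G , _ , _ , τw∈g) → from (g-value (ι σ) y σy∈g w) (ι τ , ι p , p∈G , to ι-⟨,⟩∈ τp∈σ , τw∈g))
        where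
        fwd : (∃₂ λ τ p → p 𝐍.∈ G × 𝐍.⟨ τ , p ⟩∈ ι σ × 𝐍.⟨ τ , w ⟩∈ g) → Member σ w
        fwd (τ , p , p∈G , τp∈ισ , τw∈g) = rep (ground-pair (names σ σ∈T) τp∈ισ)
          where
          rep : ∃[ τ′ ] ∃[ p′ ] (ι τ′ 𝐍.≈ τ × ι p′ 𝐍.≈ p × ⟨ τ′ , p′ ⟩∈ σ) → Member σ w
          rep (τ′ , p′ , e , e′ , h) = τ′ , p′ , h , 𝐍.∈-respˡ (𝐍.sym e′) p∈G , proj₁ (relation-sides (names σ σ∈T) h) ,
            T′-closed (ι σ) (ι τ′) (ι p′) σ∈T′ (to ι-⟨,⟩∈ h) , 𝐍.⟨,⟩∈-resp (𝐍.sym e) 𝐍.refl τw∈g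

      common : ∀ {p q} → ι p 𝐍.∈ G → ι q 𝐍.∈ G → ∃[ r ] (ι r 𝐍.∈ G × r ≼ p × r ≼ q)
      common = G-directed _ _

      module _ {x : Carrier} (x∈X : x ∈ X) (ih : ∀ y → y ∈ x → TruthAt y)
        {σ : Carrier} (σ∈T : σ ∈ T) (σ∈T′ : ι σ 𝐍.∈ T′) where

        -- The two clauses of `Step` give the two inclusions between the value of `σ` and `x`. Each
        -- provides witnesses densely below a condition of `G`, and genericity picks one inside `G`.
        forced⇒true : ∃[ q ] (ι q 𝐍.∈ G × Triple R q σ x) → 𝐍.⟨ ι σ , ι x ⟩∈ g
        forced⇒true (q , q∈G , h) = conclude (to (R⇔ q σ x) h) (𝐍.function-total g-function (ι σ) σ∈T′)
          where
          conclude : q ∈ P × σ ∈ T × x ∈ X × Step ⊑ R q σ x → ∃[ y ] (y 𝐍.∈ Y × 𝐍.⟨ ι σ , y ⟩∈ g) → 𝐍.⟨ ι σ , ι x ⟩∈ g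
          conclude (_ , _ , _ , forth , back) (y , _ , σy∈g) = 𝐍.⟨,⟩∈-resp 𝐍.refl y≈ιx σy∈g
            where
            into : ∀ {w} → Member σ w → w 𝐍.∈ ι x
            into (τ , p , τp∈σ , p∈G , τ∈T , τ∈T′ , τw∈g) = at (common q∈G p∈G)
              where
              at : ∃[ r ] (ι r 𝐍.∈ G × r ≼ q × r ≼ p) → _ 𝐍.∈ ι x
              at (r , r∈G , r≼q , r≼p) =
                let s , s∈G , z , z∈x , k = meets-below (∃ᵈ (v0 ∈ᵈ v2 ∧ᵈ tripleᵈ v3 v1 v4 v0)) (x ∷ R ∷ τ ∷ []) r∈G
                      (λ u u≼r → forth τ p τp∈σ u (transitive u r q u≼r r≼q) (transitive u r p u≼r r≼p))
                in 𝐍.∈-respˡ (𝐍.function-unique g-function (to (ih z z∈x τ τ∈T τ∈T′) (s , s∈G , k)) τw∈g) (to (ι-∈ z x) z∈x)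
            onto : ∀ {w} → ∃[ z ] (ι z 𝐍.≈ w × z ∈ x) → Member σ w
            onto (z , e , z∈x) = at (meets-below
                (∃ᵈ (∃ᵈ (⟨ v1 , v0 ⟩∈ᵈ v3 ∧ᵈ ⟨ v2 , v0 ⟩∈ᵈ v4 ∧ᵈ tripleᵈ v5 v2 v1 v6))) (σ ∷ ⊑ ∷ R ∷ z ∷ []) q∈G (back z z∈x))
              where
              at : ∃[ s ] (ι s 𝐍.∈ G × ∃[ τ ] ∃[ p ] (⟨ τ , p ⟩∈ σ × s ≼ p × Triple R s τ z)) → Member σ _
              at (s , s∈G , τ , p , τp∈σ , s≼p , k) =
                let τ∈T = proj₁ (relation-sides (names σ σ∈T) τp∈σ)
                    τ∈T′ = T′-closed (ι σ) (ι τ) (ι p) σ∈T′ (to ι-⟨,⟩∈ τp∈σ)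
                in τ , p , τp∈σ , G-upward s p s≼p s∈G , τ∈T , τ∈T′ ,
                   𝐍.⟨,⟩∈-resp 𝐍.refl e (to (ih z z∈x τ τ∈T τ∈T′) (s , s∈G , k))
            y≈ιx : y 𝐍.≈ ι x
            y≈ιx = 𝐍.extensionality _ _ λ w → mk⇔ (λ w∈y → into (to (members σ∈T σ∈T′ σy∈g w) w∈y))
              (λ w∈ιx → from (members σ∈T σ∈T′ σy∈g w) (onto (ground w∈ιx)))

        -- The two ways to refute `σ = x` below `q`: a member named by `σ` that is never forced
        -- equal to an element of `x`, or an element of `x` that no member of `σ` is ever forced to
        -- equal. They are the negations of the two clauses of `Step`, moved to a stronger
        -- condition.
        Extra Missing : Carrier → Set ℓ
        Extra q = ∃[ τ ] ∃[ p ] (⟨ τ , p ⟩∈ σ × q ≼ p × (∀ s → s ≼ q → ∀ y → y ∈ x → ¬ Triple R s τ y))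
        Missing q = ∃[ y ] (y ∈ x × (∀ s → s ≼ q → ∀ τ p → ⟨ τ , p ⟩∈ σ → s ≼ p → ¬ Triple R s τ y))

        decision-dense : ∀ p → p ∈ P → ∃[ q ] (q ≼ p × (Triple R q σ x ⊎ Extra q ⊎ Missing q))
        decision-dense p p∈P with em {∃[ q ] (q ≼ p × (Extra q ⊎ Missing q))}
        ... | yes (q , q≼p , h) = q , q≼p , inj₂ h
        ... | no none = p , reflexive p p∈P , inj₁ (from (R⇔ p σ x) (p∈P , σ∈T , x∈X ,
          (λ τ p′ τp′∈σ r r≼p r≼p′ → byContradiction λ h → none (r , r≼p , inj₁ (τ , p′ , τp′∈σ , r≼p′ ,
            λ s s≼r y y∈x k → h (s , s≼r , y , y∈x , k)))) ,
          (λ y y∈x r r≼p → byContradiction λ h → none (r , r≼p , inj₂ (y , y∈x ,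
            λ s s≼r τ p′ τp′∈σ s≼p′ k → h (s , s≼r , τ , p′ , τp′∈σ , s≼p′ , k))))))

        -- `G` contains a condition that forces the equality or refutes it in the sense of `Extra`
        -- or `Missing`. By the induction hypothesis, a refutation in `G` would contradict the
        -- actual value of `σ`.
        true⇒forced : 𝐍.⟨ ι σ , ι x ⟩∈ g → ∃[ q ] (ι q 𝐍.∈ G × Triple R q σ x)
        true⇒forced σx∈g = start G-nonempty
          where
          not-extra : ∀ {q} → ι q 𝐍.∈ G → ¬ Extra q
          not-extra {q} q∈G (τ , p , τp∈σ , q≼p , none) = at (𝐍.function-total g-function (ι τ) τ∈T′)
            where
            τ∈T : τ ∈ T
            τ∈T = proj₁ (relation-sides (names σ σ∈T) τp∈σ)
            τ∈T′ : ι τ 𝐍.∈ T′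
            τ∈T′ = T′-closed (ι σ) (ι τ) (ι p) σ∈T′ (to ι-⟨,⟩∈ τp∈σ)
            clash : ∀ {y} → y ∈ x → ∃[ q′ ] (ι q′ 𝐍.∈ G × Triple R q′ τ y) → ⊥
            clash y∈x (q′ , q′∈G , k) = let s , _ , s≼q , s≼q′ = common q∈G q′∈G in
              none s s≼q _ y∈x (forcing-mono ℙ R⇔ s≼q′ k)
            at : ∃[ u ] (u 𝐍.∈ Y × 𝐍.⟨ ι τ , u ⟩∈ g) → ⊥
            at (u , _ , τu∈g) =
              let y , e , y∈x = ground (from (members σ∈T σ∈T′ σx∈g u) (τ , p , τp∈σ , G-upward q p q≼p q∈G , τ∈T , τ∈T′ , τu∈g))
              in clash y∈x (from (ih y y∈x τ τ∈T τ∈T′) (𝐍.⟨,⟩∈-resp 𝐍.refl (𝐍.sym e) τu∈g))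
          not-missing : ∀ {q} → ι q 𝐍.∈ G → ¬ Missing q
          not-missing {q} q∈G (y , y∈x , none) = at (to (members σ∈T σ∈T′ σx∈g (ι y)) (to (ι-∈ y x) y∈x))
            where
            at : Member σ (ι y) → ⊥
            at (τ , p , τp∈σ , p∈G , τ∈T , τ∈T′ , τy∈g) = clash (from (ih y y∈x τ τ∈T τ∈T′) τy∈g) (common q∈G p∈G)
              where
              clash : ∃[ q′ ] (ι q′ 𝐍.∈ G × Triple R q′ τ y) → ∃[ r ] (ι r 𝐍.∈ G × r ≼ q × r ≼ p) → ⊥
              clash (q′ , q′∈G , k) (r , r∈G , r≼q , r≼p) = let s , _ , s≼r , s≼q′ = common r∈G q′∈G in
                none s (transitive s r q s≼r r≼q) τ p τp∈σ (transitive s r p s≼r r≼p) (forcing-mono ℙ R⇔ s≼q′ k)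
          finish : ∃[ q ] (ι q 𝐍.∈ G × (Triple R q σ x ⊎ Extra q ⊎ Missing q)) → ∃[ q ] (ι q 𝐍.∈ G × Triple R q σ x)
          finish (q , q∈G , inj₁ h)        = q , q∈G , h
          finish (q , q∈G , inj₂ (inj₁ h)) = ⊥-elim (not-extra q∈G h)
          finish (q , q∈G , inj₂ (inj₂ h)) = ⊥-elim (not-missing q∈G h)
          start : ∃[ p ] (p 𝐍.∈ G) → ∃[ q ] (ι q 𝐍.∈ G × Triple R q σ x)
          start (p , p∈G) = let p′ , e , _ = ground (G⊆P p p∈G) in
            finish (meets-below (tripleᵈ v1 v0 v2 v3
                ∨ᵈ (∃ᵈ (∃ᵈ (⟨ v1 , v0 ⟩∈ᵈ v4 ∧ᵈ ⟨ v2 , v0 ⟩∈ᵈ v6 ∧ᵈ (∀ᵈ (⟨ v0 , v3 ⟩∈ᵈ v7 ⇒ᵈ (∀ᵈ (v0 ∈ᵈ v7 ⇒ᵈ (¬ᵈ (tripleᵈ v5 v1 v3 v0)))))))))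
                ∨ᵈ (∃ᵈ (v0 ∈ᵈ v4 ∧ᵈ (∀ᵈ (⟨ v0 , v2 ⟩∈ᵈ v6 ⇒ᵈ (∀ᵈ (∀ᵈ (⟨ v1 , v0 ⟩∈ᵈ v6 ⇒ᵈ ⟨ v2 , v0 ⟩∈ᵈ v8 ⇒ᵈ (¬ᵈ (tripleᵈ v5 v2 v1 v3))))))))))
              (R ∷ σ ∷ x ∷ ⊑ ∷ []) (𝐍.∈-respˡ (𝐍.sym e) p∈G) (λ q q≼p → decision-dense q (below∈P q≼p)))

      -- The statement mentions `G` and `g`, which exist only in the extension, so the induction has
      -- to run inside `N`. `TruthAtᴺ` is the internal form, definable from `ι T`, `T′`, `G`, `ι R`
      -- and `g`; `up` and `down` translate at elements of the ground model.
      truth : ∀ x → x ∈ X → TruthAt x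
      truth x x∈X σ σ∈T σ∈T′ = down x (inN (ι x) (to (ι-∈ x X) x∈X)) σ σ∈T σ∈T′
        where
        TruthAtᴺ : 𝐍.Carrier → Set ℓ
        TruthAtᴺ y = ∀ s → s 𝐍.∈ ι T → s 𝐍.∈ T′ → (∃[ q ] (q 𝐍.∈ G × 𝐍F.Triple (ι R) q s y)) ⇔ 𝐍.⟨ s , y ⟩∈ g
        truthᴺ : 𝐍.Definable {6} (λ ρ → ∀ s → s 𝐍.∈ lookup ρ v1 → s 𝐍.∈ lookup ρ v2 →
                   (∃[ q ] (q 𝐍.∈ lookup ρ v3 × 𝐍F.Triple (lookup ρ v4) q s (lookup ρ v0))) ⇔ 𝐍.⟨ s , lookup ρ v0 ⟩∈ lookup ρ v5)
        truthᴺ = 𝐍.∀ᵈ (v0 𝐍.∈ᵈ v2 𝐍.⇒ᵈ v0 𝐍.∈ᵈ v3 𝐍.⇒ᵈ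
          ((𝐍.∃ᵈ (v0 𝐍.∈ᵈ v5 𝐍.∧ᵈ 𝐍F.tripleᵈ v6 v0 v1 v2)) 𝐍.⇔ᵈ (𝐍.⟨ v0 , v1 ⟩∈ᵈ v6)))
        params : Vec 𝐍.Carrier 5
        params = ι T ∷ T′ ∷ G ∷ ι R ∷ g ∷ []
        down : ∀ y → TruthAtᴺ (ι y) → TruthAt y
        down y h σ σ∈T σ∈T′ = mk⇔
          (λ (q , q∈G , k) → to (h (ι σ) (to (ι-∈ σ T) σ∈T) σ∈T′) (ι q , q∈G , to ι-triple k))
          (λ σy∈g → lower (from (h (ι σ) (to (ι-∈ σ T) σ∈T) σ∈T′) σy∈g))
          where
          lower : ∃[ q ] (q 𝐍.∈ G × 𝐍F.Triple (ι R) q (ι σ) (ι y)) → ∃[ q ] (ι q 𝐍.∈ G × Triple R q σ y)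
          lower (q , q∈G , k) = let q′ , e , _ = ground (G⊆P q q∈G) in q′ , 𝐍.∈-respˡ (𝐍.sym e) q∈G ,
            from ι-triple (𝐍.resp₁ (𝐍F.tripleᵈ v1 v0 v2 v3) (ι R ∷ ι σ ∷ ι y ∷ []) (𝐍.sym e) k)
        up : ∀ y → TruthAt y → TruthAtᴺ (ι y)
        up y h s s∈ιT s∈T′ = rep (ground s∈ιT)
          where
          rep : ∃[ σ ] (ι σ 𝐍.≈ s × σ ∈ T) → (∃[ q ] (q 𝐍.∈ G × 𝐍F.Triple (ι R) q s (ι y))) ⇔ 𝐍.⟨ s , ι y ⟩∈ g
          rep (σ , e , σ∈T) = mk⇔
            (λ (q , q∈G , k) → 𝐍.⟨,⟩∈-resp e 𝐍.refl (to at (lower q q∈G k (ground (G⊆P q q∈G)))))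
            (λ sy∈g → raise (from at (𝐍.⟨,⟩∈-resp (𝐍.sym e) 𝐍.refl sy∈g)))
            where
            at : (∃[ q ] (ι q 𝐍.∈ G × Triple R q σ y)) ⇔ 𝐍.⟨ ι σ , ι y ⟩∈ g
            at = h σ σ∈T (𝐍.∈-respˡ (𝐍.sym e) s∈T′)
            lower : ∀ q → q 𝐍.∈ G → 𝐍F.Triple (ι R) q s (ι y) → ∃[ q′ ] (ι q′ 𝐍.≈ q × q′ ∈ P) → ∃[ q ] (ι q 𝐍.∈ G × Triple R q σ y)
            lower q q∈G k (q′ , e′ , _) = q′ , 𝐍.∈-respˡ (𝐍.sym e′) q∈G ,
              from ι-triple (𝐍.resp₂ (𝐍F.tripleᵈ v2 v0 v1 v3) (ι R ∷ ι y ∷ []) (𝐍.sym e′) (𝐍.sym e) k)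
            raise : ∃[ q ] (ι q 𝐍.∈ G × Triple R q σ y) → ∃[ q ] (q 𝐍.∈ G × 𝐍F.Triple (ι R) q s (ι y))
            raise (q , q∈G , k) = ι q , q∈G , 𝐍.resp₁ (𝐍F.tripleᵈ v1 v2 v0 v3) (ι R ∷ ι q ∷ ι y ∷ []) e (to ι-triple k)
        inN : ∀ y → y 𝐍.∈ ι X → TruthAtᴺ y
        inN = 𝐍.∈-induction truthᴺ params (ι X) λ y y∈ιX ih → step (ground y∈ιX) ih
          where
          step : ∀ {y} → ∃[ y′ ] (ι y′ 𝐍.≈ y × y′ ∈ X) → (∀ z → z 𝐍.∈ y → z 𝐍.∈ ι X → TruthAtᴺ z) → TruthAtᴺ y
          step (y′ , e , y′∈X) ih = 𝐍.resp₁ truthᴺ params e (up y′ λ σ σ∈T σ∈T′ →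
            mk⇔ (forced⇒true y′∈X ih′ σ∈T σ∈T′) (true⇒forced y′∈X ih′ σ∈T σ∈T′))
            where
            ih′ : ∀ z → z ∈ y′ → TruthAt z
            ih′ z z∈y′ = down z (ih (ι z) (𝐍.∈-respʳ e (to (ι-∈ z y′) z∈y′)) (to (ι-∈ z X) (X-transitive y′ y′∈X z z∈y′)))

-- Covering functions of the extension; cofinalities and cardinals.

module Preservation {ℓ : Level} (em : ExcludedMiddle ℓ) (M : Structure ℓ) (zfᴹ : IsModelOfZF M)
  (ℙ : ForcingNotion M) (ccc : ForcingNotion.CCC₃ ℙ) (E : GenericExtension M ℙ) where
  open GenericExtension E
  open ForcingNotion ℙ renaming (≤ to ⊑)
  open SetTheory em M zfᴹ
  open Ordinals em M zfᴹ
  open CountableCovers em M zfᴹ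
  open ForcingRelation em M zfᴹ
  open Absoluteness em M zfᴹ ℙ E
  open GenericValues em M zfᴹ ℙ E

  abstract
    -- The forcing relation needs a transitive set of values. Power sets of transitive sets are
    -- transitive, and the double power set of the union of `α` and `δ` contains all the pairs.
    pair-universe : ∀ {α δ} → IsTransitive α → IsTransitive δ →
      ∃[ X ] (IsTransitive X × (∀ z a b → IsOrderedPair z a b → a ∈ α → b ∈ δ → z ∈ X))
    pair-universe {α} {δ} trα trδ = go (binaryUnion α δ)
      where
      PairUniverse : Set ℓ
      PairUniverse = ∃[ X ] (IsTransitive X × (∀ z a b → IsOrderedPair z a b → a ∈ α → b ∈ δ → z ∈ X))
      go : ∃[ U ] (∀ z → z ∈ U ⇔ (z ∈ α ⊎ z ∈ δ)) → PairUniverse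
      go (U , U⇔) = square (powerset U)
        where
        trU : IsTransitive U
        trU y y∈U z z∈y with to (U⇔ y) y∈U
        ... | inj₁ y∈α = from (U⇔ z) (inj₁ (trα y y∈α z z∈y))
        ... | inj₂ y∈δ = from (U⇔ z) (inj₂ (trδ y y∈δ z z∈y))
        square : ∃[ V ] (∀ z → z ∈ V ⇔ z ⊆ U) → PairUniverse
        square (V , V⇔) = let X , X⇔ = powerset V in
          X , (λ y y∈X z z∈y → from (X⇔ z) λ u u∈z → from (V⇔ u) (trU u (to (V⇔ z) (to (X⇔ y) y∈X z z∈y) u u∈z))) ,
          λ z a b z≡ab a∈α b∈δ → from (X⇔ z) λ v v∈z →
            from (V⇔ v) (orderedPair⊆ z≡ab (from (U⇔ a) (inj₁ a∈α)) (from (U⇔ b) (inj₂ b∈δ)) v v∈z)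

  Covering : (f : 𝐍.Carrier) (α δ : Carrier) → Set ℓ
  Covering f α δ = ∃[ B ] (IsRelation B α δ × CountableColumns B α × (∀ ξ β → 𝐍.⟨ ι ξ , ι β ⟩∈ f → ⟨ ξ , β ⟩∈ B))

  module _ {α δ τ T X R : Carrier} {f T′ Y g : 𝐍.Carrier}
    (F : 𝐍.IsFunction f (ι α) (ι δ)) (τ∈T : τ ∈ T) (names : AreNames ℙ T)
    (X-transitive : IsTransitive X) (pairs : ∀ z a b → IsOrderedPair z a b → a ∈ α → b ∈ δ → z ∈ X)
    (R⇔ : IsForcing ℙ T X R)
    (g-function : 𝐍.IsFunction g T′ Y)
    (T′-closed : ∀ t σ p → t 𝐍.∈ T′ → 𝐍.⟨ σ , p ⟩∈ t → σ 𝐍.∈ T′)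
    (g-value : ∀ t y → 𝐍.⟨ t , y ⟩∈ g → ∀ w → w 𝐍.∈ y ⇔ (∃₂ λ σ p → p 𝐍.∈ G × 𝐍.⟨ σ , p ⟩∈ t × 𝐍.⟨ σ , w ⟩∈ g))
    (τf∈g : 𝐍.⟨ ι τ , f ⟩∈ g) where
    open Truth names X-transitive R⇔ g-function T′-closed g-value

    abstract
      sides : ∀ {a b} → 𝐍.⟨ ι a , ι b ⟩∈ f → a ∈ α × b ∈ δ
      sides {a} {b} ab∈f = let a∈ , b∈ = 𝐍.function-sides F ab∈f in from (ι-∈ a α) a∈ , from (ι-∈ b δ) b∈

      τ∈T′ : ι τ 𝐍.∈ T′
      τ∈T′ = proj₁ (𝐍.function-sides g-function τf∈g)

      pair⇒forced : ∀ {a b} → 𝐍.⟨ ι a , ι b ⟩∈ f → ∃[ q ] (ι q 𝐍.∈ G × ForcesPair ⊑ R τ q a b)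
      pair⇒forced {a} {b} ab∈f = go (orderedPair a b)
        where
        go : ∃[ x ] IsOrderedPair x a b → ∃[ q ] (ι q 𝐍.∈ G × ForcesPair ⊑ R τ q a b)
        go (x , x≡ab) = member (to (members τ∈T τ∈T′ τf∈g (ι x)) (𝐍.pair∈ ab∈f (ι-orderedPair x≡ab)))
          where
          member : Member τ (ι x) → ∃[ q ] (ι q 𝐍.∈ G × ForcesPair ⊑ R τ q a b)
          member (σ , p , σp∈τ , p∈G , σ∈T , σ∈T′ , σx∈g) =
            extend (from (truth x (pairs x a b x≡ab (proj₁ (sides ab∈f)) (proj₂ (sides ab∈f))) σ σ∈T σ∈T′) σx∈g)
            where
            extend : ∃[ q ] (ι q 𝐍.∈ G × Triple R q σ x) → ∃[ q ] (ι q 𝐍.∈ G × ForcesPair ⊑ R τ q a b)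
            extend (q , q∈G , h) = let r , r∈G , r≼q , r≼p = G-directed q p q∈G p∈G in
              r , r∈G , x , x≡ab , σ , p , σp∈τ , r≼p , forcing-mono ℙ R⇔ r≼q h

      forced⇒pair : ∀ {a b q} → ι q 𝐍.∈ G → ForcesPair ⊑ R τ q a b → 𝐍.⟨ ι a , ι b ⟩∈ f
      forced⇒pair {q = q} q∈G (x , x≡ab , σ , p , σp∈τ , q≼p , h) =
        let _ , σ∈T , x∈X , _ = to (R⇔ q σ x) h
            σ∈T′ = T′-closed (ι τ) (ι σ) (ι p) τ∈T′ (to ι-⟨,⟩∈ σp∈τ)
        in ι x , ι-orderedPair x≡ab , from (members τ∈T τ∈T′ τf∈g (ι x))
             (σ , p , σp∈τ , G-upward q p q≼p q∈G , σ∈T , σ∈T′ , to (truth x x∈X σ σ∈T σ∈T′) (q , q∈G , h))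

      -- A `Multivalued` condition in `G` would give `f` two values at one argument, so a condition
      -- of `G` in the dense set is `Functional`.
      functional-condition : ∃[ p₀ ] (ι p₀ 𝐍.∈ G × Functional ℙ R τ p₀)
      functional-condition = meet (functionality-dense ℙ R τ)
        where
        meet : ∃[ D ] (IsDense D × (∀ p → p ∈ D → Multivalued ℙ R τ p ⊎ Functional ℙ R τ p)) → ∃[ p₀ ] (ι p₀ 𝐍.∈ G × Functional ℙ R τ p₀)
        meet (D , dense , decided) = decide (G-generic D dense)
          where
          decide : ∃[ d ] (d ∈ D × ι d 𝐍.∈ G) → ∃[ p₀ ] (ι p₀ 𝐍.∈ G × Functional ℙ R τ p₀)
          decide (d , d∈D , d∈G) with decided d d∈D
          ... | inj₂ functional = d , d∈G , functional
          ... | inj₁ (a , b , b′ , h , h′ , b≉b′) =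
            ⊥-elim (b≉b′ (from (ι-≈ b b′) (𝐍.function-unique F (forced⇒pair d∈G h) (forced⇒pair d∈G h′))))

      name-covering : Covering f α δ
      name-covering = go functional-condition
        where
        go : ∃[ p₀ ] (ι p₀ 𝐍.∈ G × Functional ℙ R τ p₀) → Covering f α δ
        go (p₀ , p₀∈G , functional) = cover (relation-comprehension
            (∃ᵈ (⟨ v0 , v3 ⟩∈ᵈ v4 ∧ᵈ forcesPairᵈ v4 v5 v6 v0 v1 v2)) (p₀ ∷ ⊑ ∷ R ∷ τ ∷ []) α δ)
          where
          cover : ∃[ B ] (IsRelation B α δ × (∀ a b → ⟨ a , b ⟩∈ B ⇔
                    (a ∈ α × b ∈ δ × ∃[ q ] (q ≼ p₀ × ForcesPair ⊑ R τ q a b)))) → Covering f α δ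
          cover (B , rel , B⇔) = B , rel , (λ ξ ξ∈α → column ξ) , λ ξ β ξβ∈f → contains ξβ∈f (pair⇒forced ξβ∈f)
            where
            column : ∀ ξ → ∃[ c ] (Countable c × (∀ β → ⟨ ξ , β ⟩∈ B → β ∈ c))
            column ξ = let c , c⇔ = comprehension (⟨ v1 , v0 ⟩∈ᵈ v2) (ξ ∷ B ∷ []) δ in
              c , possible-values-countable ℙ ccc R⇔ functional
                    (λ b b∈c → proj₂ (proj₂ (to (B⇔ ξ b) (proj₂ (to (c⇔ b) b∈c))))) ,
              λ β ξβ∈B → from (c⇔ β) (proj₂ (relation-sides rel ξβ∈B) , ξβ∈B)
            contains : ∀ {ξ β} → 𝐍.⟨ ι ξ , ι β ⟩∈ f → ∃[ q ] (ι q 𝐍.∈ G × ForcesPair ⊑ R τ q ξ β) → ⟨ ξ , β ⟩∈ B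
            -- The forcing condition found in `G` need not lie below `p₀`; a common extension in `G`
            -- does and still forces the pair.
            contains {ξ} {β} ξβ∈f (q , q∈G , h) = let r , _ , r≼q , r≼p₀ = G-directed q p₀ q∈G p₀∈G in
              from (B⇔ ξ β) (proj₁ (sides ξβ∈f) , proj₂ (sides ξβ∈f) , r , r≼p₀ , forcesPair-mono ℙ R⇔ r≼q h)

  abstract
    covering : ∀ {f α δ} → IsTransitive α → IsTransitive δ → 𝐍.IsFunction f (ι α) (ι δ) → Covering f α δ
    covering {f} {α} {δ} trα trδ F = go (generated f) (pair-universe trα trδ)
      where
      go : ∃[ τ ] (IsName τ × IsValueOf N G (ι τ) f) →
           ∃[ X ] (IsTransitive X × (∀ z a b → IsOrderedPair z a b → a ∈ α → b ∈ δ → z ∈ X)) → Covering f α δ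
      go (τ , (T , τ∈T , names) , T′ , Y , g , g-function , T′-closed , g-value , τf∈g) (X , trX , pairs) =
        let R , R⇔ = forcing-exists ℙ T X names trX
        in name-covering F τ∈T names trX pairs R⇔ g-function T′-closed g-value τf∈g

    -- The cover leaves only the case of finite `μ`. Since `ω` and limit ordinals are absolute, the
    -- given map would then be a finite cofinal map into a limit ordinal of the extension.
    no-short-cofinal-map : ∀ {δ λ′ μ} → IsLimitOrdinal δ → IsCofinalityOf λ′ δ → μ ∈ λ′ → ¬ 𝐍.HasCofinalMap (ι μ) (ι δ)
    no-short-cofinal-map {δ} {λ′} {μ} lim@(oδ , _) cof@(oλ , _) μ∈λ map@(f , F , cofinal) =
      go (covering (proj₁ (∈-ordinal oλ μ∈λ)) (proj₁ oδ) F)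
      where
      go : Covering f μ δ → ⊥
      go (B , rel , countable , f⊆B) =
        let w , ωw , μ∈w = short-cofinal-cover⇒finite lim cof μ∈λ rel countable
              (λ β β∈δ → reach (cofinal (ι β) (to (ι-∈ β δ) β∈δ)))
        in 𝐍.no-finite-cofinal-map (ι-ω ωw) (ι-limit lim) (to (ι-∈ μ w) μ∈w) map
        where
        reach : ∀ {β} → (∃₂ λ a c → 𝐍.⟨ a , c ⟩∈ f × ι β 𝐍.≤ c) → ∃₂ λ ξ γ → ⟨ ξ , γ ⟩∈ B × β ≤ γ
        reach {β} (a , c , ac∈f , β≤c) =
          reps (ground (proj₁ (𝐍.function-sides F ac∈f))) (ground (proj₂ (𝐍.function-sides F ac∈f)))
          where
          le : ∀ {γ} → ι γ 𝐍.≈ c → ι β 𝐍.≤ c → β ≤ γ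
          le {γ} e (inj₁ β∈c) = inj₁ (from (ι-∈ β γ) (𝐍.∈-respʳ (𝐍.sym e) β∈c))
          le {γ} e (inj₂ β≈c) = inj₂ (from (ι-≈ β γ) (𝐍.trans β≈c (𝐍.sym e)))
          reps : ∃[ ξ ] (ι ξ 𝐍.≈ a × ξ ∈ μ) → ∃[ γ ] (ι γ 𝐍.≈ c × γ ∈ δ) → ∃₂ λ ξ γ → ⟨ ξ , γ ⟩∈ B × β ≤ γ
          reps (ξ , e , _) (γ , e′ , _) = ξ , γ , f⊆B ξ γ (𝐍.⟨,⟩∈-resp (𝐍.sym e) (𝐍.sym e′) ac∈f) , le e′ β≤c

    -- A cofinality can only drop, since a cofinal map of the ground model stays cofinal. A drop
    -- would be witnessed by a short cofinal map.
    cofinality-preserved : ∀ {δ λ′ μ} → IsLimitOrdinal δ → IsCofinalityOf λ′ δ → 𝐍.IsCofinalityOf μ (ι δ) → μ 𝐍.≈ ι λ′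
    cofinality-preserved {δ} {λ′} {μ} lim cof@(oλ , mapλ , _) (oμ , mapμ , minimal)
      with 𝐍.trichotomy oμ (ι-ordinal oλ)
    ... | inj₂ (inj₁ μ≈ιλ) = μ≈ιλ
    ... | inj₂ (inj₂ ιλ∈μ) = ⊥-elim (minimal (ι λ′) ιλ∈μ (ι-cofinalMap mapλ))
    ... | inj₁ μ∈ιλ = let μ′ , e , μ′∈λ = ground μ∈ιλ in
      ⊥-elim (no-short-cofinal-map lim cof μ′∈λ (𝐍.cofinalMap-resp (𝐍.sym e) 𝐍.refl mapμ))

    -- Being an infinite ordinal passes to the extension, so only initiality can fail.
    collapsing-bijection : ∀ {κ} → IsCardinal κ → ¬ 𝐍.IsCardinal (ι κ) → ∃[ α ] (α ∈ κ × ∃[ f ] 𝐍.IsBijection f (ι α) (ι κ))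
    collapsing-bijection {κ} (oκ , (w , ωw , w⊆κ) , _) collapsed = byContradiction λ none → collapsed
      ( ι-ordinal oκ
      , (ι w , ι-ω ωw , λ n n∈ιw → let n′ , e , n′∈w = ground n∈ιw in 𝐍.∈-respˡ e (to (ι-∈ n′ κ) (w⊆κ n′ n′∈w)))
      , λ { α α∈ικ (f , injection , surjective) → let α′ , e , α′∈κ = ground α∈ικ in
          none (α′ , α′∈κ , f , 𝐍.resp₁ (𝐍.injectionᵈ v1 v0 v2) (f ∷ ι κ ∷ []) (𝐍.sym e) injection , surjective) })

    cardinals-above-ω₁-preserved : ∀ {κ ω₁} → Isω₁ ω₁ → ω₁ ∈ κ → IsCardinal κ → 𝐍.IsCardinal (ι κ)
    cardinals-above-ω₁-preserved {κ} {ω₁} isω₁ ω₁∈κ card@(oκ , _) = byContradiction λ collapsed → go (collapsing-bijection card collapsed)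
      where
      go : ∃[ α ] (α ∈ κ × ∃[ f ] 𝐍.IsBijection f (ι α) (ι κ)) → ⊥
      go (α , α∈κ , f , (F , _) , surjective) = uncovered (covering (proj₁ (∈-ordinal oκ α∈κ)) (proj₁ oκ) F)
        where
        uncovered : Covering f α κ → ⊥
        uncovered (B , rel , countable , f⊆B) = no-countable-cover card isω₁ ω₁∈κ α∈κ rel countable λ β β∈κ →
          hit (surjective (ι β) (to (ι-∈ β κ) β∈κ))
          where
          hit : ∀ {β} → ∃[ a ] 𝐍.⟨ a , ι β ⟩∈ f → ∃[ ξ ] ⟨ ξ , β ⟩∈ B
          hit {β} (a , aβ∈f) = let ξ , e , _ = ground (proj₁ (𝐍.function-sides F aβ∈f)) in
            ξ , f⊆B ξ β (𝐍.⟨,⟩∈-resp (𝐍.sym e) 𝐍.refl aβ∈f)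

    countable-cardinal-≈ω : ∀ {κ w} → IsCardinal κ → Countable κ → Isω w → w ≈ κ
    countable-cardinal-≈ω {κ} {w} card@(oκ , (w′ , ωw′ , w′⊆κ) , _) (w″ , e , ωw″ , inj) ωw
      with ⊆⇒≤ (proj₁ (proj₁ ωw′)) oκ w′⊆κ
    ... | inj₂ w′≈κ = trans (ω-unique ωw ωw′) w′≈κ
    ... | inj₁ w′∈κ = ⊥-elim (cardinal-not-≲ card (∈-respˡ (ω-unique ωw′ ωw″) w′∈κ) (e , inj))

    -- Such a `κ` is `ω`. A bijection onto it from a smaller ordinal would be a finite cofinal map
    -- into a limit ordinal.
    countable-cardinals-preserved : ∀ {κ} → Countable κ → IsCardinal κ → 𝐍.IsCardinal (ι κ)
    countable-cardinals-preserved {κ} countable card@(oκ , (w , ωw , _) , _) = byContradiction λ collapsed → go (collapsing-bijection card collapsed)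
      where
      w≈κ : w ≈ κ
      w≈κ = countable-cardinal-≈ω card countable ωw
      go : ∃[ α ] (α ∈ κ × ∃[ f ] 𝐍.IsBijection f (ι α) (ι κ)) → ⊥
      go (α , α∈κ , f , bijection) = 𝐍.no-finite-cofinal-map (ι-ω ωw) (ι-limit (limit-resp w≈κ (proj₁ ωw)))
        (to (ι-∈ α w) (∈-respʳ (sym w≈κ) α∈κ)) (𝐍.bijection⇒cofinalMap bijection)

    -- A bijection from a smaller ordinal onto `ω₁` is in particular cofinal. As `ω₁` is its own
    -- cofinality, this is a short cofinal map, so the result on cofinalities applies where the
    -- embedding into `α × ω₁` is of no help.
    regular-ω₁-preserved : ∀ {κ ω₁} → IsRegular ω₁ → κ ≈ ω₁ → IsCardinal κ → 𝐍.IsCardinal (ι κ)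
    regular-ω₁-preserved {κ} {ω₁} (lim , cof) κ≈ω₁ card = byContradiction λ collapsed → go (collapsing-bijection card collapsed)
      where
      go : ∃[ α ] (α ∈ κ × ∃[ f ] 𝐍.IsBijection f (ι α) (ι κ)) → ⊥
      go (α , α∈κ , f , bijection) = no-short-cofinal-map lim cof (∈-respʳ κ≈ω₁ α∈κ)
        (𝐍.cofinalMap-resp 𝐍.refl (to (ι-≈ κ ω₁) κ≈ω₁) (𝐍.bijection⇒cofinalMap bijection))

    cardinals-preserved : ∀ {κ ω₁} → Isω₁ ω₁ → IsRegular ω₁ → IsCardinal κ → 𝐍.IsCardinal (ι κ)
    cardinals-preserved isω₁@(o₁ , _ , below) regular card with trichotomy (proj₁ card) o₁
    ... | inj₁ κ∈ω₁        = countable-cardinals-preserved (below _ κ∈ω₁) card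
    ... | inj₂ (inj₁ κ≈ω₁) = regular-ω₁-preserved regular κ≈ω₁ card
    ... | inj₂ (inj₂ ω₁∈κ) = cardinals-above-ω₁-preserved isω₁ ω₁∈κ card

corollary5p5 : ∀ {ℓ : Level} → ExcludedMiddle ℓ →
    (M : Structure ℓ) → IsModelOfZF M →
    (ℙ : ForcingNotion M) → ForcingNotion.CCC₃ ℙ →
    let open Structure M
        open Sets M
    in ∀ ω₁ → Isω₁ ω₁ →
       ( ¬ ChangesCofinalities M ℙ
       × (∀ κ → ω₁ ∈ κ → ¬ Collapses M ℙ κ) )
     × ( IsRegular ω₁ →
         ¬ ChangesCofinalities M ℙ
       × (∀ κ → ¬ Collapses M ℙ κ) )
corollary5p5 em M zf ℙ ccc ω₁ isω₁ =
    (cofinalities , λ κ ω₁∈κ (card , E , collapsed) →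
      collapsed (Preservation.cardinals-above-ω₁-preserved em M zf ℙ ccc E isω₁ ω₁∈κ card))
  , λ regular → cofinalities , λ κ (card , E , collapsed) →
      collapsed (Preservation.cardinals-preserved em M zf ℙ ccc E isω₁ regular card)
  where
  cofinalities : ¬ ChangesCofinalities M ℙ
  cofinalities (δ , λ′ , lim , cof , E , μ , cofᴺ , μ≉ιλ) =
    μ≉ιλ (Preservation.cofinality-preserved em M zf ℙ ccc E lim cof cofᴺ)
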